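{- $$\lim_{n\to\infty}\frac{t(4,n)}{r(4,n)}=0.$$
   Context: All graphs are finite and simple. In a graph $G=(V,E)$, a set $X\subseteq V$ is irredundant if every vertex $x\in X$ is either isolated in the induced subgraph $G[X]$, or has a private neighbor, i.e. a vertex $y\in V\setminus X$ adjacent to $x$ and to no other vertex of $X$. For a red-blue coloring of the edges of $K_N$, the blue (resp. red) subgraph is the spanning subgraph formed by the blue (resp. red) edges. The mixed Ramsey number $t(m,n)$ is the smallest $N$ such that every red-blue coloring of the edges of $K_N$ has an $m$-element irredundant set in the blue subgraph or an $n$-element independent set in the red subgraph. The Ramsey number $r(m,n)$ is the smallest $N$ such that every red-blue coloring of the edges of $K_N$ has an $m$-element independent set in the blue subgraph (equivalently, a red $K_m$) or an $n$-element independent set in the red subgraph (equivalently, a blue $K_n$). -}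

module Defs where

open import Data.Nat using (ℕ; _<_)
open import Data.Fin using (Fin)
open import Data.Bool using (Bool; true; false)
open import Data.Product using (Σ; ∃; _×_)
open import Data.Sum using (_⊎_)
open import Relation.Nullary using (¬_)
open import Relation.Binary.PropositionalEquality using (_≡_; _≢_)
open import Function.Definitions using (Injective)

-- A red-blue coloring of the edges of K_N: a symmetric map on pairs of
-- vertices (true = blue, false = red); diagonal values are irrelevant.
record Coloring (N : ℕ) : Set where
  field
    col : Fin N → Fin N → Bool
    col-sym : ∀ i j → col i j ≡ col j i
open Coloring public

Blue : ∀ {N} → Coloring N → Fin N → Fin N → Set
Blue c i j = i ≢ j × col c i j ≡ true

Red : ∀ {N} → Coloring N → Fin N → Fin N → Set
Red c i j = i ≢ j × col c i j ≡ false

Img : ∀ {m N} → (Fin m → Fin N) → Fin N → Set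
Img f v = ∃ λ i → f i ≡ v

Irredundant : ∀ {N} → (Fin N → Fin N → Set) → (Fin N → Set) → Set
Irredundant {N} G X =
  ∀ x → X x →
    (∀ y → X y → ¬ G x y)
    ⊎ (Σ (Fin N) λ y → ¬ X y × G x y × (∀ z → X z → G z y → z ≡ x))

Independent : ∀ {N} → (Fin N → Fin N → Set) → (Fin N → Set) → Set
Independent G X = ∀ x y → X x → X y → ¬ G x y

HasSet : ∀ N m → ((Fin N → Set) → Set) → Set
HasSet N m P = Σ (Fin m → Fin N) λ f → Injective _≡_ _≡_ f × P (Img f)

TProp : ℕ → ℕ → ℕ → Set
TProp m n N = (c : Coloring N) →
  HasSet N m (Irredundant (Blue c)) ⊎ HasSet N n (Independent (Red c))

RProp : ℕ → ℕ → ℕ → Set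
RProp m n N = (c : Coloring N) →
  HasSet N m (Independent (Blue c)) ⊎ HasSet N n (Independent (Red c))

IsLeast : (ℕ → Set) → ℕ → Set
IsLeast P N = P N × (∀ M → M < N → ¬ P M)

IsT : ℕ → ℕ → ℕ → Set
IsT m n T = IsLeast (TProp m n) T

IsR : ℕ → ℕ → ℕ → Set
IsR m n R = IsLeast (RProp m n) R

{-# OPTIONS --safe #-}
-- Write red edges as a graph.  Upper bound, n = u⁷: in a graph without a red K₄ and without a coned hexagon (each
-- gives a blue irredundant 4-set) the neighbourhood of a vertex contains no triangle and no hexagon.  There, for
-- non-adjacent c and v, the sets N(c) ∩ N(x), x ∈ N(v), form a chain under inclusion, so a single one of them contains
-- all vertices of N(c) with a neighbour in N(v).  Starting from vertices v₁, …, v_u whose neighbourhoods have small common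
-- parts, deleting few vertices from the union of the N(vᵢ) leaves an independent set; hence red degrees are O(u¹³) and
-- t(4,n) = O(u²⁰) = O(n^(20/7)).
--
-- Lower bound (after Mattheus and Verstraete): the lines meeting the Hermitian curve over F_{p²} contain no four lines
-- meeting pairwise in six distinct points of the curve (O'Nan).  Give every line a label in {0,1} at each point, and
-- join two lines meeting at P when their labels at P differ: the resulting graph on labelled lines has no K₄.
-- Taking all labels at once, rather than random ones, makes every set of labelled lines of density ≫ p⁻² span many
-- edges, so Kleitman–Winston counting bounds the independent n-tuples, and some sample of N ≈ n p² vertices contains no
-- independent n-set.  With p between n^(53/56) and n^(54/56), provided by Chebyshev's bound, this gives
-- r(4,n) ≥ c n^(162/56), and 162/56 > 20/7 = 160/56.
module Submission where

open import Defs
open import Algebra.Bundles using (CommutativeRing)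
import Algebra.Solver.Ring
open import Algebra.Solver.Ring.AlmostCommutativeRing using (_-Raw-AlmostCommutative⟶_; fromCommutativeRing)
open import Algebra.Structures using (IsCommutativeRing)
open import Data.Bool using (Bool; true; false; not; _∧_; _∨_; _xor_; T)
import Data.Bool
open import Data.Bool.Properties using (T?; xor-comm; ∧-comm; ∧-assoc)
open import Data.Empty using (⊥; ⊥-elim)
open import Data.Fin using (Fin; zero; suc)
import Data.Fin
import Data.Fin.Properties as Fin
import Data.Integer as ℤ
open ℤ using (ℤ; -[1+_]; ∣_∣)
import Data.Integer.Properties as ℤ
import Data.Integer.DivMod as ℤ
import Data.Integer.Divisibility.Signed as ℤ∣
import Data.Integer.Tactic.RingSolver as ℤ-Solver
open import Data.List using (List; []; _∷_; _++_; length; map; filterᵇ; tabulate; allFin; lookup; cartesianProduct)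
import Data.List.Properties as Listₚ
open import Data.List.Membership.Propositional using (_∈_)
open import Data.List.Membership.Propositional.Properties using (∈-allFin; ∈-∃++; ∈-lookup; ∈-filter⁻)
open import Data.List.Relation.Unary.All using (_∷_)
import Data.List.Relation.Unary.All as All
open import Data.List.Relation.Unary.Any using (here; there)
open import Data.List.Relation.Unary.AllPairs using ([]; _∷_)
open import Data.List.Relation.Unary.Unique.Propositional using (Unique)
import Data.List.Relation.Unary.Unique.Propositional.Properties as Unique
open import Data.List.Relation.Binary.Sublist.Propositional using (_⊆_; []; _∷_; _∷ʳ_; ⊆-refl; ⊆-trans)
open import Data.Maybe using (Maybe; just; nothing)
open import Data.Nat
open import Data.Nat.Properties
open import Data.Nat.Combinatorics using (_C_; nCk+nC[k+1]≡[n+1]C[k+1]; k>n⇒nCk≡0; nCk≡nC[n∸k]; nCn≡1)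
import Data.Nat.Coprimality as Coprimality
open import Data.Nat.Divisibility using (_∣_; _∣?_; divides; ∣-refl; ∣m+n∣m⇒∣n; ∣n⇒∣m*n; *-pres-∣; ∣⇒≤; m∣m*n; n∣m*n)
open import Data.Nat.DivMod using (m/n*n≤m; m≡m%n+[m/n]*n; m%n<n)
import Data.Nat.GCD as GCD
open import Data.Nat.Induction using (<-rec)
open import Data.Nat.Primality using (Prime; prime?; euclidsLemma; prime⇒irreducible; prime⇒nonTrivial; prime⇒nonZero)
open import Data.Nat.Primality.Factorisation using (factorise; PrimeFactorisation)
open import Data.Nat.Tactic.RingSolver using (solve-∀)
open import Data.Product using (Σ; ∃; _×_; _,_; proj₁; proj₂)
import Data.Product.Properties as Product
open import Data.Sum using (_⊎_; inj₁; inj₂)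
import Data.Sum
open import Data.Unit using (tt)
open import Data.Vec using (Vec; []; _∷_)
import Data.Vec as Vec
import Data.Vec.Properties as Vecₚ
open import Function using (_∘_; id)
open import Function.Definitions using (Injective)
open import Level using (0ℓ)
open import Relation.Binary.Definitions using (DecidableEquality)
open import Relation.Binary.PropositionalEquality using (_≡_; _≢_; refl; sym; trans; cong; cong₂; subst; subst₂; module ≡-Reasoning)
import Relation.Binary.Reasoning.Setoid
open import Relation.Nullary using (¬_; Dec; yes; no; does; contradiction)
open import Relation.Nullary.Decidable using (_×-dec_; _⊎-dec_; _→-dec_; ¬?; map′)

-- Sums and counts over lists

-- With p close to n the construction would give almost n³ vertices, so any power saving below n³
-- for t(4,n) decides the limit. Triangle-freeness of a red neighbourhood alone bounds red degrees
-- by about n²; the missing hexagons supply the saving, and the gap between 160 and 162 absorbs all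
-- constants and logarithms. A random labelling would call for concentration over all subsets of
-- lines. With every label vector present, a dense set cannot crowd around a single vector, because
-- Hamming balls are exponentially small; this replaces probability by counting. Samples are
-- likewise averaged as sums over all N-tuples, with denominators multiplied out. The upper end
-- 54/56 for p is forced by Kleitman-Winston: it makes about p log p rounds, each with polynomially
-- many choices, and the total number of choices has to stay below 2^n. The lower end 53/56 leaves
-- room for an elementary prime bound. The scale n = 2^(56 L) makes both u = n^(1/7) = 2^(8 L) and
-- the bounds on p powers of 2.

private variable
  𝓐 𝓑 : Set

⟦_⟧ : Bool → ℕ
⟦ true ⟧ = 1
⟦ false ⟧ = 0

∑ : List 𝓐 → (𝓐 → ℕ) → ℕ
∑ [] f = 0
∑ (x ∷ xs) f = f x + ∑ xs f

# : List 𝓐 → (𝓐 → Bool) → ℕ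
# xs p = ∑ xs (λ x → ⟦ p x ⟧)

∑-cong-∈ : ∀ (xs : List 𝓐) {f g} → (∀ x → x ∈ xs → f x ≡ g x) → ∑ xs f ≡ ∑ xs g
∑-cong-∈ [] h = refl
∑-cong-∈ (x ∷ xs) h = cong₂ _+_ (h x (here refl)) (∑-cong-∈ xs (λ y → h y ∘ there))

∑-cong : ∀ (xs : List 𝓐) {f g} → (∀ x → f x ≡ g x) → ∑ xs f ≡ ∑ xs g
∑-cong xs h = ∑-cong-∈ xs (λ x _ → h x)

∑-mono-∈ : ∀ (xs : List 𝓐) {f g} → (∀ x → x ∈ xs → f x ≤ g x) → ∑ xs f ≤ ∑ xs g
∑-mono-∈ [] h = z≤n
∑-mono-∈ (x ∷ xs) h = +-mono-≤ (h x (here refl)) (∑-mono-∈ xs (λ y → h y ∘ there))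

∑-mono : ∀ (xs : List 𝓐) {f g} → (∀ x → f x ≤ g x) → ∑ xs f ≤ ∑ xs g
∑-mono xs h = ∑-mono-∈ xs (λ x _ → h x)

∑-+ : ∀ (xs : List 𝓐) f g → ∑ xs (λ x → f x + g x) ≡ ∑ xs f + ∑ xs g
∑-+ [] f g = refl
∑-+ (x ∷ xs) f g rewrite ∑-+ xs f g = lem (f x) (g x) (∑ xs f) (∑ xs g)
  where
  lem : ∀ a b c d → (a + b) + (c + d) ≡ (a + c) + (b + d)
  lem = solve-∀

∑-*ˡ : ∀ (xs : List 𝓐) c f → ∑ xs (λ x → c * f x) ≡ c * ∑ xs f
∑-*ˡ [] c f = sym (*-zeroʳ c)
∑-*ˡ (x ∷ xs) c f rewrite ∑-*ˡ xs c f = sym (*-distribˡ-+ c (f x) (∑ xs f))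

∑-*ʳ : ∀ (xs : List 𝓐) c f → ∑ xs (λ x → f x * c) ≡ ∑ xs f * c
∑-*ʳ [] c f = refl
∑-*ʳ (x ∷ xs) c f rewrite ∑-*ʳ xs c f = sym (*-distribʳ-+ c (f x) (∑ xs f))

∑-const : ∀ (xs : List 𝓐) c → ∑ xs (λ _ → c) ≡ length xs * c
∑-const [] c = refl
∑-const (x ∷ xs) c = cong (c +_) (∑-const xs c)

∑-zero : ∀ (xs : List 𝓐) → ∑ xs (λ _ → 0) ≡ 0
∑-zero [] = refl
∑-zero (x ∷ xs) = ∑-zero xs

∑-swap : ∀ (xs : List 𝓐) (ys : List 𝓑) (f : 𝓐 → 𝓑 → ℕ) → ∑ xs (λ x → ∑ ys (f x)) ≡ ∑ ys (λ y → ∑ xs (λ x → f x y))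
∑-swap [] ys f = sym (∑-zero ys)
∑-swap (x ∷ xs) ys f = trans (cong (∑ ys (f x) +_) (∑-swap xs ys f)) (sym (∑-+ ys (f x) (λ y → ∑ xs (λ x₁ → f x₁ y))))

∑-++ : ∀ (xs ys : List 𝓐) f → ∑ (xs ++ ys) f ≡ ∑ xs f + ∑ ys f
∑-++ [] ys f = refl
∑-++ (x ∷ xs) ys f rewrite ∑-++ xs ys f = sym (+-assoc (f x) _ _)

∑-map : ∀ (g : 𝓐 → 𝓑) xs f → ∑ (map g xs) f ≡ ∑ xs (f ∘ g)
∑-map g [] f = refl
∑-map g (x ∷ xs) f = cong (f (g x) +_) (∑-map g xs f)

∑-tabulate : ∀ {n} (g : Fin n → 𝓐) f → ∑ (tabulate g) f ≡ ∑ (allFin n) (f ∘ g)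
∑-tabulate {n = zero} g f = refl
∑-tabulate {n = suc n} g f = cong (f (g zero) +_)
  (trans (∑-tabulate (g ∘ suc) f) (sym (∑-tabulate suc (f ∘ g))))

∑-allFin-suc : ∀ n f → ∑ (allFin (suc n)) f ≡ f zero + ∑ (allFin n) (f ∘ suc)
∑-allFin-suc n f = cong (f zero +_) (∑-tabulate suc f)

∑-lookup : ∀ (xs : List 𝓐) f → ∑ (allFin (length xs)) (f ∘ lookup xs) ≡ ∑ xs f
∑-lookup [] f = refl
∑-lookup (x ∷ xs) f = trans (∑-allFin-suc (length xs) (f ∘ lookup (x ∷ xs))) (cong (f x +_) (∑-lookup xs f))

length-filterᵇ : ∀ (p : 𝓐 → Bool) xs → length (filterᵇ p xs) ≡ # xs p
length-filterᵇ p [] = refl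
length-filterᵇ p (x ∷ xs) with p x
... | true = cong suc (length-filterᵇ p xs)
... | false = length-filterᵇ p xs

∑-filterᵇ : ∀ (p : 𝓐 → Bool) xs f → ∑ (filterᵇ p xs) f ≡ ∑ xs (λ x → ⟦ p x ⟧ * f x)
∑-filterᵇ p [] f = refl
∑-filterᵇ p (x ∷ xs) f with p x
... | true = cong₂ _+_ (sym (+-identityʳ (f x))) (∑-filterᵇ p xs f)
... | false = ∑-filterᵇ p xs f

∑-⊆ : ∀ {xs ys : List 𝓐} → xs ⊆ ys → ∀ f → ∑ xs f ≤ ∑ ys f
∑-⊆ [] f = z≤n
∑-⊆ (y ∷ʳ s) f = ≤-trans (∑-⊆ s f) (m≤n+m _ (f y))
∑-⊆ (refl ∷ s) f = +-monoʳ-≤ (f _) (∑-⊆ s f)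

∈-≤-∑ : ∀ {x : 𝓐} {xs} → x ∈ xs → ∀ f → f x ≤ ∑ xs f
∈-≤-∑ (here refl) f = m≤m+n _ _
∈-≤-∑ {xs = y ∷ xs} (there i) f = ≤-trans (∈-≤-∑ i f) (m≤n+m _ (f y))

∑<⇒∃ : ∀ (xs : List 𝓐) c f → ∑ xs f < c * length xs → ∃ λ x → x ∈ xs × f x < c
∑<⇒∃ [] c f h = contradiction (subst (0 <_) (*-zeroʳ c) h) λ ()
∑<⇒∃ (x ∷ xs) c f h with f x <? c
... | yes q = x , here refl , q
... | no q with ∑<⇒∃ xs c f (+-cancelˡ-< c _ _ (≤-<-trans (+-monoˡ-≤ _ (≮⇒≥ q)) (subst (f x + ∑ xs f <_) (*-suc c (length xs)) h)))
... | y , i , r = y , there i , r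

#-total : ∀ (xs : List 𝓐) p → # xs p + # xs (not ∘ p) ≡ length xs
#-total [] p = refl
#-total (x ∷ xs) p with p x
... | true = cong suc (#-total xs p)
... | false = trans (+-suc (# xs p) _) (cong suc (#-total xs p))

⟦⟧-mono : ∀ {a b} → (a ≡ true → b ≡ true) → ⟦ a ⟧ ≤ ⟦ b ⟧
⟦⟧-mono {false} h = z≤n
⟦⟧-mono {true} h rewrite h refl = ≤-refl

⟦∨⟧≤ : ∀ a b → ⟦ a ∨ b ⟧ ≤ ⟦ a ⟧ + ⟦ b ⟧
⟦∨⟧≤ true b = s≤s z≤n
⟦∨⟧≤ false b = ≤-refl

⟦∧⟧ : ∀ a b → ⟦ a ∧ b ⟧ ≡ ⟦ a ⟧ * ⟦ b ⟧
⟦∧⟧ true b = sym (+-identityʳ _)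
⟦∧⟧ false b = refl

#-mono : ∀ (xs : List 𝓐) {p q} → (∀ x → p x ≡ true → q x ≡ true) → # xs p ≤ # xs q
#-mono xs h = ∑-mono xs (λ x → ⟦⟧-mono (h x))

#-∨ : ∀ (xs : List 𝓐) p q → # xs (λ x → p x ∨ q x) ≤ # xs p + # xs q
#-∨ xs p q = ≤-trans (∑-mono xs (λ x → ⟦∨⟧≤ (p x) (q x))) (≤-reflexive (∑-+ xs _ _))

#-pos : ∀ {x : 𝓐} {xs p} → x ∈ xs → p x ≡ true → 1 ≤ # xs p
#-pos {x = x} {xs} {p} i h = ≤-trans (≤-reflexive (cong ⟦_⟧ (sym h))) (∈-≤-∑ i (λ x → ⟦ p x ⟧))

#-witness : ∀ (xs : List 𝓐) p → 1 ≤ # xs p → ∃ λ x → x ∈ xs × p x ≡ true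
#-witness (x ∷ xs) p h with p x in eq
... | true = x , here refl , eq
... | false with #-witness xs p h
... | y , i , r = y , there i , r

#-none : ∀ (xs : List 𝓐) p → (∀ x → x ∈ xs → ¬ p x ≡ true) → # xs p ≡ 0
#-none [] p h = refl
#-none (x ∷ xs) p h with p x in eq
... | true = contradiction eq (h x (here refl))
... | false = #-none xs p (λ y → h y ∘ there)

#-≤1 : ∀ (xs : List 𝓐) p → Unique xs → (∀ x y → x ∈ xs → y ∈ xs → p x ≡ true → p y ≡ true → x ≡ y) → # xs p ≤ 1
#-≤1 [] p u h = z≤n
#-≤1 (x ∷ xs) p (x∉ ∷ u) h with p x in eq
... | false = #-≤1 xs p u (λ y z i j → h y z (there i) (there j))
... | true = s≤s (≤-reflexive (#-none xs p λ y i q → All.lookup x∉ i (h x y (here refl) (there i) eq q)))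

any? : List 𝓐 → (𝓐 → Bool) → Bool
any? [] p = false
any? (x ∷ xs) p = p x ∨ any? xs p

any?-⁺ : ∀ {x : 𝓐} {xs} p → x ∈ xs → p x ≡ true → any? xs p ≡ true
any?-⁺ p (here refl) h rewrite h = refl
any?-⁺ {xs = y ∷ ys} p (there i) h with p y
... | true = refl
... | false = any?-⁺ p i h

any?-⁻ : ∀ (xs : List 𝓐) p → any? xs p ≡ true → ∃ λ x → x ∈ xs × p x ≡ true
any?-⁻ (x ∷ xs) p h with p x in eq
... | true = x , here refl , eq
... | false with any?-⁻ xs p h
... | y , i , r = y , there i , r

#≤any? : ∀ (xs : List 𝓐) p → # xs p ≤ 1 → # xs p ≤ ⟦ any? xs p ⟧
#≤any? xs p h with # xs p in eq
... | zero = z≤n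
... | suc _ with #-witness xs p (subst (1 ≤_) (sym eq) (s≤s z≤n))
... | x , i , r rewrite any?-⁺ p i r = h

#-any? : ∀ (xs : List 𝓐) (ys : List 𝓑) (p : 𝓐 → 𝓑 → Bool) → # xs (λ x → any? ys (p x)) ≤ ∑ ys (λ y → # xs (λ x → p x y))
#-any? xs [] p = ≤-reflexive (∑-zero xs)
#-any? xs (y ∷ ys) p = ≤-trans (#-∨ xs (λ x → p x y) _) (+-monoʳ-≤ _ (#-any? xs ys p))

-- Induction on the list: the new cross term `2 * (a * s)` is distributed over the entries and each
-- summand is bounded by AM-GM.
cauchy : ∀ (xs : List 𝓐) f → ∑ xs f * ∑ xs f ≤ length xs * ∑ xs (λ x → f x * f x)
cauchy [] f = z≤n
cauchy (x ∷ xs) f = begin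
  (a + s) * (a + s)  ≡⟨ e₁ a s ⟩
  a * a + s * s + 2 * (a * s)  ≤⟨ +-mono-≤ (+-monoʳ-≤ (a * a) (cauchy xs f)) cross ⟩
  a * a + l * q + (l * (a * a) + q)    ≡⟨ e₂ (a * a) l q ⟩
  suc l * (a * a + q)  ∎
  where
  open ≤-Reasoning
  a = f x
  s = ∑ xs f
  l = length xs
  q = ∑ xs (λ y → f y * f y)
  e₁ : ∀ a s → (a + s) * (a + s) ≡ a * a + s * s + 2 * (a * s)
  e₁ = solve-∀
  e₂ : ∀ b l q → b + l * q + (l * b + q) ≡ (1 + l) * (b + q)
  e₂ = solve-∀
  amgm : ∀ x y → 2 * (x * y) ≤ x * x + y * y
  amgm zero y = z≤n
  amgm (suc x) zero = subst (_≤ suc x * suc x + 0) (sym (cong (2 *_) (*-zeroʳ (suc x)))) z≤n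
  amgm (suc x) (suc y) = subst₂ _≤_ (e₃ x y) (e₄ x y) (+-monoˡ-≤ (2 + 2 * x + 2 * y) (amgm x y))
    where
    e₃ : ∀ x y → 2 * (x * y) + (2 + 2 * x + 2 * y) ≡ 2 * ((1 + x) * (1 + y))
    e₃ = solve-∀
    e₄ : ∀ x y → x * x + y * y + (2 + 2 * x + 2 * y) ≡ (1 + x) * (1 + x) + (1 + y) * (1 + y)
    e₄ = solve-∀
  cross : 2 * (a * s) ≤ l * (a * a) + q
  cross = begin
    2 * (a * s)  ≡⟨ e₅ a s ⟩
    2 * a * s  ≡⟨ ∑-*ˡ xs (2 * a) f ⟨
    ∑ xs (λ y → 2 * a * f y)  ≤⟨ ∑-mono xs (λ y → ≤-trans (≤-reflexive (sym (e₅ a (f y)))) (amgm a (f y))) ⟩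
    ∑ xs (λ y → a * a + f y * f y)  ≡⟨ ∑-+ xs (λ _ → a * a) (λ y → f y * f y) ⟩
    ∑ xs (λ _ → a * a) + q  ≡⟨ cong (_+ q) (∑-const xs (a * a)) ⟩
    l * (a * a) + q ∎
    where
    e₅ : ∀ a s → 2 * (a * s) ≡ 2 * a * s
    e₅ = solve-∀

allFin-unique : ∀ n → Unique (allFin n)
allFin-unique n = Unique.allFin⁺ n

does⇒ : ∀ {P : Set} (d : Dec P) → does d ≡ true → P
does⇒ (yes p) h = p

⇒does : ∀ {P : Set} (d : Dec P) → P → does d ≡ true
⇒does (yes p) q = refl
⇒does (no np) q = contradiction q np

∧-⁻ : ∀ {a b} → a ∧ b ≡ true → a ≡ true × b ≡ true
∧-⁻ {true} h = refl , h

∧-⁺ : ∀ {a b} → a ≡ true → b ≡ true → a ∧ b ≡ true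
∧-⁺ refl h = h

∨-⁻ : ∀ {a b} → a ∨ b ≡ true → a ≡ true ⊎ b ≡ true
∨-⁻ {true} h = inj₁ refl
∨-⁻ {false} h = inj₂ h

not-⁻ : ∀ {a} → not a ≡ true → a ≡ false
not-⁻ {false} h = refl

≢true : ∀ {a} → ¬ a ≡ true → a ≡ false
≢true {false} h = refl
≢true {true} h = contradiction refl h

true≢false : ∀ {a} {X : Set} → a ≡ true → a ≡ false → X
true≢false refl ()

≢false : ∀ {a} → ¬ a ≡ false → a ≡ true
≢false {true} h = refl
≢false {false} h = contradiction refl h

-- Counting independent tuples

filterᵇ-comm : ∀ {A : Set} (p q : A → Bool) xs → filterᵇ p (filterᵇ q xs) ≡ filterᵇ q (filterᵇ p xs)
filterᵇ-comm p q [] = refl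
filterᵇ-comm p q (x ∷ xs) with p x in ep | q x in eq
... | true  | true  rewrite ep | eq = cong (x ∷_) (filterᵇ-comm p q xs)
... | true  | false rewrite eq = filterᵇ-comm p q xs
... | false | true  rewrite ep = filterᵇ-comm p q xs
... | false | false = filterᵇ-comm p q xs

filterᵇ-⊆ : ∀ {A : Set} (p : A → Bool) xs → filterᵇ p xs ⊆ xs
filterᵇ-⊆ p [] = []
filterᵇ-⊆ p (x ∷ xs) with p x
... | true = refl ∷ filterᵇ-⊆ p xs
... | false = x ∷ʳ filterᵇ-⊆ p xs

++-∷-⊆ : ∀ {A : Set} (xs : List A) v ys → (xs ++ ys) ⊆ (xs ++ v ∷ ys)
++-∷-⊆ [] v ys = v ∷ʳ ⊆-refl
++-∷-⊆ (x ∷ xs) v ys = refl ∷ ++-∷-⊆ xs v ys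

∑-insert : ∀ {A : Set} (xs : List A) v ys f → ∑ (xs ++ v ∷ ys) f ≡ f v + ∑ (xs ++ ys) f
∑-insert [] v ys f = refl
∑-insert (x ∷ xs) v ys f rewrite ∑-insert xs v ys f = lem (f x) (f v) _
  where
  lem : ∀ a b c → a + (b + c) ≡ b + (a + c)
  lem = solve-∀

module _ {V : Set} (adj : V → V → Bool) where

  infixl 6 _∖_
  _∖_ : List V → V → List V
  xs ∖ v = filterᵇ (not ∘ adj v) xs

  -- The number of n-tuples of pairwise non-adjacent entries; an entry may be repeated.
  ind : ℕ → List V → ℕ
  ind zero xs = 1
  ind (suc n) xs = ∑ xs (λ v → ind n (xs ∖ v))

  length-∖ : ∀ xs v → length (xs ∖ v) ≤ length xs
  length-∖ xs v = Listₚ.length-filter (T? ∘ (not ∘ adj v)) xs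

  ind≤^ : ∀ n xs → ind n xs ≤ length xs ^ n
  ind≤^ zero xs = ≤-refl
  ind≤^ (suc n) xs = ≤-trans
    (∑-mono xs (λ v → ≤-trans (ind≤^ n (xs ∖ v)) (^-monoˡ-≤ n (length-∖ xs v))))
    (≤-reflexive (∑-const xs _))

  module _ (adj-sym : ∀ u v → adj u v ≡ adj v u) where

    -- A tuple avoids the listed entry `v`, or has it at one of `suc n` positions; erasing that
    -- position leaves a tuple of non-neighbours of `v`. Since entries may repeat, `v` itself stays
    -- available for the remaining positions unless it is adjacent to itself.
    ind-remove : ∀ n xs v ys →
      ind (suc n) (xs ++ v ∷ ys) ≤ ind (suc n) (xs ++ ys) + suc n * ind n ((xs ++ v ∷ ys) ∖ v)
    ind-remove zero xs v ys = ≤-reflexive (trans (∑-insert xs v ys (λ _ → 1)) (+-comm 1 _))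
    ind-remove (suc m) xs v ys = begin
      ind (2 + m) A  ≡⟨ ∑-insert xs v ys f ⟩
      f v + ∑ R f  ≤⟨ +-monoʳ-≤ (f v) (∑-mono R pointwise) ⟩
      f v + ∑ R (λ u → ind (suc m) (R ∖ u) + ⟦ not (adj v u) ⟧ * (suc m * h u))
        ≡⟨ cong (f v +_) (∑-+ R _ _) ⟩
      f v + (ind (2 + m) R + ∑ R (λ u → ⟦ not (adj v u) ⟧ * (suc m * h u)))
        ≤⟨ +-monoʳ-≤ (f v) (+-monoʳ-≤ (ind (2 + m) R) tail) ⟩
      f v + (ind (2 + m) R + suc m * f v)  ≡⟨ rearrange (f v) (ind (2 + m) R) (suc m * f v) ⟩
      ind (2 + m) R + suc (suc m) * f v  ∎
      where
      open ≤-Reasoning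
      A = xs ++ v ∷ ys
      R = xs ++ ys
      f = λ u → ind (suc m) (A ∖ u)
      h = λ u → ind m (A ∖ v ∖ u)
      rearrange : ∀ a b c → a + (b + c) ≡ b + (a + c)
      rearrange = solve-∀
      pointwise : ∀ u → f u ≤ ind (suc m) (R ∖ u) + ⟦ not (adj v u) ⟧ * (suc m * h u)
      pointwise u
        rewrite filterᵇ-comm (not ∘ adj u) (not ∘ adj v) A
              | Listₚ.filter-++ (T? ∘ (not ∘ adj u)) xs (v ∷ ys)
              | Listₚ.filter-++ (T? ∘ (not ∘ adj u)) xs ys
              | adj-sym v u
        with adj u v
      -- If the first entry `u` is adjacent to `v`, filtering by `u` already deletes `v` and the two
      -- lists coincide.
      ... | true = m≤m+n _ _
      ... | false = ≤-trans (ind-remove m (xs ∖ u) v (ys ∖ u)) (≤-reflexive (cong (ind (suc m) (xs ∖ u ++ ys ∖ u) +_) (sym (+-identityʳ (suc m * ind m ((xs ∖ u ++ v ∷ ys ∖ u) ∖ v))))))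
      tail : ∑ R (λ u → ⟦ not (adj v u) ⟧ * (suc m * h u)) ≤ suc m * f v
      tail = begin
        ∑ R (λ u → ⟦ not (adj v u) ⟧ * (suc m * h u)) ≡⟨ ∑-filterᵇ (not ∘ adj v) R _ ⟨
        ∑ (R ∖ v) (λ u → suc m * h u)  ≡⟨ ∑-*ˡ (R ∖ v) (suc m) h ⟩
        suc m * ∑ (R ∖ v) h  ≤⟨ *-monoʳ-≤ (suc m) sub ⟩
        suc m * f v ∎
        where
        sub : ∑ (R ∖ v) h ≤ ∑ (A ∖ v) h
        sub = begin
          ∑ (R ∖ v) h  ≡⟨ ∑-filterᵇ (not ∘ adj v) R h ⟩
          ∑ R (λ u → ⟦ not (adj v u) ⟧ * h u)   ≤⟨ ∑-⊆ (++-∷-⊆ xs v ys) (λ u → ⟦ not (adj v u) ⟧ * h u) ⟩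
          ∑ A (λ u → ⟦ not (adj v u) ⟧ * h u)   ≡⟨ ∑-filterᵇ (not ∘ adj v) A h ⟨
          ∑ (A ∖ v) h ∎

    module _ (Γ : List V) (M X B nmax : ℕ)
      (dense : ∀ A → A ⊆ Γ → M ≤ length A →
        ∃ λ xs → ∃ λ v → ∃ λ ys → A ≡ xs ++ v ∷ ys × suc B * length (A ∖ v) ≤ B * length A)
      (1≤X : 1 ≤ X)
      (X-large : M + nmax * length Γ ≤ X * M) where

      length-⊆ : ∀ {xs ys : List V} → xs ⊆ ys → length xs ≤ length ys
      length-⊆ {xs} {ys} s = subst₂ _≤_ (trans (∑-const xs 1) (*-identityʳ _)) (trans (∑-const ys 1) (*-identityʳ _)) (∑-⊆ s (λ _ → 1))

      -- Each picked vertex shrinks the available set by a factor B / (B + 1), so after j picks at most M vertices remain.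
      kleitman-winston : ∀ j n A → n ≤ nmax → A ⊆ Γ → B ^ j * length A ≤ suc B ^ j * M → ind n A ≤ X ^ j * M ^ n
      kleitman-winston zero n A n≤ A⊆ h = ≤-trans (ind≤^ n A)
        (≤-trans (^-monoˡ-≤ n (subst₂ _≤_ (+-identityʳ _) (+-identityʳ _) h)) (≤-reflexive (sym (+-identityʳ _))))
      kleitman-winston (suc j) zero A n≤ A⊆ h = ≤-trans (m^n>0 X {{>-nonZero 1≤X}} (suc j)) (≤-reflexive (sym (*-identityʳ _)))
      kleitman-winston (suc j) (suc n) A n≤ A⊆ h = begin
        ind (suc n) A  ≤⟨ go (length A) A A⊆ ≤-refl h ⟩
        M ^ suc n + length A * W  ≤⟨ +-mono-≤ first (*-monoˡ-≤ W (length-⊆ A⊆)) ⟩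
        M * (X ^ j * M ^ n) + length Γ * (suc n * (X ^ j * M ^ n))
          ≡⟨ e₁ M (X ^ j * M ^ n) (length Γ) n ⟩
        (M + suc n * length Γ) * (X ^ j * M ^ n)  ≤⟨ *-monoˡ-≤ (X ^ j * M ^ n) (≤-trans (+-monoʳ-≤ M (*-monoˡ-≤ (length Γ) n≤)) X-large) ⟩
        X * M * (X ^ j * M ^ n)  ≡⟨ e₂ X M (X ^ j) (M ^ n) ⟩
        X ^ suc j * M ^ suc n ∎
        where
        open ≤-Reasoning
        W = suc n * (X ^ j * M ^ n)
        e₁ : ∀ m w g n → m * w + g * ((1 + n) * w) ≡ (m + (1 + n) * g) * w
        e₁ = solve-∀
        e₂ : ∀ x m a b → x * m * (a * b) ≡ x * a * (m * b)
        e₂ = solve-∀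
        first : M ^ suc n ≤ M * (X ^ j * M ^ n)
        first = *-monoʳ-≤ M (≤-trans (≤-reflexive (sym (+-identityʳ _))) (*-monoˡ-≤ (M ^ n) (m^n>0 X {{>-nonZero 1≤X}} j)))
        -- Vertices of high degree are deleted one after another, with `l` as fuel. A tuple is
        -- charged to the first deleted vertex that it contains, which costs `W`; a tuple containing
        -- none of them lives in fewer than `M` vertices. `X-large` makes `X` pay for both kinds in
        -- one round.
        go : ∀ l A → A ⊆ Γ → length A ≤ l → B ^ suc j * length A ≤ suc B ^ suc j * M →
          ind (suc n) A ≤ M ^ suc n + length A * W
        go l A A⊆ len h with length A <? M
        ... | yes q = ≤-trans (≤-trans (ind≤^ (suc n) A) (^-monoˡ-≤ (suc n) (<⇒≤ q))) (m≤m+n _ _)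
        ... | no q with dense A A⊆ (≮⇒≥ q)
        ... | xs , v , ys , refl , deg with trans (length-++-∷ xs v ys) refl
          where
          length-++-∷ : ∀ xs (v : V) ys → length (xs ++ v ∷ ys) ≡ suc (length (xs ++ ys))
          length-++-∷ [] v ys = refl
          length-++-∷ (x ∷ xs) v ys = cong suc (length-++-∷ xs v ys)
        go zero A A⊆ len h | no q | xs , v , ys , refl , deg | eq = contradiction (subst (_≤ 0) eq len) λ ()
        go (suc l) A A⊆ len h | no q | xs , v , ys , refl , deg | eq = begin
          ind (suc n) A  ≤⟨ ind-remove n xs v ys ⟩
          ind (suc n) (xs ++ ys) + suc n * ind n (A ∖ v)  ≤⟨ +-mono-≤ rest picked ⟩
          M ^ suc n + length (xs ++ ys) * W + W  ≡⟨ e₃ (M ^ suc n) (length (xs ++ ys)) W ⟩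
          M ^ suc n + suc (length (xs ++ ys)) * W  ≡⟨ cong (λ k → M ^ suc n + k * W) eq ⟨
          M ^ suc n + length A * W ∎
          where
          e₃ : ∀ a k w → a + k * w + w ≡ a + (1 + k) * w
          e₃ = solve-∀
          shorter : length (xs ++ ys) ≤ length A
          shorter = length-⊆ (++-∷-⊆ xs v ys)
          rest = go l (xs ++ ys) (⊆-trans (++-∷-⊆ xs v ys) A⊆) (s≤s⁻¹ (subst (_≤ suc l) eq len))
                   (≤-trans (*-monoʳ-≤ (B ^ suc j) shorter) h)
          e₄ : ∀ b c l → b * (c * l) ≡ c * (b * l)
          e₄ = solve-∀
          shrink : B ^ j * length (A ∖ v) ≤ suc B ^ j * M
          shrink = *-cancelˡ-≤ (suc B) (begin
            suc B * (B ^ j * length (A ∖ v))   ≡⟨ e₄ (suc B) (B ^ j) _ ⟩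
            B ^ j * (suc B * length (A ∖ v))   ≤⟨ *-monoʳ-≤ (B ^ j) deg ⟩
            B ^ j * (B * length A)  ≡⟨ e₄ (B ^ j) B _ ⟩
            B * (B ^ j * length A)  ≡⟨ *-assoc B (B ^ j) _ ⟨
            B ^ suc j * length A  ≤⟨ h ⟩
            suc B ^ suc j * M  ≡⟨ *-assoc (suc B) (suc B ^ j) M ⟩
            suc B * (suc B ^ j * M) ∎)
          picked : suc n * ind n (A ∖ v) ≤ W
          picked = *-monoʳ-≤ (suc n) (kleitman-winston j n (A ∖ v) (<⇒≤ n≤) (⊆-trans (filterᵇ-⊆ _ A) A⊆) shrink)

-- Sampling a graph without independent n-sets

nC0≡1 : ∀ n → n C 0 ≡ 1
nC0≡1 n = trans (nCk≡nC[n∸k] {0} {n} z≤n) (nCn≡1 n)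

^-distribʳ-* : ∀ n a b → (a * b) ^ n ≡ a ^ n * b ^ n
^-distribʳ-* zero a b = refl
^-distribʳ-* (suc n) a b = trans (cong (a * b *_) (^-distribʳ-* n a b)) (e a b (a ^ n) (b ^ n))
  where
  e : ∀ a b c d → a * b * (c * d) ≡ a * c * (b * d)
  e = solve-∀

-- This and `power-secant` bound the increment of the power `suc n` from `a` to `suc a` by its
-- derivative at the two ends, which is what Pascal's rule calls for in the two binomial estimates
-- below.
power-bernoulli : ∀ a n → a ^ suc n + suc n * a ^ n ≤ suc a ^ suc n
power-bernoulli a zero = ≤-reflexive (e a)
  where
  e : ∀ a → a * 1 + 1 * 1 ≡ (1 + a) * 1
  e = solve-∀
power-bernoulli a (suc n) = begin
  a ^ suc (suc n) + suc (suc n) * a ^ suc n  ≤⟨ m≤m+n _ (suc n * a ^ n) ⟩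
  a ^ suc (suc n) + suc (suc n) * a ^ suc n + suc n * a ^ n ≡⟨ e a n (a ^ n) ⟩
  suc a * (a ^ suc n + suc n * a ^ n)  ≤⟨ *-monoʳ-≤ (suc a) (power-bernoulli a n) ⟩
  suc a ^ suc (suc n) ∎
  where
  open ≤-Reasoning
  e : ∀ a n w → a * (a * w) + (2 + n) * (a * w) + (1 + n) * w ≡ (1 + a) * (a * w + (1 + n) * w)
  e = solve-∀

power-secant : ∀ a n → suc a ^ suc n ≤ a ^ suc n + suc n * suc a ^ n
power-secant a zero = ≤-reflexive (e a)
  where
  e : ∀ a → (1 + a) * 1 ≡ a * 1 + 1 * 1
  e = solve-∀
power-secant a (suc n) = begin
  suc a ^ suc (suc n)  ≡⟨⟩
  suc a ^ suc n + a * suc a ^ suc n  ≤⟨ +-monoʳ-≤ _ (*-monoʳ-≤ a (power-secant a n)) ⟩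
  suc a ^ suc n + a * (a ^ suc n + suc n * suc a ^ n)   ≤⟨ m≤m+n _ (suc n * suc a ^ n) ⟩
  suc a ^ suc n + a * (a ^ suc n + suc n * suc a ^ n) + suc n * suc a ^ n ≡⟨ e a n (a ^ suc n) (suc a ^ n) ⟩
  a ^ suc (suc n) + suc (suc n) * suc a ^ suc n ∎
  where
  open ≤-Reasoning
  e : ∀ a n w v → (1 + a) * v + a * (w + (1 + n) * v) + (1 + n) * v ≡ a * w + (2 + n) * ((1 + a) * v)
  e = solve-∀

C*!≤^ : ∀ N n → (N C n) * n ! ≤ N ^ n
C*!≤^ N zero = ≤-reflexive (trans (*-identityʳ _) (nC0≡1 N))
C*!≤^ zero (suc n) rewrite k>n⇒nCk≡0 {0} {suc n} (s≤s z≤n) = z≤n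
C*!≤^ (suc N) (suc n) = begin
  (suc N C suc n) * suc n !  ≡⟨ cong (_* suc n !) (nCk+nC[k+1]≡[n+1]C[k+1] N n) ⟨
  (N C n + N C suc n) * suc n !  ≡⟨ e (N C n) (N C suc n) n (n !) ⟩
  (N C suc n) * suc n ! + suc n * ((N C n) * n !)  ≤⟨ +-mono-≤ (C*!≤^ N (suc n)) (*-monoʳ-≤ (suc n) (C*!≤^ N n)) ⟩
  N ^ suc n + suc n * N ^ n  ≤⟨ power-bernoulli N n ⟩
  suc N ^ suc n ∎
  where
  open ≤-Reasoning
  e : ∀ a b n f → (a + b) * ((1 + n) * f) ≡ b * ((1 + n) * f) + (1 + n) * (a * f)
  e = solve-∀

^≤C*! : ∀ m n → m ^ n ≤ ((m + n) C n) * n !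
^≤C*! m zero = ≤-reflexive (sym (trans (*-identityʳ _) (nC0≡1 (m + 0))))
^≤C*! zero (suc n) = z≤n
^≤C*! (suc m) (suc n) = begin
  suc m ^ suc n  ≤⟨ power-secant m n ⟩
  m ^ suc n + suc n * suc m ^ n  ≤⟨ +-mono-≤ (^≤C*! m (suc n)) (*-monoʳ-≤ (suc n) (^≤C*! (suc m) n)) ⟩
  ((m + suc n) C suc n) * suc n ! + suc n * (((suc m + n) C n) * n !)
    ≡⟨ cong (λ k → (k C suc n) * suc n ! + suc n * (((suc m + n) C n) * n !)) (+-suc m n) ⟩
  ((suc m + n) C suc n) * suc n ! + suc n * (((suc m + n) C n) * n !) ≡⟨ e ((suc m + n) C n) ((suc m + n) C suc n) n (n !) ⟩
  ((suc m + n) C n + (suc m + n) C suc n) * suc n !  ≡⟨ cong (_* suc n !) (nCk+nC[k+1]≡[n+1]C[k+1] (suc m + n) n) ⟩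
  ((suc (suc m + n)) C suc n) * suc n !  ≡⟨ cong (λ k → (k C suc n) * suc n !) (+-suc (suc m) n) ⟨
  ((suc m + suc n) C suc n) * suc n ! ∎
  where
  open ≤-Reasoning
  e : ∀ a b n f → b * ((1 + n) * f) + (1 + n) * (a * f) ≡ (a + b) * ((1 + n) * f)
  e = solve-∀

C≤2^ : ∀ n k → n C k ≤ 2 ^ n
C≤2^ n zero rewrite nC0≡1 n = m^n>0 2 n
C≤2^ zero (suc k) rewrite k>n⇒nCk≡0 {0} {suc k} (s≤s z≤n) = z≤n
C≤2^ (suc n) (suc k) = begin
  suc n C suc k  ≡⟨ nCk+nC[k+1]≡[n+1]C[k+1] n k ⟨
  n C k + n C suc k   ≤⟨ +-mono-≤ (C≤2^ n k) (C≤2^ n (suc k)) ⟩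
  2 ^ n + 2 ^ n  ≡⟨ cong (2 ^ n +_) (+-identityʳ _) ⟨
  2 ^ suc n ∎
  where open ≤-Reasoning

-- A substitute for Stirling's formula: `n ^ n` is at most C(2n , n) n!, hence at most 4^n n!, so
-- that C(N , n) is at most (4N / n)^n.
C*n^n≤ : ∀ N n → (N C n) * n ^ n ≤ (4 * N) ^ n
C*n^n≤ N n = begin
  (N C n) * n ^ n  ≤⟨ *-monoʳ-≤ (N C n) (^≤C*! n n) ⟩
  (N C n) * (((n + n) C n) * n !)  ≤⟨ *-monoʳ-≤ (N C n) (*-monoˡ-≤ (n !) (C≤2^ (n + n) n)) ⟩
  (N C n) * (2 ^ (n + n) * n !)  ≡⟨ e (N C n) (2 ^ (n + n)) (n !) ⟩
  2 ^ (n + n) * ((N C n) * n !)  ≤⟨ *-monoʳ-≤ (2 ^ (n + n)) (C*!≤^ N n) ⟩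
  2 ^ (n + n) * N ^ n  ≡⟨ cong (λ k → 2 ^ k * N ^ n) (cong (n +_) (+-identityʳ n)) ⟨
  2 ^ (2 * n) * N ^ n  ≡⟨ cong (_* N ^ n) (^-*-assoc 2 2 n) ⟨
  4 ^ n * N ^ n  ≡⟨ ^-distribʳ-* n 4 N ⟨
  (4 * N) ^ n ∎
  where
  open ≤-Reasoning
  e : ∀ a b c → a * (b * c) ≡ b * (a * c)
  e = solve-∀

module _ {V : Set} (adj : V → V → Bool) where

  -- Counts sets of n positions in the sample, so one vertex drawn twice counts as two. The
  -- predicate `P` remembers non-adjacency to the entries taken so far.
  indepSubs : ∀ {N} → (V → Bool) → ℕ → Vec V N → ℕ
  indepSubs P zero gs = 1
  indepSubs P (suc n) [] = 0
  indepSubs P (suc n) (v ∷ gs) = indepSubs P (suc n) gs + ⟦ P v ⟧ * indepSubs (λ u → P u ∧ not (adj v u)) n gs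

  indepSubs-pos : ∀ {N} (gs : Vec V N) P n (S : Fin N → Bool) →
    (∀ i → S i ≡ true → P (Vec.lookup gs i) ≡ true) →
    (∀ i j → i ≢ j → S i ≡ true → S j ≡ true → adj (Vec.lookup gs i) (Vec.lookup gs j) ≡ false) →
    n ≤ # (allFin N) S → 1 ≤ indepSubs P n gs
  indepSubs-pos gs P zero S hP hS h = ≤-refl
  indepSubs-pos {suc N} (v ∷ gs) P (suc n) S hP hS h = go (S zero) refl
    where
    rest : suc n ≤ ⟦ S zero ⟧ + # (allFin N) (S ∘ suc)
    rest = subst (suc n ≤_) (∑-allFin-suc N (λ i → ⟦ S i ⟧)) h
    hS′ = λ i j i≢j → hS (suc i) (suc j) (i≢j ∘ Fin.suc-injective)
    go : ∀ b → S zero ≡ b → 1 ≤ indepSubs P (suc n) (v ∷ gs)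
    go false s₀ = ≤-trans
      (indepSubs-pos gs P (suc n) (S ∘ suc) (hP ∘ suc) hS′
        (subst (λ b → suc n ≤ ⟦ b ⟧ + # (allFin N) (S ∘ suc)) s₀ rest))
      (m≤m+n _ _)
    go true s₀ rewrite hP zero s₀ = ≤-trans
      (indepSubs-pos gs (λ u → P u ∧ not (adj v u)) n (S ∘ suc)
        (λ i si → ∧-⁺ (hP (suc i) si) (cong not (hS zero (suc i) (λ ()) s₀ si))) hS′
        (s≤s⁻¹ (subst (λ b → suc n ≤ ⟦ b ⟧ + # (allFin N) (S ∘ suc)) s₀ rest)))
      (≤-trans (≤-reflexive (sym (+-identityʳ _))) (m≤n+m _ (indepSubs P (suc n) gs)))

  module _ (Γ : List V) where

    ∑ᵛ : ∀ N → (Vec V N → ℕ) → ℕ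
    ∑ᵛ zero f = f []
    ∑ᵛ (suc N) f = ∑ Γ (λ v → ∑ᵛ N (λ gs → f (v ∷ gs)))

    ∑ᵛ-+ : ∀ N (f g : Vec V N → ℕ) → ∑ᵛ N (λ gs → f gs + g gs) ≡ ∑ᵛ N f + ∑ᵛ N g
    ∑ᵛ-+ zero f g = refl
    ∑ᵛ-+ (suc N) f g = trans (∑-cong Γ (λ v → ∑ᵛ-+ N (f ∘ (v ∷_)) (g ∘ (v ∷_)))) (∑-+ Γ _ _)

    ∑ᵛ-* : ∀ N c (f : Vec V N → ℕ) → ∑ᵛ N (λ gs → c * f gs) ≡ c * ∑ᵛ N f
    ∑ᵛ-* zero c f = refl
    ∑ᵛ-* (suc N) c f = trans (∑-cong Γ (λ v → ∑ᵛ-* N c (f ∘ (v ∷_)))) (∑-*ˡ Γ c _)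

    ∑ᵛ-1 : ∀ N → ∑ᵛ N (λ _ → 1) ≡ length Γ ^ N
    ∑ᵛ-1 zero = refl
    ∑ᵛ-1 (suc N) = trans (∑-cong Γ (λ v → ∑ᵛ-1 N)) (∑-const Γ _)

    ∑ᵛ-zero : ∀ N (f : Vec V N → ℕ) → ∑ᵛ N f < length Γ ^ N → ∃ λ gs → f gs ≡ 0
    ∑ᵛ-zero zero f h = [] , n<1⇒n≡0 h
    ∑ᵛ-zero (suc N) f h with ∑<⇒∃ Γ (length Γ ^ N) _ (subst (∑ᵛ (suc N) f <_) (*-comm (length Γ) (length Γ ^ N)) h)
    ... | v , _ , q with ∑ᵛ-zero N _ q
    ... | gs , e = v ∷ gs , e

    filterᵇ-∖ : ∀ (P : V → Bool) v xs → filterᵇ (λ u → P u ∧ not (adj v u)) xs ≡ filterᵇ (not ∘ adj v) (filterᵇ P xs)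
    filterᵇ-∖ P v [] = refl
    filterᵇ-∖ P v (x ∷ xs) with P x
    ... | false = filterᵇ-∖ P v xs
    ... | true with not (adj v x)
    ... | true = cong (x ∷_) (filterᵇ-∖ P v xs)
    ... | false = filterᵇ-∖ P v xs

    -- Linearity of expectation without division: each of the C(N , n) position sets carries an
    -- independent tuple in the proportion `ind` to `length Γ ^ n` of all samples. Sampling is with
    -- replacement, which is why `ind` admits repeated entries. The induction splits on the first
    -- position, as Pascal's rule does.
    ∑ᵛ-indepSubs : ∀ N n P → ∑ᵛ N (indepSubs P n) * length Γ ^ n ≡ (N C n) * ind adj n (filterᵇ P Γ) * length Γ ^ N
    ∑ᵛ-indepSubs N zero P = trans (*-identityʳ _) (trans (∑ᵛ-1 N) (sym (trans (cong (_* length Γ ^ N) (trans (*-identityʳ _) (nC0≡1 N))) (+-identityʳ _))))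
    ∑ᵛ-indepSubs zero (suc n) P rewrite k>n⇒nCk≡0 {0} {suc n} (s≤s z≤n) = refl
    ∑ᵛ-indepSubs (suc N) (suc n) P = begin
      ∑ᵛ (suc N) (indepSubs P (suc n)) * (G * G ^ n)
        ≡⟨ cong (_* (G * G ^ n)) (∑-cong Γ (λ v → trans (∑ᵛ-+ N _ _) (cong (∑ᵛ N (indepSubs P (suc n)) +_) (∑ᵛ-* N ⟦ P v ⟧ _)))) ⟩
      ∑ Γ (λ v → s + ⟦ P v ⟧ * t v) * (G * G ^ n)
        ≡⟨ cong (_* (G * G ^ n)) (trans (∑-+ Γ _ _) (cong₂ _+_ (∑-const Γ s) (sym (∑-filterᵇ P Γ t)))) ⟩
      (G * s + ∑ (filterᵇ P Γ) t) * (G * G ^ n)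
        ≡⟨ e₁ G s (∑ (filterᵇ P Γ) t) (G ^ n) ⟩
      G * (s * (G * G ^ n)) + G * (∑ (filterᵇ P Γ) t * G ^ n)
        ≡⟨ cong₂ (λ x y → G * x + G * y) (∑ᵛ-indepSubs N (suc n) P) tails ⟩
      G * ((N C suc n) * I * G ^ N) + G * ((N C n) * I * G ^ N)
        ≡⟨ e₂ G (N C suc n) (N C n) I (G ^ N) ⟩
      (N C n + N C suc n) * I * (G * G ^ N)
        ≡⟨ cong (λ c → c * I * (G * G ^ N)) (nCk+nC[k+1]≡[n+1]C[k+1] N n) ⟩
      (suc N C suc n) * I * (G * G ^ N) ∎
      where
      open ≡-Reasoning
      G = length Γ
      s = ∑ᵛ N (indepSubs P (suc n))
      I = ind adj (suc n) (filterᵇ P Γ)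
      t = λ v → ∑ᵛ N (indepSubs (λ u → P u ∧ not (adj v u)) n)
      e₁ : ∀ g s t w → (g * s + t) * (g * w) ≡ g * (s * (g * w)) + g * (t * w)
      e₁ = solve-∀
      e₂ : ∀ g a b i w → g * (a * i * w) + g * (b * i * w) ≡ (b + a) * i * (g * w)
      e₂ = solve-∀
      tails : ∑ (filterᵇ P Γ) t * G ^ n ≡ (N C n) * I * G ^ N
      tails = begin
        ∑ (filterᵇ P Γ) t * G ^ n  ≡⟨ ∑-*ʳ (filterᵇ P Γ) (G ^ n) t ⟨
        ∑ (filterᵇ P Γ) (λ v → t v * G ^ n)
          ≡⟨ ∑-cong (filterᵇ P Γ) (λ v → trans (∑ᵛ-indepSubs N n (λ u → P u ∧ not (adj v u)))
               (cong (λ L → (N C n) * ind adj n L * G ^ N) (filterᵇ-∖ P v Γ))) ⟩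
        ∑ (filterᵇ P Γ) (λ v → (N C n) * ind adj n (filterᵇ (not ∘ adj v) (filterᵇ P Γ)) * G ^ N)
          ≡⟨ trans (∑-*ʳ (filterᵇ P Γ) (G ^ N) _) (cong (_* G ^ N) (∑-*ˡ (filterᵇ P Γ) (N C n) _)) ⟩
        (N C n) * I * G ^ N ∎

    filterᵇ-true : ∀ (xs : List V) → filterᵇ (λ _ → true) xs ≡ xs
    filterᵇ-true [] = refl
    filterᵇ-true (x ∷ xs) = cong (x ∷_) (filterᵇ-true xs)

    -- First moment method: the hypothesis says that the average number of independent position sets
    -- is below 1.
    sample : ∀ N n → (N C n) * ind adj n Γ < length Γ ^ n → ∃ λ (gs : Vec V N) → indepSubs (λ _ → true) n gs ≡ 0
    sample N n h = ∑ᵛ-zero N _ (*-cancelʳ-< (length Γ ^ n) _ _ (begin-strict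
      ∑ᵛ N (indepSubs (λ _ → true) n) * length Γ ^ n  ≡⟨ ∑ᵛ-indepSubs N n (λ _ → true) ⟩
      (N C n) * ind adj n (filterᵇ (λ _ → true) Γ) * length Γ ^ N
        ≡⟨ cong (λ L → (N C n) * ind adj n L * length Γ ^ N) (filterᵇ-true Γ) ⟩
      (N C n) * ind adj n Γ * length Γ ^ N  <⟨ *-monoˡ-< (length Γ ^ N) {{m^n≢0 (length Γ) N {{G≢0}}}} h ⟩
      length Γ ^ n * length Γ ^ N  ≡⟨ *-comm (length Γ ^ n) _ ⟩
      length Γ ^ N * length Γ ^ n ∎))
      where
      open ≤-Reasoning
      nonzero : ∀ n g → (N C n) * ind adj n Γ < g ^ n → NonZero g
      nonzero n (suc g) h = _
      nonzero zero zero h = contradiction (subst (λ k → k * 1 < 1) (nC0≡1 N) h) λ { (s≤s ()) }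
      G≢0 : NonZero (length Γ)
      G≢0 = nonzero n (length Γ) h

    -- After C(N , n) is replaced by (4N / n)^n, the factor 8 in the density hypothesis leaves a
    -- spare 2^(-n), which beats the number `W` of containers.
    sample-bound : ∀ N n M W → ind adj n Γ ≤ W * M ^ n → 8 * (N * M) ≤ n * length Γ → W < 2 ^ n → 0 < n * length Γ →
      (N C n) * ind adj n Γ < length Γ ^ n
    sample-bound N n M W hI hN hW pos = *-cancelʳ-< (n ^ n * 2 ^ n) _ _ (begin-strict
      (N C n) * ind adj n Γ * (n ^ n * 2 ^ n)  ≤⟨ *-monoˡ-≤ (n ^ n * 2 ^ n) (*-monoʳ-≤ (N C n) hI) ⟩
      (N C n) * (W * M ^ n) * (n ^ n * 2 ^ n)  ≡⟨ e₁ (N C n) W (M ^ n) (n ^ n) (2 ^ n) ⟩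
      ((N C n) * n ^ n) * (2 ^ n * M ^ n) * W  ≤⟨ *-monoˡ-≤ W (*-monoˡ-≤ (2 ^ n * M ^ n) (C*n^n≤ N n)) ⟩
      (4 * N) ^ n * (2 ^ n * M ^ n) * W  ≡⟨ cong (_* W) (cong ((4 * N) ^ n *_) (^-distribʳ-* n 2 M)) ⟨
      (4 * N) ^ n * (2 * M) ^ n * W  ≡⟨ cong (_* W) (^-distribʳ-* n (4 * N) (2 * M)) ⟨
      (4 * N * (2 * M)) ^ n * W  ≤⟨ *-monoˡ-≤ W (^-monoˡ-≤ n (≤-trans (≤-reflexive (e₂ N M)) hN)) ⟩
      (n * length Γ) ^ n * W  <⟨ *-monoʳ-< ((n * length Γ) ^ n) {{m^n≢0 (n * length Γ) n {{>-nonZero pos}}}} hW ⟩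
      (n * length Γ) ^ n * 2 ^ n  ≡⟨ cong (_* 2 ^ n) (^-distribʳ-* n n (length Γ)) ⟩
      n ^ n * length Γ ^ n * 2 ^ n  ≡⟨ e₃ (n ^ n) (length Γ ^ n) (2 ^ n) ⟩
      length Γ ^ n * (n ^ n * 2 ^ n) ∎)
      where
      open ≤-Reasoning
      e₁ : ∀ c w m n t → c * (w * m) * (n * t) ≡ (c * n) * (t * m) * w
      e₁ = solve-∀
      e₂ : ∀ N M → 4 * N * (2 * M) ≡ 8 * (N * M)
      e₂ = solve-∀
      e₃ : ∀ a b c → a * b * c ≡ b * (a * c)
      e₃ = solve-∀

-- Labelled lines

∑-cartesianProduct : ∀ {A B : Set} (xs : List A) (ys : List B) f →
  ∑ (cartesianProduct xs ys) f ≡ ∑ xs (λ x → ∑ ys (λ y → f (x , y)))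
∑-cartesianProduct [] ys f = refl
∑-cartesianProduct (x ∷ xs) ys f = trans (∑-++ (map (x ,_) ys) _ f)
  (cong₂ _+_ (∑-map (x ,_) ys f) (∑-cartesianProduct xs ys f))

≤∑⇒∃ : ∀ {A : Set} (xs : List A) c f → 1 ≤ length xs → c * length xs ≤ ∑ xs f → ∃ λ x → x ∈ xs × c ≤ f x
≤∑⇒∃ (x ∷ xs) c f _ h with c ≤? f x
... | yes q = x , here refl , q
≤∑⇒∃ (x ∷ []) c f _ h | no q = contradiction (subst₂ _≤_ (*-identityʳ c) (+-identityʳ (f x)) h) q
≤∑⇒∃ (x ∷ xs@(_ ∷ _)) c f _ h | no q with ≤∑⇒∃ xs c f (s≤s z≤n)
  (+-cancelˡ-≤ c _ _ (≤-trans (subst (_≤ f x + ∑ xs f) (*-suc c (length xs)) h) (+-monoˡ-≤ _ (<⇒≤ (≰⇒> q)))))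
... | y , i , r = y , there i , r

allVec : ∀ K → List (Vec Bool K)
allVec zero = [] ∷ []
allVec (suc K) = map (true ∷_) (allVec K) ++ map (false ∷_) (allVec K)

∑-allVec-suc : ∀ K f → ∑ (allVec (suc K)) f ≡ ∑ (allVec K) (λ σ → f (true ∷ σ)) + ∑ (allVec K) (λ σ → f (false ∷ σ))
∑-allVec-suc K f = trans (∑-++ (map (true ∷_) (allVec K)) _ f) (cong₂ _+_ (∑-map _ (allVec K) f) (∑-map _ (allVec K) f))

length-allVec : ∀ K → length (allVec K) ≡ 2 ^ K
length-allVec K = trans (sym (trans (∑-const (allVec K) 1) (*-identityʳ _))) (go K)
  where
  go : ∀ K → ∑ (allVec K) (λ _ → 1) ≡ 2 ^ K
  go zero = refl
  go (suc K) = trans (∑-allVec-suc K _) (cong₂ _+_ (go K) (trans (go K) (sym (+-identityʳ _))))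

dis agr : ∀ {K} → (Fin K → Bool) → (Fin K → Bool) → Vec Bool K → ℕ
dis {K} I τ σ = # (allFin K) (λ P → I P ∧ (Vec.lookup σ P xor τ P))
agr {K} I τ σ = # (allFin K) (λ P → I P ∧ not (Vec.lookup σ P xor τ P))

dis+agr : ∀ {K} (I τ : Fin K → Bool) σ → dis I τ σ + agr I τ σ ≡ # (allFin K) I
dis+agr {K} I τ σ = trans (sym (∑-+ (allFin K) _ _)) (∑-cong (allFin K) (λ P → split (I P) (Vec.lookup σ P xor τ P)))
  where
  split : ∀ a b → ⟦ a ∧ b ⟧ + ⟦ a ∧ not b ⟧ ≡ ⟦ a ⟧
  split false b = refl
  split true true = refl
  split true false = refl

-- The generating function of agreements at 2: a coordinate in `I` contributes 2 + 1, any other one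
-- contributes 1 + 1. The extra power of 2 on the left makes the exponent of 2 on the right
-- independent of `I`.
∑-2^agr : ∀ K (I τ : Fin K → Bool) → ∑ (allVec K) (λ σ → 2 ^ agr I τ σ) * 2 ^ # (allFin K) I ≡ 3 ^ # (allFin K) I * 2 ^ K
∑-2^agr zero I τ = refl
∑-2^agr (suc K) I τ = begin
  ∑ (allVec (suc K)) (λ σ → 2 ^ agr I τ σ) * 2 ^ # (allFin (suc K)) I
    ≡⟨ cong₂ _*_ (trans (∑-allVec-suc K _) (cong₂ _+_ (head true) (head false))) (cong (2 ^_) (∑-allFin-suc K (λ P → ⟦ I P ⟧))) ⟩
  (2 ^ w true * s + 2 ^ w false * s) * 2 ^ (⟦ I zero ⟧ + h)
    ≡⟨ cong (_* 2 ^ (⟦ I zero ⟧ + h)) (*-distribʳ-+ s (2 ^ w true) (2 ^ w false)) ⟨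
  (2 ^ w true + 2 ^ w false) * s * 2 ^ (⟦ I zero ⟧ + h)
    ≡⟨ step (I zero) (τ zero) ⟩
  3 ^ (⟦ I zero ⟧ + h) * 2 ^ suc K
    ≡⟨ cong (λ k → 3 ^ k * 2 ^ suc K) (∑-allFin-suc K (λ P → ⟦ I P ⟧)) ⟨
  3 ^ # (allFin (suc K)) I * 2 ^ suc K ∎
  where
  open ≡-Reasoning
  h = # (allFin K) (I ∘ suc)
  s = ∑ (allVec K) (λ σ → 2 ^ agr (I ∘ suc) (τ ∘ suc) σ)
  w : Bool → ℕ
  w b = ⟦ I zero ∧ not (b xor τ zero) ⟧
  head : ∀ b → ∑ (allVec K) (λ σ → 2 ^ agr I τ (b ∷ σ)) ≡ 2 ^ w b * s
  head b = trans (∑-cong (allVec K) λ σ →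
      trans (cong (2 ^_) (∑-allFin-suc K (λ P → ⟦ I P ∧ not (Vec.lookup (b ∷ σ) P xor τ P) ⟧)))
            (^-distribˡ-+-* 2 (w b) (agr (I ∘ suc) (τ ∘ suc) σ)))
    (∑-*ˡ (allVec K) (2 ^ w b) _)
  ih : s * 2 ^ h ≡ 3 ^ h * 2 ^ K
  ih = ∑-2^agr K (I ∘ suc) (τ ∘ suc)
  three : 3 * s * 2 ^ suc h ≡ 3 ^ suc h * 2 ^ suc K
  three = trans (e₁ s (2 ^ h)) (trans (cong (6 *_) ih) (e₂ (3 ^ h) (2 ^ K)))
    where
    e₁ : ∀ s t → 3 * s * (2 * t) ≡ 6 * (s * t)
    e₁ = solve-∀
    e₂ : ∀ a b → 6 * (a * b) ≡ 3 * a * (2 * b)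
    e₂ = solve-∀
  two : 2 * s * 2 ^ h ≡ 3 ^ h * 2 ^ suc K
  two = trans (*-assoc 2 s (2 ^ h)) (trans (cong (2 *_) ih) (e (3 ^ h) (2 ^ K)))
    where
    e : ∀ a b → 2 * (a * b) ≡ a * (2 * b)
    e = solve-∀
  step : ∀ i t → (2 ^ ⟦ i ∧ not (true xor t) ⟧ + 2 ^ ⟦ i ∧ not (false xor t) ⟧) * s * 2 ^ (⟦ i ⟧ + h) ≡ 3 ^ (⟦ i ⟧ + h) * 2 ^ suc K
  step true true = three
  step true false = three
  step false t = two

power-≤ : ∀ a b c d e r → a * b * c ^ e ≤ d ^ e → a ^ r * b ^ r * c ^ (e * r) ≤ d ^ (e * r)
power-≤ a b c d e r h = begin
  a ^ r * b ^ r * c ^ (e * r)    ≡⟨ cong₂ _*_ (^-distribʳ-* r a b) (^-*-assoc c e r) ⟨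
  (a * b) ^ r * (c ^ e) ^ r  ≡⟨ ^-distribʳ-* r (a * b) (c ^ e) ⟨
  (a * b * c ^ e) ^ r  ≤⟨ ^-monoˡ-≤ r h ⟩
  (d ^ e) ^ r  ≡⟨ ^-*-assoc d e r ⟩
  d ^ (e * r) ∎
  where open ≤-Reasoning

-- The origin of the factor 8 between `r` and the number of points on a rich line: 4 · 2 · 3^8 =
-- 52488 is below 4^8 = 65536.
eighth : ∀ r → 4 ^ r * 2 ^ r * 3 ^ (8 * r) ≤ 4 ^ (8 * r)
eighth r = power-≤ 4 2 3 4 8 r (≤ᵇ⇒≤ (4 * 2 * 3 ^ 8) (4 ^ 8) tt)

≤ᵇ-cases : ∀ m n → (m ≤ᵇ n) ≡ true × m ≤ n ⊎ (m ≤ᵇ n) ≡ false × n < m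
≤ᵇ-cases m n with m ≤ᵇ n in e
... | true = inj₁ (refl , ≤ᵇ⇒≤ m n (subst T (sym e) tt))
... | false = inj₂ (refl , ≰⇒> λ q → subst T e (≤⇒≤ᵇ q))

-- Exponential Markov inequality with weight `2 ^ agr`: a vector in the ball agrees with `τ` in at
-- least h - r of the h coordinates, so the ball has proportion at most 2^r (3/4)^h, and h ≥ 8r
-- brings this below 4^(-r).
hamming-ball : ∀ {K} (I τ : Fin K → Bool) r → 8 * r ≤ # (allFin K) I →
  # (allVec K) (λ σ → dis I τ σ ≤ᵇ r) * 4 ^ r ≤ 2 ^ K
hamming-ball {K} I τ r hr = *-cancelʳ-≤ _ _ (4 ^ h) {{m^n≢0 4 h}} (begin
  # Ω low * 4 ^ r * 4 ^ h  ≡⟨ e₁ (# Ω low) (4 ^ r) (4 ^ h) ⟩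
  4 ^ r * (# Ω low * 4 ^ h)  ≤⟨ *-monoʳ-≤ (4 ^ r) markov ⟩
  4 ^ r * (2 ^ r * (3 ^ h * 2 ^ K))  ≡⟨ e₂ (4 ^ r) (2 ^ r) (3 ^ h) (2 ^ K) ⟩
  (4 ^ r * 2 ^ r) * 3 ^ h * 2 ^ K  ≤⟨ *-monoˡ-≤ (2 ^ K) bound ⟩
  4 ^ h * 2 ^ K  ≡⟨ *-comm (4 ^ h) _ ⟩
  2 ^ K * 4 ^ h ∎)
  where
  open ≤-Reasoning
  Ω = allVec K
  h = # (allFin K) I
  low = λ σ → dis I τ σ ≤ᵇ r
  e₁ : ∀ a b c → a * b * c ≡ b * (a * c)
  e₁ = solve-∀
  e₂ : ∀ a b c d → a * (b * (c * d)) ≡ (a * b) * c * d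
  e₂ = solve-∀
  pointwise : ∀ σ → ⟦ low σ ⟧ * 2 ^ h ≤ 2 ^ r * 2 ^ agr I τ σ
  pointwise σ with ≤ᵇ-cases (dis I τ σ) r
  ... | inj₂ (e , _) rewrite e = z≤n
  ... | inj₁ (e , q) rewrite e = ≤-trans (≤-reflexive (+-identityʳ _)) (≤-trans (^-monoʳ-≤ 2 (≤-trans (≤-reflexive (sym (dis+agr I τ σ))) (+-monoˡ-≤ _ q)))
                  (≤-reflexive (^-distribˡ-+-* 2 r (agr I τ σ))))
  four : ∀ n → 4 ^ n ≡ 2 ^ n * 2 ^ n
  four n = ^-distribʳ-* n 2 2
  markov : # Ω low * 4 ^ h ≤ 2 ^ r * (3 ^ h * 2 ^ K)
  markov = begin
    # Ω low * 4 ^ h  ≡⟨ trans (cong (# Ω low *_) (four h)) (sym (*-assoc (# Ω low) (2 ^ h) (2 ^ h))) ⟩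
    # Ω low * 2 ^ h * 2 ^ h  ≡⟨ cong (_* 2 ^ h) (∑-*ʳ Ω (2 ^ h) _) ⟨
    ∑ Ω (λ σ → ⟦ low σ ⟧ * 2 ^ h) * 2 ^ h  ≤⟨ *-monoˡ-≤ (2 ^ h) (∑-mono Ω pointwise) ⟩
    ∑ Ω (λ σ → 2 ^ r * 2 ^ agr I τ σ) * 2 ^ h  ≡⟨ cong (_* 2 ^ h) (∑-*ˡ Ω (2 ^ r) _) ⟩
    2 ^ r * ∑ Ω (λ σ → 2 ^ agr I τ σ) * 2 ^ h  ≡⟨ *-assoc (2 ^ r) _ (2 ^ h) ⟩
    2 ^ r * (∑ Ω (λ σ → 2 ^ agr I τ σ) * 2 ^ h)  ≡⟨ cong (2 ^ r *_) (∑-2^agr K I τ) ⟩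
    2 ^ r * (3 ^ h * 2 ^ K) ∎
  bound : 4 ^ r * 2 ^ r * 3 ^ h ≤ 4 ^ h
  bound with k , e ← m≤n⇒∃[o]m+o≡n hr = subst (λ h → 4 ^ r * 2 ^ r * 3 ^ h ≤ 4 ^ h) e (begin
    4 ^ r * 2 ^ r * 3 ^ (8 * r + k)  ≡⟨ cong (4 ^ r * 2 ^ r *_) (^-distribˡ-+-* 3 (8 * r) k) ⟩
    4 ^ r * 2 ^ r * (3 ^ (8 * r) * 3 ^ k)    ≡⟨ *-assoc (4 ^ r * 2 ^ r) (3 ^ (8 * r)) (3 ^ k) ⟨
    4 ^ r * 2 ^ r * 3 ^ (8 * r) * 3 ^ k  ≤⟨ *-mono-≤ (eighth r) (^-monoˡ-≤ k {3} {4} (n≤1+n 3)) ⟩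
    4 ^ (8 * r) * 4 ^ k  ≡⟨ ^-distribˡ-+-* 4 (8 * r) k ⟨
    4 ^ (8 * r + k) ∎)

-- Here `k` is the number of points, `a` the number of labelled lines, `s` and `q` the first and
-- second moments of the minorities, `d` the degree sum. Cauchy-Schwarz gives 2a² ≤ b (d + a w); the
-- pairs on a common line account for b a w ≤ a², and a² remains for `d`.
many-edges : ∀ k r b a s d w q → 1 ≤ k → 8 * k ≤ r * r * b → b * w ≤ a → r * a ≤ 2 * s →
  s * s ≤ k * q → q ≤ d + a * w → a * a ≤ b * d
many-edges k r b a s d w q 1≤k hb hw hs hq hd =
  +-cancelʳ-≤ (a * a) _ _ (*-cancelˡ-≤ (4 * k) {{>-nonZero (≤-trans (s≤s z≤n) (*-monoʳ-≤ 4 1≤k))}} (begin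
    4 * k * (a * a + a * a)  ≡⟨ e₁ k a ⟩
    8 * k * (a * a)  ≤⟨ *-monoˡ-≤ (a * a) hb ⟩
    r * r * b * (a * a)  ≡⟨ e₂ r b a ⟩
    b * ((r * a) * (r * a))  ≤⟨ *-monoʳ-≤ b (*-mono-≤ hs hs) ⟩
    b * ((2 * s) * (2 * s))  ≡⟨ e₃ b s ⟩
    4 * b * (s * s)  ≤⟨ *-monoʳ-≤ (4 * b) (≤-trans hq (*-monoʳ-≤ k hd)) ⟩
    4 * b * (k * (d + a * w))  ≡⟨ e₄ b k d a w ⟩
    4 * k * (b * d + a * (b * w))  ≤⟨ *-monoʳ-≤ (4 * k) (+-monoʳ-≤ (b * d) (*-monoʳ-≤ a hw)) ⟩
    4 * k * (b * d + a * a) ∎))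
  where
  open ≤-Reasoning
  e₁ : ∀ k a → 4 * k * (a * a + a * a) ≡ 8 * k * (a * a)
  e₁ = solve-∀
  e₂ : ∀ r b a → r * r * b * (a * a) ≡ b * ((r * a) * (r * a))
  e₂ = solve-∀
  e₃ : ∀ b s → b * ((2 * s) * (2 * s)) ≡ 4 * b * (s * s)
  e₃ = solve-∀
  e₄ : ∀ b k d a c → 4 * b * (k * (d + a * c)) ≡ 4 * k * (b * d + a * (b * c))
  e₄ = solve-∀

bool-pigeonhole : ∀ a b c → a xor b ≡ true → a xor c ≡ true → b xor c ≡ true → ⊥
bool-pigeonhole true false false p q ()
bool-pigeonhole false true true p q ()
bool-pigeonhole true true c ()
bool-pigeonhole false false c ()
bool-pigeonhole true false true p ()
bool-pigeonhole false true false p ()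

module LabelledLines {Line : Set} (_≟L_ : DecidableEquality Line) (K : ℕ) (inc : Line → Fin K → Bool) where

  Labelled : Set
  Labelled = Line × Vec Bool K

  clash : Labelled → Labelled → Fin K → Bool
  clash (ℓ , σ) (ℓ′ , σ′) P = inc ℓ P ∧ (inc ℓ′ P ∧ (Vec.lookup σ P xor Vec.lookup σ′ P))

  same : Labelled → Labelled → Bool
  same (ℓ , _) (ℓ′ , _) = does (ℓ ≟L ℓ′)

  -- The lines through a point would form a clique; the labels at that point make it bipartite.
  adj : Labelled → Labelled → Bool
  adj u v = not (same u v) ∧ any? (allFin K) (clash u v)

  any?-cong : ∀ {A : Set} (xs : List A) {p q} → (∀ x → p x ≡ q x) → any? xs p ≡ any? xs q
  any?-cong [] h = refl
  any?-cong (x ∷ xs) h = cong₂ _∨_ (h x) (any?-cong xs h)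

  adj-sym : ∀ u v → adj u v ≡ adj v u
  adj-sym (ℓ , σ) (ℓ′ , σ′) = cong₂ _∧_ (cong not eq) (any?-cong (allFin K) λ P →
    trans (swap (inc ℓ P) (inc ℓ′ P) _) (cong (λ b → inc ℓ′ P ∧ (inc ℓ P ∧ b)) (xor-comm (Vec.lookup σ P) (Vec.lookup σ′ P))))
    where
    swap : ∀ a b c → a ∧ (b ∧ c) ≡ b ∧ (a ∧ c)
    swap a b c = trans (sym (∧-assoc a b c)) (trans (cong (_∧ c) (∧-comm a b)) (∧-assoc b a c))
    eq : does (ℓ ≟L ℓ′) ≡ does (ℓ′ ≟L ℓ)
    eq with ℓ ≟L ℓ′ | ℓ′ ≟L ℓ
    ... | yes _ | yes _ = refl
    ... | no _ | no _ = refl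
    ... | yes p | no q = contradiction (sym p) q
    ... | no p | yes q = contradiction (sym q) p

  record Clash (u v : Labelled) : Set where
    constructor mkClash
    field
      distinct : proj₁ u ≢ proj₁ v
      at  : Fin K
      onˡ  : inc (proj₁ u) at ≡ true
      onʳ  : inc (proj₁ v) at ≡ true
      labels   : Vec.lookup (proj₂ u) at xor Vec.lookup (proj₂ v) at ≡ true
  open Clash

  adj⇒Clash : ∀ u v → adj u v ≡ true → Clash u v
  adj⇒Clash u v h =
    let (ns , c) = ∧-⁻ h
        (P , _ , e) = any?-⁻ (allFin K) (clash u v) c
        (e₁ , e₂₃) = ∧-⁻ e
        (e₂ , e₃) = ∧-⁻ e₂₃
    in mkClash (λ q → true≢false (⇒does (proj₁ u ≟L proj₁ v) q) (not-⁻ ns)) P e₁ e₂ e₃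

  -- If `u` clashes with `v` and with `w` at one point, then that point is also the only common
  -- point of the lines of `v` and `w`, so their clash is there too; three labels from a two-element
  -- set cannot differ pairwise.
  clash-points-differ : (∀ ℓ ℓ′ P Q → ℓ ≢ ℓ′ → inc ℓ P ≡ true → inc ℓ′ P ≡ true → inc ℓ Q ≡ true → inc ℓ′ Q ≡ true → P ≡ Q) →
    ∀ {u v w} (c : Clash u v) (c′ : Clash u w) (c″ : Clash v w) → at c ≢ at c′
  clash-points-differ meet-once {u} {v} {w} (mkClash _ P a₁ a₂ a₃) (mkClash _ _ b₁ b₂ b₃) (mkClash ne Q c₁ c₂ c₃) refl
    with meet-once (proj₁ v) (proj₁ w) P Q ne a₂ b₂ c₁ c₂
  ... | refl = bool-pigeonhole (Vec.lookup (proj₂ u) P) (Vec.lookup (proj₂ v) P) (Vec.lookup (proj₂ w) P) a₃ b₃ c₃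

  flip : ∀ {u v} → Clash u v → Clash v u
  flip {u} {v} (mkClash ne P a b c) = mkClash (ne ∘ sym) P b a (trans (xor-comm (Vec.lookup (proj₂ v) P) _) c)

  labelled : List Line → List Labelled
  labelled Ls = cartesianProduct Ls (allVec K)

  length-labelled : ∀ Ls → length (labelled Ls) ≡ length Ls * 2 ^ K
  length-labelled Ls = begin
    length (labelled Ls)  ≡⟨ trans (sym (*-identityʳ _)) (sym (∑-const (labelled Ls) 1)) ⟩
    ∑ (labelled Ls) (λ _ → 1)  ≡⟨ ∑-cartesianProduct Ls (allVec K) _ ⟩
    ∑ Ls (λ _ → ∑ (allVec K) (λ _ → 1))     ≡⟨ ∑-const Ls _ ⟩
    length Ls * ∑ (allVec K) (λ _ → 1)  ≡⟨ cong (length Ls *_) (trans (∑-const (allVec K) 1) (trans (*-identityʳ _) (length-allVec K))) ⟩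
    length Ls * 2 ^ K ∎
    where open ≡-Reasoning

  module Supersaturation (Ls : List Line) (Ls-unique : Unique Ls)
    (meet-once : ∀ ℓ ℓ′ P Q → ℓ ≢ ℓ′ → inc ℓ P ≡ true → inc ℓ′ P ≡ true → inc ℓ Q ≡ true → inc ℓ′ Q ≡ true → P ≡ Q)
    (r R : ℕ) (rich : ∀ ℓ → ℓ ∈ Ls → 8 * r ≤ # (allFin K) (inc ℓ)) (thin : ∀ ℓ → # (allFin K) (inc ℓ) ≤ R) where

    -- Distinct lines share at most one point, so clashes overcount adjacency only between labelled
    -- copies of one line, by at most its number of points.
    clash≤ : ∀ u v → # (allFin K) (clash u v) ≤ ⟦ adj u v ⟧ + ⟦ same u v ⟧ * R
    clash≤ u@(ℓ , σ) v@(ℓ′ , σ′) with ℓ ≟L ℓ′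
    ... | yes _ = ≤-trans (≤-trans (#-mono (allFin K) (λ P → proj₁ ∘ ∧-⁻)) (thin ℓ)) (≤-reflexive (sym (+-identityʳ R)))
    ... | no ℓ≢ = ≤-trans (#≤any? (allFin K) _ (#-≤1 (allFin K) _ (allFin-unique K)
        λ P Q _ _ p q → let (p₁ , p₂) = ∧-⁻ p ; (q₁ , q₂) = ∧-⁻ q in
          meet-once ℓ ℓ′ P Q ℓ≢ p₁ (proj₁ (∧-⁻ p₂)) q₁ (proj₁ (∧-⁻ q₂))))
      (m≤m+n _ _)

    module _ (A : List Labelled) (A⊆ : A ⊆ labelled Ls) where

      same≤ : ∀ u → # A (same u) ≤ 2 ^ K
      same≤ u@(ℓ , _) = begin
        # A (same u)  ≤⟨ ∑-⊆ A⊆ _ ⟩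
        # (labelled Ls) (same u)  ≡⟨ ∑-cartesianProduct Ls (allVec K) _ ⟩
        ∑ Ls (λ ℓ′ → ∑ (allVec K) (λ _ → ⟦ does (ℓ ≟L ℓ′) ⟧)) ≡⟨ ∑-cong Ls (λ ℓ′ → trans (∑-const (allVec K) _) (cong (_* ⟦ does (ℓ ≟L ℓ′) ⟧) (length-allVec K))) ⟩
        ∑ Ls (λ ℓ′ → 2 ^ K * ⟦ does (ℓ ≟L ℓ′) ⟧)  ≡⟨ ∑-*ˡ Ls (2 ^ K) _ ⟩
        2 ^ K * # Ls (λ ℓ′ → does (ℓ ≟L ℓ′))  ≤⟨ *-monoʳ-≤ (2 ^ K) (#-≤1 Ls _ Ls-unique λ x y _ _ p q → trans (sym (does⇒ (ℓ ≟L x) p)) (does⇒ (ℓ ≟L y) q)) ⟩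
        2 ^ K * 1  ≡⟨ *-identityʳ _ ⟩
        2 ^ K ∎
        where open ≤-Reasoning

      a = length A
      degrees = ∑ A (λ u → # A (adj u))

      minority majority : Fin K → Bool → ℕ
      minority P b = # A (λ (ℓ , σ) → inc ℓ P ∧ (Vec.lookup σ P xor b))
      majority P b = # A (λ (ℓ , σ) → inc ℓ P ∧ not (Vec.lookup σ P xor b))

      -- τ P is the majority label at P.  Few labelled lines agree with τ at most of their points (Hamming balls), so
      -- the minorities x P are large on average, and minority times majority counts edges.
      balanced : ∀ P → ∃ λ b → minority P b ≤ majority P b
      balanced P with minority P true ≤? majority P true
      ... | yes q = true , q
      ... | no q = false , subst₂ _≤_ (∑-cong A λ (ℓ , σ) → cong (λ b → ⟦ inc ℓ P ∧ b ⟧) (flip₁ (Vec.lookup σ P)))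
                                      (∑-cong A λ (ℓ , σ) → cong (λ b → ⟦ inc ℓ P ∧ b ⟧) (flip₂ (Vec.lookup σ P))) (<⇒≤ (≰⇒> q))
        where
        flip₁ : ∀ b → not (b xor true) ≡ b xor false
        flip₁ true = refl
        flip₁ false = refl
        flip₂ : ∀ b → b xor true ≡ not (b xor false)
        flip₂ true = refl
        flip₂ false = refl

      τ : Fin K → Bool
      τ P = proj₁ (balanced P)

      x = λ P → minority P (τ P)

      clash-pair : ∀ u v P → ⟦ inc (proj₁ u) P ∧ (Vec.lookup (proj₂ u) P xor τ P) ⟧ * ⟦ inc (proj₁ v) P ∧ not (Vec.lookup (proj₂ v) P xor τ P) ⟧ ≤ ⟦ clash u v P ⟧
      clash-pair (ℓ , σ) (ℓ′ , σ′) P = go (inc ℓ P) (inc ℓ′ P) (Vec.lookup σ P) (Vec.lookup σ′ P) (τ P)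
        where
        go : ∀ i j s t b → ⟦ i ∧ (s xor b) ⟧ * ⟦ j ∧ not (t xor b) ⟧ ≤ ⟦ i ∧ (j ∧ (s xor t)) ⟧
        go false j s t b = z≤n
        go true false s t b = ≤-reflexive (*-zeroʳ ⟦ s xor b ⟧)
        go true true true true true = ≤-refl
        go true true true true false = ≤-refl
        go true true true false true = z≤n
        go true true true false false = ≤-refl
        go true true false true true = ≤-refl
        go true true false true false = z≤n
        go true true false false true = ≤-refl
        go true true false false false = ≤-refl

      ∑x²≤ : ∑ (allFin K) (λ P → x P * x P) ≤ degrees + a * (2 ^ K * R)
      ∑x²≤ = begin
        ∑ (allFin K) (λ P → x P * x P)  ≤⟨ ∑-mono (allFin K) (λ P → *-monoʳ-≤ (x P) (proj₂ (balanced P))) ⟩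
        ∑ (allFin K) (λ P → x P * majority P (τ P))  ≡⟨ ∑-cong (allFin K) (λ P → trans (sym (∑-*ʳ A _ _)) (∑-cong A λ u → sym (∑-*ˡ A ⟦ inc (proj₁ u) P ∧ (Vec.lookup (proj₂ u) P xor τ P) ⟧ _))) ⟩
        ∑ (allFin K) (λ P → ∑ A (λ u → ∑ A (λ v → ⟦ inc (proj₁ u) P ∧ (Vec.lookup (proj₂ u) P xor τ P) ⟧ * ⟦ inc (proj₁ v) P ∧ not (Vec.lookup (proj₂ v) P xor τ P) ⟧)))
          ≤⟨ ∑-mono (allFin K) (λ P → ∑-mono A (λ u → ∑-mono A (λ v → clash-pair u v P))) ⟩
        ∑ (allFin K) (λ P → ∑ A (λ u → ∑ A (λ v → ⟦ clash u v P ⟧)))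
          ≡⟨ trans (∑-swap (allFin K) A _) (∑-cong A (λ u → ∑-swap (allFin K) A _)) ⟩
        ∑ A (λ u → ∑ A (λ v → # (allFin K) (clash u v)))     ≤⟨ ∑-mono A (λ u → ∑-mono A (clash≤ u)) ⟩
        ∑ A (λ u → ∑ A (λ v → ⟦ adj u v ⟧ + ⟦ same u v ⟧ * R)) ≡⟨ ∑-cong A (λ u → trans (∑-+ A _ _) (cong (# A (adj u) +_) (∑-*ʳ A R _))) ⟩
        ∑ A (λ u → # A (adj u) + # A (same u) * R)  ≤⟨ ∑-mono A (λ u → +-monoʳ-≤ (# A (adj u)) (*-monoˡ-≤ R (same≤ u))) ⟩
        ∑ A (λ u → # A (adj u) + 2 ^ K * R)  ≡⟨ trans (∑-+ A _ _) (cong (degrees +_) (∑-const A _)) ⟩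
        degrees + a * (2 ^ K * R) ∎
        where open ≤-Reasoning

      disᵤ : Labelled → ℕ
      disᵤ (ℓ , σ) = dis (inc ℓ) τ σ

      low : Labelled → Bool
      low u = disᵤ u ≤ᵇ r

      low≤ : # A low * 4 ^ r ≤ length Ls * 2 ^ K
      low≤ = begin
        # A low * 4 ^ r  ≤⟨ *-monoˡ-≤ (4 ^ r) (∑-⊆ A⊆ _) ⟩
        # (labelled Ls) low * 4 ^ r  ≡⟨ cong (_* 4 ^ r) (∑-cartesianProduct Ls (allVec K) _) ⟩
        ∑ Ls (λ ℓ → # (allVec K) (λ σ → low (ℓ , σ))) * 4 ^ r  ≡⟨ ∑-*ʳ Ls (4 ^ r) _ ⟨
        ∑ Ls (λ ℓ → # (allVec K) (λ σ → low (ℓ , σ)) * 4 ^ r)  ≤⟨ ∑-mono-∈ Ls (λ ℓ i → hamming-ball (inc ℓ) τ r (rich ℓ i)) ⟩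
        ∑ Ls (λ _ → 2 ^ K)  ≡⟨ ∑-const Ls _ ⟩
        length Ls * 2 ^ K ∎
        where open ≤-Reasoning

      ∑x≥ : r * a ≤ ∑ (allFin K) x + r * # A low
      ∑x≥ = begin
        r * a  ≡⟨ trans (*-comm r a) (sym (∑-const A r)) ⟩
        ∑ A (λ _ → r)  ≤⟨ ∑-mono A pointwise ⟩
        ∑ A (λ u → disᵤ u + r * ⟦ low u ⟧)  ≡⟨ trans (∑-+ A _ _) (cong₂ _+_ (sym (∑-swap (allFin K) A _)) (∑-*ˡ A r _)) ⟩
        ∑ (allFin K) x + r * # A low ∎
        where
        open ≤-Reasoning
        pointwise : ∀ u → r ≤ disᵤ u + r * ⟦ low u ⟧
        pointwise u with ≤ᵇ-cases (disᵤ u) r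
        ... | inj₁ (e , _) rewrite e = ≤-trans (≤-reflexive (sym (*-identityʳ r))) (m≤n+m _ (disᵤ u))
        ... | inj₂ (_ , q) = ≤-trans (<⇒≤ q) (m≤m+n _ _)

      module _ (B : ℕ) (1≤K : 1 ≤ K) (hB : 8 * K ≤ r * r * suc B) (hM : suc B * (2 ^ K * R) ≤ a)
               (hlow : 2 * (length Ls * 2 ^ K) ≤ 4 ^ r * a) (1≤a : 1 ≤ a) where

        open ≤-Reasoning

        -- By the Hamming bound and `hlow`, at most half of `A` is close to `τ`; every other
        -- labelled line disagrees with `τ` in more than `r` of its points.
        half : r * a ≤ 2 * ∑ (allFin K) x
        half = +-cancelʳ-≤ (r * a) _ _ (begin
          r * a + r * a  ≤⟨ +-mono-≤ ∑x≥ ∑x≥ ⟩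
          (∑ (allFin K) x + r * # A low) + (∑ (allFin K) x + r * # A low) ≡⟨ e (∑ (allFin K) x) r (# A low) ⟩
          2 * ∑ (allFin K) x + r * (2 * # A low)  ≤⟨ +-monoʳ-≤ _ (*-monoʳ-≤ r few) ⟩
          2 * ∑ (allFin K) x + r * a ∎)
          where
          e : ∀ s r l → (s + r * l) + (s + r * l) ≡ 2 * s + r * (2 * l)
          e = solve-∀
          few : 2 * # A low ≤ a
          few = *-cancelʳ-≤ _ _ (4 ^ r) {{m^n≢0 4 r}} (begin
            2 * # A low * 4 ^ r  ≡⟨ *-assoc 2 (# A low) (4 ^ r) ⟩
            2 * (# A low * 4 ^ r)  ≤⟨ *-monoʳ-≤ 2 low≤ ⟩
            2 * (length Ls * 2 ^ K)    ≤⟨ hlow ⟩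
            4 ^ r * a  ≡⟨ *-comm (4 ^ r) a ⟩
            a * 4 ^ r ∎)

        many : a * a ≤ suc B * degrees
        many = many-edges K r (suc B) a (∑ (allFin K) x) degrees (2 ^ K * R) _ 1≤K hB hM half
          (subst (λ k → ∑ (allFin K) x * ∑ (allFin K) x ≤ k * ∑ (allFin K) (λ P → x P * x P)) (Listₚ.length-tabulate {n = K} id) (cauchy (allFin K) x))
          ∑x²≤

        high-degree : ∃ λ xs → ∃ λ v → ∃ λ ys → A ≡ xs ++ v ∷ ys × suc B * length (_∖_ adj A v) ≤ B * length A
        high-degree = let (v , v∈ , q) = found ; (xs , ys , e) = ∈-∃++ v∈ in xs , v , ys , e , shrink v q
          where
          found : ∃ λ v → v ∈ A × a ≤ suc B * # A (adj v)
          found = ≤∑⇒∃ A a (λ v → suc B * # A (adj v)) 1≤a (≤-trans many (≤-reflexive (sym (∑-*ˡ A (suc B) (λ v → # A (adj v))))))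
          shrink : ∀ v → a ≤ suc B * # A (adj v) → suc B * length (_∖_ adj A v) ≤ B * a
          shrink v q = +-cancelˡ-≤ a _ _ (begin
            a + suc B * length (_∖_ adj A v)  ≡⟨ cong (λ k → a + suc B * k) (length-filterᵇ _ A) ⟩
            a + suc B * # A (not ∘ adj v)  ≤⟨ +-monoˡ-≤ _ q ⟩
            suc B * # A (adj v) + suc B * # A (not ∘ adj v)    ≡⟨ *-distribˡ-+ (suc B) (# A (adj v)) _ ⟨
            suc B * (# A (adj v) + # A (not ∘ adj v))  ≡⟨ cong (suc B *_) (#-total A (adj v)) ⟩
            a + B * a ∎)

-- O'Nan configurations

-- O'Nan's argument is phrased by polynomial identities and the absence of zero divisors, without
-- division, so that it applies to pairs of integers modulo p under a setoid equality. The map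
-- `fromℤ` supplies the coefficients of the ring solver.
record ConjugationDomain (R : CommutativeRing 0ℓ 0ℓ) : Set where
  open CommutativeRing R renaming (_+_ to _⊕_; _*_ to _⊗_; _-_ to _⊖_) using (Carrier; _≈_; 0#)
  field
    fromℤ     : ℤ.+-*-rawRing -Raw-AlmostCommutative⟶ fromCommutativeRing R
    conj  : Carrier → Carrier
    conj-cong : ∀ {x y} → x ≈ y → conj x ≈ conj y
    conj-⊕    : ∀ x y → conj (x ⊕ y) ≈ conj x ⊕ conj y
    conj-⊗    : ∀ x y → conj (x ⊗ y) ≈ conj x ⊗ conj y
    conj-⊖    : ∀ x y → conj (x ⊖ y) ≈ conj x ⊖ conj y
    conj-conj : ∀ x → conj (conj x) ≈ x
    domain    : ∀ x y → x ⊗ y ≈ 0# → x ≈ 0# ⊎ y ≈ 0#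
    char≢2    : ∀ x → x ⊕ x ≈ 0# → x ≈ 0#

module Quadrilateral (R : CommutativeRing 0ℓ 0ℓ) (D : ConjugationDomain R) where

  open CommutativeRing R using (Carrier; _≈_; 0#; +-cong; +-congˡ; +-congʳ; *-cong; *-congˡ; *-congʳ; -‿cong; setoid; -‿inverseʳ)
    renaming (_+_ to _⊕_; _*_ to _⊗_; _-_ to _⊖_; -_ to ⊖_; refl to ≈-refl; sym to ≈-sym; trans to ≈-trans)
  open ConjugationDomain D
  open Relation.Binary.Reasoning.Setoid setoid

  coefficients-equal? : ∀ m n → Maybe (_-Raw-AlmostCommutative⟶_.⟦_⟧ fromℤ m ≈ _-Raw-AlmostCommutative⟶_.⟦_⟧ fromℤ n)
  coefficients-equal? m n with m ℤ.≟ n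
  ... | yes refl = just ≈-refl
  ... | no _ = nothing

  open Algebra.Solver.Ring ℤ.+-*-rawRing (fromCommutativeRing R) fromℤ coefficients-equal?
    using (solve; _:=_; _:+_; _:*_; _:-_; :-_)

  infixl 7 _⊗₂_
  _⊗₂_ : Carrier → Carrier → Carrier
  x ⊗₂ y = x ⊗ y ⊕ x ⊗ y

  conj-⊗₂ : ∀ x y → conj (x ⊗₂ y) ≈ conj x ⊗₂ conj y
  conj-⊗₂ x y = ≈-trans (conj-⊕ _ _) (+-cong (conj-⊗ x y) (conj-⊗ x y))

  ⊖-swap : ∀ x y → x ⊖ y ≈ ⊖ (y ⊖ x)
  ⊖-swap = solve 2 (λ x y → x :- y := :- (y :- x)) ≈-refl

  -- The factor 2 makes the real part of `y` the norm of `x`, so that the curve is parametrised by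
  -- `x` and the imaginary part of `y` without halving.
  Null : Carrier → Carrier → Set
  Null x y = y ⊕ conj y ≈ x ⊗₂ conj x

  -- The sesquilinear polarisation of `Null`: on the diagonal it vanishes exactly at the points of
  -- the curve.
  form : Carrier → Carrier → Carrier → Carrier → Carrier
  form x y x′ y′ = y ⊕ conj y′ ⊖ x ⊗₂ conj x′

  form-conj : ∀ x y x′ y′ → conj (form x y x′ y′) ≈ form x′ y′ x y
  form-conj x y x′ y′ = begin
    conj (y ⊕ conj y′ ⊖ x ⊗₂ conj x′)  ≈⟨ conj-⊖ _ _ ⟩
    conj (y ⊕ conj y′) ⊖ conj (x ⊗₂ conj x′)  ≈⟨ +-cong (conj-⊕ _ _) (-‿cong (conj-⊗₂ _ _)) ⟩
    conj y ⊕ conj (conj y′) ⊖ conj x ⊗₂ conj (conj x′)  ≈⟨ +-cong (+-congˡ (conj-conj y′)) (-‿cong (+-cong (*-congˡ (conj-conj x′)) (*-congˡ (conj-conj x′)))) ⟩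
    conj y ⊕ y′ ⊖ conj x ⊗₂ x′  ≈⟨ solve 4 (λ ȳ y′ x̄ x′ → ȳ :+ y′ :- (x̄ :* x′ :+ x̄ :* x′) := y′ :+ ȳ :- (x′ :* x̄ :+ x′ :* x̄)) ≈-refl (conj y) y′ (conj x) x′ ⟩
    form x′ y′ x y ∎

  -- The value of the Hermitian form on the points of the line of slope a with first coordinates x and x′.
  chord : Carrier → Carrier → Carrier → Carrier
  chord a x x′ = (x ⊖ x′) ⊗ (a ⊖ (conj x′ ⊕ conj x′))

  -- Along a line the form is affine in its first argument, and it vanishes when that argument is
  -- the null point `x′` itself; hence the factor `x ⊖ x′` splits off.
  chord-form : ∀ a b x x′ y y′ → y ≈ a ⊗ x ⊕ b → y′ ≈ a ⊗ x′ ⊕ b → Null x′ y′ → chord a x x′ ≈ form x y x′ y′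
  chord-form a b x x′ y y′ e e′ n = begin
    chord a x x′
      ≈⟨ solve 6 (λ a b x x′ x̄′ ȳ′ → (x :- x′) :* (a :- (x̄′ :+ x̄′)) :=
           (a :* x :+ b) :+ ȳ′ :- (x :* x̄′ :+ x :* x̄′) :- ((a :* x′ :+ b) :+ ȳ′ :- (x′ :* x̄′ :+ x′ :* x̄′))) ≈-refl a b x x′ (conj x′) (conj y′) ⟩
    (a ⊗ x ⊕ b) ⊕ conj y′ ⊖ x ⊗₂ conj x′ ⊖ ((a ⊗ x′ ⊕ b) ⊕ conj y′ ⊖ x′ ⊗₂ conj x′)
      ≈⟨ +-cong (+-congʳ (+-congʳ (≈-sym e))) (-‿cong (+-congʳ (≈-trans (+-congʳ (≈-sym e′)) n))) ⟩
    form x y x′ y′ ⊖ (x′ ⊗₂ conj x′ ⊖ x′ ⊗₂ conj x′)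
      ≈⟨ solve 2 (λ z w → z :- (w :- w) := z) ≈-refl (form x y x′ y′) (x′ ⊗₂ conj x′) ⟩
    form x y x′ y′ ∎

  chord-flip : ∀ a b x x′ y y′ → y ≈ a ⊗ x ⊕ b → y′ ≈ a ⊗ x′ ⊕ b → Null x y → Null x′ y′ → conj (chord a x x′) ≈ chord a x′ x
  chord-flip a b x x′ y y′ e e′ n n′ = begin
    conj (chord a x x′)    ≈⟨ conj-cong (chord-form a b x x′ y y′ e e′ n′) ⟩
    conj (form x y x′ y′)  ≈⟨ form-conj x y x′ y′ ⟩
    form x′ y′ x y  ≈⟨ chord-form a b x′ x y′ y e′ e n ⟨
    chord a x′ x ∎

  Imaginary : Carrier → Set
  Imaginary x = conj x ≈ ⊖ x

  -- Every use of `chord-flip` exchanges the slope factor at one end of a chord for the one at the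
  -- other end. Once round p, s and q the factor at `q` is back, and the differences picked up agree
  -- with the original ones up to a single sign.
  collinear-imaginary : ∀ a b p q s yp yq ys → yp ≈ a ⊗ p ⊕ b → yq ≈ a ⊗ q ⊕ b → ys ≈ a ⊗ s ⊕ b →
    Null p yp → Null q yq → Null s ys → Imaginary (conj (p ⊖ s) ⊗ (s ⊖ q) ⊗ chord a p q)
  collinear-imaginary a b p q s yp yq ys ep eq es np nq ns = begin
    conj (conj (p ⊖ s) ⊗ (s ⊖ q) ⊗ chord a p q)
      ≈⟨ ≈-trans (conj-⊗ _ _) (*-cong (≈-trans (conj-⊗ _ _) (*-cong (conj-conj _) conj-sq)) (chord-flip a b p q yp yq ep eq np nq)) ⟩
    (p ⊖ s) ⊗ ⊖ conj (q ⊖ s) ⊗ ((q ⊖ p) ⊗ slope p)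
      ≈⟨ solve 5 (λ p q s z w → (p :- s) :* (:- z) :* ((q :- p) :* w) := :- (((s :- p) :* w) :* z :* (p :- q))) ≈-refl p q s (conj (q ⊖ s)) (slope p) ⟩
    ⊖ (chord a s p ⊗ conj (q ⊖ s) ⊗ (p ⊖ q))
      ≈⟨ -‿cong (*-congʳ (*-congʳ (≈-sym (chord-flip a b p s yp ys ep es np ns)))) ⟩
    ⊖ (conj (chord a p s) ⊗ conj (q ⊖ s) ⊗ (p ⊖ q))
      ≈⟨ -‿cong (*-congʳ (≈-trans (*-congʳ (conj-⊗ _ _)) (solve 3 (λ x y z → x :* y :* z := x :* (z :* y)) ≈-refl _ _ _))) ⟩
    ⊖ (conj (p ⊖ s) ⊗ (conj (q ⊖ s) ⊗ conj (slope s)) ⊗ (p ⊖ q))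
      ≈⟨ -‿cong (*-congʳ (*-congˡ (≈-trans (≈-sym (conj-⊗ _ _)) (chord-flip a b q s yq ys eq es nq ns)))) ⟩
    ⊖ (conj (p ⊖ s) ⊗ chord a s q ⊗ (p ⊖ q))
      ≈⟨ -‿cong (solve 4 (λ z t w u → z :* (t :* w) :* u := z :* t :* (u :* w)) ≈-refl (conj (p ⊖ s)) (s ⊖ q) (slope q) (p ⊖ q)) ⟩
    ⊖ (conj (p ⊖ s) ⊗ (s ⊖ q) ⊗ chord a p q) ∎
    where
    slope : Carrier → Carrier
    slope x = a ⊖ (conj x ⊕ conj x)
    conj-sq : conj (s ⊖ q) ≈ ⊖ conj (q ⊖ s)
    conj-sq = ≈-trans (conj-⊖ s q) (≈-trans (⊖-swap (conj s) (conj q)) (-‿cong (≈-sym (conj-⊖ q s))))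

  conj-≉0 : ∀ {x} → ¬ x ≈ 0# → ¬ conj x ≈ 0#
  conj-≉0 {x} nz e = nz (begin
    x  ≈⟨ conj-conj x ⟨
    conj (conj x)   ≈⟨ conj-cong (≈-trans e (≈-sym (-‿inverseʳ 0#))) ⟩
    conj (0# ⊖ 0#)  ≈⟨ conj-⊖ 0# 0# ⟩
    conj 0# ⊖ conj 0# ≈⟨ -‿inverseʳ _ ⟩
    0# ∎)

  ⊗-≉0 : ∀ {x y} → ¬ x ≈ 0# → ¬ y ≈ 0# → ¬ x ⊗ y ≈ 0#
  ⊗-≉0 {x} {y} nx ny e with domain x y e
  ... | inj₁ z = nx z
  ... | inj₂ z = ny z

  imaginary-product : ∀ x y z → Imaginary x → Imaginary y → Imaginary z → Imaginary (x ⊗ y ⊗ conj z)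
  imaginary-product x y z ix iy iz = begin
    conj (x ⊗ y ⊗ conj z)  ≈⟨ ≈-trans (conj-⊗ _ _) (*-cong (≈-trans (conj-⊗ x y) (*-cong ix iy)) (conj-cong iz)) ⟩
    ⊖ x ⊗ ⊖ y ⊗ conj (⊖ z)  ≈⟨ *-congˡ (≈-trans (conj-cong (solve 1 (λ z → :- z := (z :- z) :- z) ≈-refl z)) (≈-trans (conj-⊖ _ _) (+-congʳ (conj-⊖ z z)))) ⟩
    ⊖ x ⊗ ⊖ y ⊗ (conj z ⊖ conj z ⊖ conj z)
                                       ≈⟨ solve 3 (λ x y z → (:- x) :* (:- y) :* (z :- z :- z) := :- (x :* y :* z)) ≈-refl x y (conj z) ⟩
    ⊖ (x ⊗ y ⊗ conj z) ∎

  -- The Gram determinant of three null vectors, via β = ⟨B , A⟩ and g = ⟨C , A⟩.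
  gram-determinant : ∀ P Q β g δ → β ⊕ conj β ≈ P ⊗₂ conj P → g ⊕ conj g ≈ Q ⊗₂ conj Q →
    δ ≈ β ⊕ conj g ⊖ P ⊗₂ conj Q →
    conj β ⊗ δ ⊗ g ⊕ conj (conj β ⊗ δ ⊗ g) ≈ (β ⊗ Q ⊖ g ⊗ P) ⊗₂ conj (β ⊗ Q ⊖ g ⊗ P)
  gram-determinant P Q β g δ eβ eg eδ = begin
    conj β ⊗ δ ⊗ g ⊕ conj (conj β ⊗ δ ⊗ g)
      ≈⟨ +-cong (*-congʳ (*-congˡ eδ)) (≈-trans (conj-⊗ _ _) (*-congʳ (≈-trans (conj-⊗ _ _) (*-cong (conj-conj β) conj-δ)))) ⟩
    conj β ⊗ (β ⊕ conj g ⊖ P ⊗₂ conj Q) ⊗ g ⊕ β ⊗ (conj β ⊕ g ⊖ conj P ⊗₂ Q) ⊗ conj g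
      ≈⟨ solve 8 (λ β β̄ g ḡ P P̄ Q Q̄ →
           β̄ :* (β :+ ḡ :- (P :* Q̄ :+ P :* Q̄)) :* g :+ β :* (β̄ :+ g :- (P̄ :* Q :+ P̄ :* Q)) :* ḡ :=
           β :* β̄ :* (g :+ ḡ) :+ g :* ḡ :* (β :+ β̄) :- (β̄ :* g :* (P :* Q̄ :+ P :* Q̄) :+ β :* ḡ :* (P̄ :* Q :+ P̄ :* Q)))
           ≈-refl β (conj β) g (conj g) P (conj P) Q (conj Q) ⟩
    β ⊗ conj β ⊗ (g ⊕ conj g) ⊕ g ⊗ conj g ⊗ (β ⊕ conj β) ⊖ (conj β ⊗ g ⊗ (P ⊗₂ conj Q) ⊕ β ⊗ conj g ⊗ (conj P ⊗₂ Q))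
      ≈⟨ +-congʳ (+-cong (*-congˡ eg) (*-congˡ eβ)) ⟩
    β ⊗ conj β ⊗ (Q ⊗₂ conj Q) ⊕ g ⊗ conj g ⊗ (P ⊗₂ conj P) ⊖ (conj β ⊗ g ⊗ (P ⊗₂ conj Q) ⊕ β ⊗ conj g ⊗ (conj P ⊗₂ Q))
      ≈⟨ solve 8 (λ β β̄ g ḡ P P̄ Q Q̄ →
           β :* β̄ :* (Q :* Q̄ :+ Q :* Q̄) :+ g :* ḡ :* (P :* P̄ :+ P :* P̄) :- (β̄ :* g :* (P :* Q̄ :+ P :* Q̄) :+ β :* ḡ :* (P̄ :* Q :+ P̄ :* Q)) :=
           (β :* Q :- g :* P) :* (β̄ :* Q̄ :- ḡ :* P̄) :+ (β :* Q :- g :* P) :* (β̄ :* Q̄ :- ḡ :* P̄))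
           ≈-refl β (conj β) g (conj g) P (conj P) Q (conj Q) ⟩
    (β ⊗ Q ⊖ g ⊗ P) ⊗₂ (conj β ⊗ conj Q ⊖ conj g ⊗ conj P)
      ≈⟨ +-cong (*-congˡ conj-Z) (*-congˡ conj-Z) ⟨
    (β ⊗ Q ⊖ g ⊗ P) ⊗₂ conj (β ⊗ Q ⊖ g ⊗ P) ∎
    where
    conj-δ : conj δ ≈ conj β ⊕ g ⊖ conj P ⊗₂ Q
    conj-δ = ≈-trans (conj-cong eδ) (≈-trans (conj-⊖ _ _) (+-cong (≈-trans (conj-⊕ _ _) (+-congˡ (conj-conj g)))
      (-‿cong (≈-trans (conj-⊗₂ _ _) (+-cong (*-congˡ (conj-conj Q)) (*-congˡ (conj-conj Q)))))))
    conj-Z : conj (β ⊗ Q ⊖ g ⊗ P) ≈ conj β ⊗ conj Q ⊖ conj g ⊗ conj P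
    conj-Z = ≈-trans (conj-⊖ _ _) (+-cong (conj-⊗ β Q) (-‿cong (conj-⊗ g P)))

  gram-sum : ∀ x y x′ y′ → Null x y → Null x′ y′ → form x y x′ y′ ⊕ conj (form x y x′ y′) ≈ (x ⊖ x′) ⊗₂ conj (x ⊖ x′)
  gram-sum x y x′ y′ n n′ = begin
    form x y x′ y′ ⊕ conj (form x y x′ y′)    ≈⟨ +-congˡ (form-conj x y x′ y′) ⟩
    form x y x′ y′ ⊕ form x′ y′ x y
      ≈⟨ solve 8 (λ x x̄ y ȳ x′ x̄′ y′ ȳ′ →
           (y :+ ȳ′ :- (x :* x̄′ :+ x :* x̄′)) :+ (y′ :+ ȳ :- (x′ :* x̄ :+ x′ :* x̄)) :=
           (y :+ ȳ) :+ (y′ :+ ȳ′) :- ((x :* x̄′ :+ x :* x̄′) :+ (x′ :* x̄ :+ x′ :* x̄)))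
           ≈-refl x (conj x) y (conj y) x′ (conj x′) y′ (conj y′) ⟩
    (y ⊕ conj y) ⊕ (y′ ⊕ conj y′) ⊖ (x ⊗₂ conj x′ ⊕ x′ ⊗₂ conj x)
      ≈⟨ +-congʳ (+-cong n n′) ⟩
    x ⊗₂ conj x ⊕ x′ ⊗₂ conj x′ ⊖ (x ⊗₂ conj x′ ⊕ x′ ⊗₂ conj x)
      ≈⟨ solve 4 (λ x x̄ x′ x̄′ →
           (x :* x̄ :+ x :* x̄) :+ (x′ :* x̄′ :+ x′ :* x̄′) :- ((x :* x̄′ :+ x :* x̄′) :+ (x′ :* x̄ :+ x′ :* x̄)) :=
           (x :- x′) :* (x̄ :- x̄′) :+ (x :- x′) :* (x̄ :- x̄′)) ≈-refl x (conj x) x′ (conj x′) ⟩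
    (x ⊖ x′) ⊗₂ (conj x ⊖ conj x′)  ≈⟨ +-cong (*-congˡ (conj-⊖ x x′)) (*-congˡ (conj-⊖ x x′)) ⟨
    (x ⊖ x′) ⊗₂ conj (x ⊖ x′) ∎

  -- Moves the base point to `a`, which writes the Gram entry of `b` and `c` in the shape that
  -- `gram-determinant` expects of `δ`.
  form-cocycle : ∀ xa ya xb yb xc yc → Null xa ya →
    form xb yb xc yc ≈ form xb yb xa ya ⊕ form xa ya xc yc ⊖ (xb ⊖ xa) ⊗₂ conj (xc ⊖ xa)
  form-cocycle xa ya xb yb xc yc n = ≈-sym (begin
    form xb yb xa ya ⊕ form xa ya xc yc ⊖ (xb ⊖ xa) ⊗₂ conj (xc ⊖ xa)
      ≈⟨ +-congˡ (-‿cong (+-cong (*-congˡ (conj-⊖ xc xa)) (*-congˡ (conj-⊖ xc xa)))) ⟩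
    form xb yb xa ya ⊕ form xa ya xc yc ⊖ (xb ⊖ xa) ⊗₂ (conj xc ⊖ conj xa)
      ≈⟨ solve 8 (λ xa x̄a ya ȳa xb yb x̄c ȳc →
           (yb :+ ȳa :- (xb :* x̄a :+ xb :* x̄a)) :+ (ya :+ ȳc :- (xa :* x̄c :+ xa :* x̄c)) :- ((xb :- xa) :* (x̄c :- x̄a) :+ (xb :- xa) :* (x̄c :- x̄a)) :=
           (yb :+ ȳc :- (xb :* x̄c :+ xb :* x̄c)) :+ ((ya :+ ȳa) :- (xa :* x̄a :+ xa :* x̄a)))
           ≈-refl xa (conj xa) ya (conj ya) xb yb (conj xc) (conj yc) ⟩
    form xb yb xc yc ⊕ ((ya ⊕ conj ya) ⊖ xa ⊗₂ conj xa)  ≈⟨ +-congˡ (+-congʳ n) ⟩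
    form xb yb xc yc ⊕ (xa ⊗₂ conj xa ⊖ xa ⊗₂ conj xa)
      ≈⟨ solve 2 (λ z w → z :+ (w :- w) := z) ≈-refl (form xb yb xc yc) (xa ⊗₂ conj xa) ⟩
    form xb yb xc yc ∎)

  -- For lines meeting at (u , v), the vertical distance of a point of the first line from the
  -- second is proportional to `x ⊖ u`. This yields both Menelaus' theorem and the uniqueness of the
  -- meeting point.
  offset : ∀ a b a′ b′ x y u v → y ≈ a ⊗ x ⊕ b → v ≈ a ⊗ u ⊕ b → v ≈ a′ ⊗ u ⊕ b′ → (a ⊖ a′) ⊗ (x ⊖ u) ≈ y ⊖ (a′ ⊗ x ⊕ b′)
  offset a b a′ b′ x y u v ey ev ev′ = begin
    (a ⊖ a′) ⊗ (x ⊖ u)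
      ≈⟨ solve 6 (λ a b a′ b′ x u → (a :- a′) :* (x :- u) := (a :* x :+ b) :- (a′ :* x :+ b′) :- ((a :* u :+ b) :- (a′ :* u :+ b′))) ≈-refl a b a′ b′ x u ⟩
    (a ⊗ x ⊕ b) ⊖ (a′ ⊗ x ⊕ b′) ⊖ ((a ⊗ u ⊕ b) ⊖ (a′ ⊗ u ⊕ b′))
      ≈⟨ +-cong (+-congʳ (≈-sym ey)) (-‿cong (+-cong (≈-sym ev) (-‿cong (≈-sym ev′)))) ⟩
    y ⊖ (a′ ⊗ x ⊕ b′) ⊖ (v ⊖ v)
      ≈⟨ solve 2 (λ z w → z :- (w :- w) := z) ≈-refl (y ⊖ (a′ ⊗ x ⊕ b′)) v ⟩
    y ⊖ (a′ ⊗ x ⊕ b′) ∎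

  interchange : ∀ u v w x y z → (u ⊗ v ⊗ w) ⊗ (x ⊗ y ⊗ z) ≈ (u ⊗ x) ⊗ (v ⊗ y) ⊗ (w ⊗ z)
  interchange = solve 6 (λ u v w x y z → (u :* v :* w) :* (x :* y :* z) := (u :* x) :* (v :* y) :* (w :* z)) ≈-refl

  distribute : ∀ p q r u v w u′ v′ w′ → p ⊗ q ⊗ r ⊗ (⊖ u ⊗ ⊖ v ⊗ w ⊕ u′ ⊗ v′ ⊗ ⊖ w′) ≈ p ⊗ u ⊗ (q ⊗ v) ⊗ (r ⊗ w) ⊖ p ⊗ u′ ⊗ (q ⊗ v′) ⊗ (r ⊗ w′)
  distribute p q r u v w u′ v′ w′ = begin
    p ⊗ q ⊗ r ⊗ (⊖ u ⊗ ⊖ v ⊗ w ⊕ u′ ⊗ v′ ⊗ ⊖ w′)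
      ≈⟨ *-congˡ (+-cong (solve 3 (λ u v w → (:- u) :* (:- v) :* w := u :* v :* w) ≈-refl u v w) (solve 3 (λ u v w → u :* v :* (:- w) := :- (u :* v :* w)) ≈-refl u′ v′ w′)) ⟩
    p ⊗ q ⊗ r ⊗ (u ⊗ v ⊗ w ⊖ u′ ⊗ v′ ⊗ w′)
      ≈⟨ solve 3 (λ s m m′ → s :* (m :- m′) := s :* m :- s :* m′) ≈-refl (p ⊗ q ⊗ r) (u ⊗ v ⊗ w) (u′ ⊗ v′ ⊗ w′) ⟩
    p ⊗ q ⊗ r ⊗ (u ⊗ v ⊗ w) ⊖ p ⊗ q ⊗ r ⊗ (u′ ⊗ v′ ⊗ w′)
      ≈⟨ +-cong (interchange p q r u v w) (-‿cong (interchange p q r u′ v′ w′)) ⟩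
    p ⊗ u ⊗ (q ⊗ v) ⊗ (r ⊗ w) ⊖ p ⊗ u′ ⊗ (q ⊗ v′) ⊗ (r ⊗ w′) ∎

  regroup : ∀ u v w p q r α δ g → ⊖ (u ⊗ p ⊗ α ⊗ (v ⊗ q ⊗ δ) ⊗ (r ⊗ w ⊗ g)) ≈ ⊖ (p ⊗ q ⊗ r) ⊗ (u ⊗ v ⊗ w) ⊗ (α ⊗ δ ⊗ g)
  regroup u v w p q r α δ g = begin
    ⊖ (u ⊗ p ⊗ α ⊗ (v ⊗ q ⊗ δ) ⊗ (r ⊗ w ⊗ g))
      ≈⟨ -‿cong (*-cong (interchange u p α v q δ) (*-congʳ (CommutativeRing.*-comm R r w))) ⟩
    ⊖ (u ⊗ v ⊗ (p ⊗ q) ⊗ (α ⊗ δ) ⊗ (w ⊗ r ⊗ g))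
      ≈⟨ -‿cong (interchange (u ⊗ v) (p ⊗ q) (α ⊗ δ) w r g) ⟩
    ⊖ (u ⊗ v ⊗ w ⊗ (p ⊗ q ⊗ r) ⊗ (α ⊗ δ ⊗ g))
      ≈⟨ solve 3 (λ x y z → :- (x :* y :* z) := (:- y) :* x :* z) ≈-refl (u ⊗ v ⊗ w) (p ⊗ q ⊗ r) (α ⊗ δ ⊗ g) ⟩
    ⊖ (p ⊗ q ⊗ r) ⊗ (u ⊗ v ⊗ w) ⊗ (α ⊗ δ ⊗ g) ∎

  module _ {a₁ a₂ a₃ a₄ b₁ b₂ b₃ b₄ xa ya xb yb xc yc xd yd xe ye xf yf : Carrier}
    (A₁ : ya ≈ a₁ ⊗ xa ⊕ b₁) (A₂ : ya ≈ a₂ ⊗ xa ⊕ b₂) (B₁ : yb ≈ a₁ ⊗ xb ⊕ b₁) (B₃ : yb ≈ a₃ ⊗ xb ⊕ b₃)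
    (C₂ : yc ≈ a₂ ⊗ xc ⊕ b₂) (C₃ : yc ≈ a₃ ⊗ xc ⊕ b₃) (D₁ : yd ≈ a₁ ⊗ xd ⊕ b₁) (D₄ : yd ≈ a₄ ⊗ xd ⊕ b₄)
    (E₂ : ye ≈ a₂ ⊗ xe ⊕ b₂) (E₄ : ye ≈ a₄ ⊗ xe ⊕ b₄) (F₃ : yf ≈ a₃ ⊗ xf ⊕ b₃) (F₄ : yf ≈ a₄ ⊗ xf ⊕ b₄)
    (a₁₄ : ¬ a₁ ⊖ a₄ ≈ 0#) (a₂₄ : ¬ a₂ ⊖ a₄ ≈ 0#) (a₃₄ : ¬ a₃ ⊖ a₄ ≈ 0#) where

    -- The triangle A B C is cut by the fourth line in D, E, F. Multiplied by the three slope
    -- differences, each side becomes, up to sign, the product of the vertical distances of A, B and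
    -- C from the fourth line.
    menelaus : (xd ⊖ xb) ⊗ (xf ⊖ xc) ⊗ (xa ⊖ xe) ≈ ⊖ ((xa ⊖ xd) ⊗ (xb ⊖ xf) ⊗ (xe ⊖ xc))
    menelaus = finish (domain _ _ vanishes)
      where
      gap : Carrier → Carrier → Carrier
      gap x y = y ⊖ (a₄ ⊗ x ⊕ b₄)
      M₁ = (xd ⊖ xb) ⊗ (xf ⊖ xc) ⊗ (xa ⊖ xe)
      M₂ = (xa ⊖ xd) ⊗ (xb ⊖ xf) ⊗ (xe ⊖ xc)
      slopes = (a₁ ⊖ a₄) ⊗ (a₃ ⊖ a₄) ⊗ (a₂ ⊖ a₄)
      vanishes : slopes ⊗ (M₁ ⊕ M₂) ≈ 0#
      vanishes = begin
        (a₁ ⊖ a₄) ⊗ (a₃ ⊖ a₄) ⊗ (a₂ ⊖ a₄) ⊗ (M₁ ⊕ M₂)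
          ≈⟨ *-congˡ (+-cong (*-congʳ (*-cong (⊖-swap xd xb) (⊖-swap xf xc))) (*-congˡ (⊖-swap xe xc))) ⟩
        (a₁ ⊖ a₄) ⊗ (a₃ ⊖ a₄) ⊗ (a₂ ⊖ a₄) ⊗ (⊖ (xb ⊖ xd) ⊗ ⊖ (xc ⊖ xf) ⊗ (xa ⊖ xe) ⊕ (xa ⊖ xd) ⊗ (xb ⊖ xf) ⊗ ⊖ (xc ⊖ xe))
          ≈⟨ distribute (a₁ ⊖ a₄) (a₃ ⊖ a₄) (a₂ ⊖ a₄) (xb ⊖ xd) (xc ⊖ xf) (xa ⊖ xe) (xa ⊖ xd) (xb ⊖ xf) (xc ⊖ xe) ⟩
        (a₁ ⊖ a₄) ⊗ (xb ⊖ xd) ⊗ ((a₃ ⊖ a₄) ⊗ (xc ⊖ xf)) ⊗ ((a₂ ⊖ a₄) ⊗ (xa ⊖ xe))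
          ⊖ (a₁ ⊖ a₄) ⊗ (xa ⊖ xd) ⊗ ((a₃ ⊖ a₄) ⊗ (xb ⊖ xf)) ⊗ ((a₂ ⊖ a₄) ⊗ (xc ⊖ xe))
          ≈⟨ +-cong (*-cong (*-cong (offset a₁ b₁ a₄ b₄ xb yb xd yd B₁ D₁ D₄) (offset a₃ b₃ a₄ b₄ xc yc xf yf C₃ F₃ F₄)) (offset a₂ b₂ a₄ b₄ xa ya xe ye A₂ E₂ E₄))
               (-‿cong (*-cong (*-cong (offset a₁ b₁ a₄ b₄ xa ya xd yd A₁ D₁ D₄) (offset a₃ b₃ a₄ b₄ xb yb xf yf B₃ F₃ F₄)) (offset a₂ b₂ a₄ b₄ xc yc xe ye C₂ E₂ E₄))) ⟩
        gap xb yb ⊗ gap xc yc ⊗ gap xa ya ⊖ gap xa ya ⊗ gap xb yb ⊗ gap xc yc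
          ≈⟨ +-congʳ (solve 3 (λ a b c → b :* c :* a := a :* b :* c) ≈-refl (gap xa ya) (gap xb yb) (gap xc yc)) ⟩
        gap xa ya ⊗ gap xb yb ⊗ gap xc yc ⊖ gap xa ya ⊗ gap xb yb ⊗ gap xc yc
          ≈⟨ -‿inverseʳ _ ⟩
        0# ∎
      finish : slopes ≈ 0# ⊎ M₁ ⊕ M₂ ≈ 0# → M₁ ≈ ⊖ M₂
      finish (inj₁ z) = contradiction z (⊗-≉0 (⊗-≉0 a₁₄ a₃₄) a₂₄)
      finish (inj₂ z) = begin
        M₁  ≈⟨ solve 2 (λ x y → x := (x :+ y) :- y) ≈-refl M₁ M₂ ⟩
        (M₁ ⊕ M₂) ⊖ M₂    ≈⟨ +-congʳ z ⟩
        0# ⊖ M₂  ≈⟨ CommutativeRing.+-identityˡ R _ ⟩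
        ⊖ M₂ ∎

    -- O'Nan: the three products below are imaginary by collinearity, hence by Menelaus so is the
    -- triple product of the triangle xa xb xc, and its Gram determinant vanishes.
    no-quadrilateral : Null xa ya → Null xb yb → Null xc yc → Null xd yd → Null xe ye → Null xf yf →
      ¬ xa ⊖ xd ≈ 0# → ¬ xb ⊖ xf ≈ 0# → ¬ xe ⊖ xc ≈ 0# → ¬ xb ⊖ xa ≈ 0# → ¬ xc ⊖ xa ≈ 0# → ¬ a₁ ⊖ a₂ ≈ 0# → ⊥
    no-quadrilateral na nb nc nd ne nf ad bf ec ba ca a₁₂ = ⊗-≉0 (⊗-≉0 M₂-≉0 (conj-≉0 M₂-≉0)) gram-≉0 (begin
      M₂ ⊗ conj M₂ ⊗ (t ⊕ conj t)
        ≈⟨ solve 4 (λ m m̄ t t̄ → m :* m̄ :* (t :+ t̄) := m :* m̄ :* t :+ m̄ :* m :* t̄) ≈-refl M₂ (conj M₂) t (conj t) ⟩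
      M₂ ⊗ conj M₂ ⊗ t ⊕ conj M₂ ⊗ M₂ ⊗ conj t
        ≈⟨ +-congˡ (≈-trans (*-congʳ (*-congˡ (≈-sym (conj-conj M₂)))) (≈-trans (*-congʳ (≈-sym (conj-⊗ _ _))) (≈-sym (conj-⊗ _ _)))) ⟩
      M₂ ⊗ conj M₂ ⊗ t ⊕ conj (M₂ ⊗ conj M₂ ⊗ t)
        ≈⟨ ≈-sym (+-cong negate (≈-trans (conj-cong negate) ≈-refl)) ⟩
      ⊖ product ⊕ conj (⊖ product)
        ≈⟨ +-congˡ (≈-trans (conj-cong (solve 1 (λ z → :- z := (z :- z) :- z) ≈-refl product)) (≈-trans (conj-⊖ _ _) (+-cong (conj-⊖ _ _) (-‿cong imaginary)))) ⟩
      ⊖ product ⊕ (conj product ⊖ conj product ⊖ ⊖ product)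
        ≈⟨ solve 2 (λ z w → (:- z) :+ (w :- w :- (:- z)) := z :- z) ≈-refl product (conj product) ⟩
      product ⊖ product
        ≈⟨ -‿inverseʳ product ⟩
      0# ∎)
      where
      M₂ = (xa ⊖ xd) ⊗ (xb ⊖ xf) ⊗ (xe ⊖ xc)
      M₂-≉0 = ⊗-≉0 (⊗-≉0 ad bf) ec
      α = chord a₁ xa xb
      δ = chord a₃ xb xc
      γ = chord a₂ xa xc
      β = chord a₁ xb xa
      g = chord a₂ xc xa
      P = xb ⊖ xa
      Q = xc ⊖ xa
      t = conj β ⊗ δ ⊗ g
      t₁ = conj (xa ⊖ xd) ⊗ (xd ⊖ xb) ⊗ α
      t₂ = conj (xa ⊖ xe) ⊗ (xe ⊖ xc) ⊗ γ
      t₃ = conj (xb ⊖ xf) ⊗ (xf ⊖ xc) ⊗ δ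
      product = t₁ ⊗ t₃ ⊗ conj t₂
      imaginary : Imaginary product
      imaginary = imaginary-product t₁ t₃ t₂
        (collinear-imaginary a₁ b₁ xa xb xd ya yb yd A₁ B₁ D₁ na nb nd)
        (collinear-imaginary a₃ b₃ xb xc xf yb yc yf B₃ C₃ F₃ nb nc nf)
        (collinear-imaginary a₂ b₂ xa xc xe ya yc ye A₂ C₂ E₂ na nc ne)
      α≈ : conj β ≈ α
      α≈ = chord-flip a₁ b₁ xb xa yb ya B₁ A₁ nb na
      conj-t₂ : conj t₂ ≈ (xa ⊖ xe) ⊗ conj (xe ⊖ xc) ⊗ g
      conj-t₂ = ≈-trans (conj-⊗ _ _) (*-cong (≈-trans (conj-⊗ _ _) (*-congʳ (conj-conj _))) (chord-flip a₂ b₂ xa xc ya yc A₂ C₂ na nc))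
      conj-M₂ : conj (xa ⊖ xd) ⊗ conj (xb ⊖ xf) ⊗ conj (xe ⊖ xc) ≈ conj M₂
      conj-M₂ = ≈-sym (≈-trans (conj-⊗ _ _) (*-congʳ (conj-⊗ _ _)))
      negate : ⊖ product ≈ M₂ ⊗ conj M₂ ⊗ t
      negate = begin
        ⊖ product
          ≈⟨ -‿cong (*-congˡ conj-t₂) ⟩
        ⊖ (t₁ ⊗ t₃ ⊗ ((xa ⊖ xe) ⊗ conj (xe ⊖ xc) ⊗ g))
          ≈⟨ regroup (conj (xa ⊖ xd)) (conj (xb ⊖ xf)) (conj (xe ⊖ xc)) (xd ⊖ xb) (xf ⊖ xc) (xa ⊖ xe) α δ g ⟩
        ⊖ ((xd ⊖ xb) ⊗ (xf ⊖ xc) ⊗ (xa ⊖ xe)) ⊗ (conj (xa ⊖ xd) ⊗ conj (xb ⊖ xf) ⊗ conj (xe ⊖ xc)) ⊗ (α ⊗ δ ⊗ g)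
          ≈⟨ *-cong (*-cong (-‿cong menelaus) conj-M₂) (*-congʳ (*-congʳ (≈-sym α≈))) ⟩
        ⊖ (⊖ M₂) ⊗ conj M₂ ⊗ t
          ≈⟨ *-congʳ (*-congʳ (solve 1 (λ z → :- (:- z) := z) ≈-refl M₂)) ⟩
        M₂ ⊗ conj M₂ ⊗ t ∎
      β-form : β ≈ form xb yb xa ya
      β-form = chord-form a₁ b₁ xb xa yb ya B₁ A₁ na
      g-form : g ≈ form xc yc xa ya
      g-form = chord-form a₂ b₂ xc xa yc ya C₂ A₂ na
      determinant : Carrier
      determinant = β ⊗ Q ⊖ g ⊗ P
      gram : t ⊕ conj t ≈ determinant ⊗₂ conj determinant
      gram = gram-determinant P Q β g δ
        (≈-trans (+-cong β-form (conj-cong β-form)) (gram-sum xb yb xa ya nb na))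
        (≈-trans (+-cong g-form (conj-cong g-form)) (gram-sum xc yc xa ya nc na))
        (≈-trans (chord-form a₃ b₃ xb xc yb yc B₃ C₃ nc) (≈-trans (form-cocycle xa ya xb yb xc yc na)
          (+-congʳ (+-cong (≈-sym β-form) (≈-sym (≈-trans (conj-cong g-form) (form-conj xc yc xa ya)))))))
      -- The determinant equals `P ⊗ Q ⊗ (a₁ ⊖ a₂)`: it is nonzero because A, B, C form a genuine
      -- triangle.
      determinant-≉0 : ¬ determinant ≈ 0#
      determinant-≉0 e = ⊗-≉0 (⊗-≉0 ba ca) a₁₂ (≈-trans
        (solve 5 (λ P Q a a′ s → P :* Q :* (a :- a′) := P :* (a :- s) :* Q :- Q :* (a′ :- s) :* P) ≈-refl P Q a₁ a₂ (conj xa ⊕ conj xa)) e)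
      gram-≉0 : ¬ t ⊕ conj t ≈ 0#
      gram-≉0 e = ⊗-≉0 determinant-≉0 (conj-≉0 determinant-≉0) (char≢2 _ (≈-trans (≈-sym gram) e))

-- The field with p² elements

module Modulo (p : ℕ) (p-prime : Prime p) where

  open import Data.Integer using (+_)

  Div : ℤ → Set
  Div x = (+ p) ℤ∣.∣ x

  Div? : ∀ x → Dec (Div x)
  Div? x = (+ p) ℤ∣.∣? x

  private instance
    p≢0 : NonZero p
    p≢0 = prime⇒nonZero p-prime

  Div-+ : ∀ {x y} → Div x → Div y → Div (x ℤ.+ y)
  Div-+ = ℤ∣.∣m∣n⇒∣m+n

  Div-- : ∀ {x y} → Div x → Div y → Div (x ℤ.- y)
  Div-- = ℤ∣.∣m∣n⇒∣m-n

  Div-*ˡ : ∀ x {y} → Div y → Div (x ℤ.* y)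
  Div-*ˡ = ℤ∣.∣n⇒∣m*n

  Div-0 : Div (+ 0)
  Div-0 = ℤ∣.divides (+ 0) refl

  Div-p : Div (+ p)
  Div-p = ℤ∣.∣-refl

  euclid : ∀ x y → Div (x ℤ.* y) → Div x ⊎ Div y
  euclid x y h with euclidsLemma ∣ x ∣ ∣ y ∣ p-prime (subst (p ∣_) (ℤ.abs-* x y) (ℤ∣.∣⇒∣ᵤ h))
  ... | inj₁ q = inj₁ (ℤ∣.∣ᵤ⇒∣ q)
  ... | inj₂ q = inj₂ (ℤ∣.∣ᵤ⇒∣ q)

  Div-<⇒≡0 : ∀ n → n < p → Div (+ n) → n ≡ 0
  Div-<⇒≡0 zero n<p h = refl
  Div-<⇒≡0 (suc n) n<p h = contradiction (∣⇒≤ (ℤ∣.∣⇒∣ᵤ h)) (<⇒≱ n<p)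

  toℤ : Fin p → ℤ
  toℤ i = + Data.Fin.toℕ i

  private
    ≤-injective : ∀ m n → n ≤ m → m < p → Div (+ m ℤ.- + n) → m ≡ n
    ≤-injective m n n≤m m<p h = ≤-antisym (m∸n≡0⇒m≤n (Div-<⇒≡0 (m ∸ n) (≤-<-trans (m∸n≤m m n) m<p)
      (subst Div (trans (ℤ.m-n≡m⊖n m n) (ℤ.⊖-≥ n≤m)) h))) n≤m

  toℤ-injective : ∀ i j → Div (toℤ i ℤ.- toℤ j) → i ≡ j
  toℤ-injective i j h with ≤-total (Data.Fin.toℕ j) (Data.Fin.toℕ i)
  ... | inj₁ q = Fin.toℕ-injective (≤-injective _ _ q (Fin.toℕ<n i) h)
  ... | inj₂ q = Fin.toℕ-injective (sym (≤-injective _ _ q (Fin.toℕ<n j) (subst Div (swap (toℤ i) (toℤ j)) (ℤ∣.∣m⇒∣-m h))))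
    where
    swap : ∀ x y → ℤ.- (x ℤ.- y) ≡ y ℤ.- x
    swap = ℤ-Solver.solve-∀

  residue : ∀ z → ∃ λ i → Div (z ℤ.- toℤ i)
  residue z = Data.Fin.fromℕ< r<p , ℤ∣.divides (z ℤ./ℕ p) (trans
      (cong₂ ℤ._-_ (ℤ.a≡a%ℕn+[a/ℕn]*n z p) (cong +_ (Fin.toℕ-fromℕ< r<p)))
      (cancel (+ (z ℤ.%ℕ p)) (z ℤ./ℕ p ℤ.* + p)))
    where
    r<p = ℤ.n%ℕd<d z p
    cancel : ∀ x y → x ℤ.+ y ℤ.- x ≡ y
    cancel = ℤ-Solver.solve-∀

  invertible : ∀ b → ¬ Div b → ∃ λ u → Div (u ℤ.* b ℤ.- + 1)
  invertible b ¬b = signed (GCD.Bézout.identity (Coprimality.coprime⇒GCD≡1 coprime))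
    where
    coprime : Coprimality.Coprime p ∣ b ∣
    coprime (i∣p , i∣b) with prime⇒irreducible p-prime i∣p
    ... | inj₁ e = e
    ... | inj₂ refl = contradiction (ℤ∣.∣ᵤ⇒∣ i∣b) ¬b
    up-to-sign : GCD.Bézout.Identity 1 p ∣ b ∣ → ∃ λ u → Div (u ℤ.* + ∣ b ∣ ℤ.- + 1)
    up-to-sign (GCD.Bézout.+- x y eq) = ℤ.- (+ y) , ℤ∣.divides (ℤ.- (+ x)) (trans (rearrange (+ y) (+ ∣ b ∣)) (trans (cong ℤ.-_ (cast x y eq)) (ℤ.neg-distribˡ-* (+ x) (+ p))))
      where
      rearrange : ∀ y b → ℤ.- y ℤ.* b ℤ.- + 1 ≡ ℤ.- (+ 1 ℤ.+ y ℤ.* b)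
      rearrange = ℤ-Solver.solve-∀
      cast : ∀ x y → 1 + y * ∣ b ∣ ≡ x * p → + 1 ℤ.+ + y ℤ.* + ∣ b ∣ ≡ + x ℤ.* + p
      cast x y eq = trans (cong (λ z → + 1 ℤ.+ z) (sym (ℤ.pos-* y ∣ b ∣))) (trans (cong +_ eq) (ℤ.pos-* x p))
    up-to-sign (GCD.Bézout.-+ x y eq) = + y , ℤ∣.divides (+ x) (trans (cong (ℤ._- + 1) (trans (sym (ℤ.pos-* y ∣ b ∣)) (trans (cong +_ (sym eq)) (cong (λ z → + 1 ℤ.+ z) (ℤ.pos-* x p))))) (cancel (+ x ℤ.* + p)))
      where
      cancel : ∀ x → + 1 ℤ.+ x ℤ.- + 1 ≡ x
      cancel = ℤ-Solver.solve-∀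
    fix-sign : ∀ c → + ∣ c ∣ ≡ c ⊎ + ∣ c ∣ ≡ ℤ.- c
    fix-sign (+ n) = inj₁ refl
    fix-sign (-[1+ n ]) = inj₂ refl
    signed : GCD.Bézout.Identity 1 p ∣ b ∣ → ∃ λ u → Div (u ℤ.* b ℤ.- + 1)
    signed id with up-to-sign id | fix-sign b
    ... | u , h | inj₁ e = u , subst (λ c → Div (u ℤ.* c ℤ.- + 1)) e h
    ... | u , h | inj₂ e = ℤ.- u , subst (λ c → Div (c ℤ.- + 1)) (neg u b) (subst (λ c → Div (u ℤ.* c ℤ.- + 1)) e h)
      where
      neg : ∀ u b → u ℤ.* (ℤ.- b) ≡ ℤ.- u ℤ.* b
      neg = ℤ-Solver.solve-∀

  -- The residues 1 and p - 1 have the same square, so at most p - 1 residues are squares.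
  nonresidue : 2 < p → ∃ λ d → ∀ z → ¬ Div (z ℤ.* z ℤ.- d)
  nonresidue 2<p = found (Fin.any? λ d → ¬? (root? d))
    where
    HasRoot : Fin p → Set
    HasRoot d = ∃ λ (s : Fin (pred p)) → Div (+ Data.Fin.toℕ s ℤ.* + Data.Fin.toℕ s ℤ.- toℤ d)
    root? : ∀ d → Dec (HasRoot d)
    root? d = Fin.any? λ s → Div? _
    subtract : ∀ s x y → s ℤ.- y ℤ.- (s ℤ.- x) ≡ x ℤ.- y
    subtract = ℤ-Solver.solve-∀
    pred-< : ∀ {n} → NonZero n → pred n < n
    pred-< {suc n} _ = ≤-refl
    not-all : (∀ d → HasRoot d) → ⊥
    not-all root = collide (Fin.pigeonhole (pred-< p≢0) (proj₁ ∘ root))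
      where
      collide : (∃ λ i → ∃ λ j → i Data.Fin.< j × proj₁ (root i) ≡ proj₁ (root j)) → ⊥
      collide (i , j , i<j , e) = Fin.<⇒≢ i<j (toℤ-injective i j (subst Div (subtract (+ Data.Fin.toℕ (proj₁ (root i)) ℤ.* + Data.Fin.toℕ (proj₁ (root i))) (toℤ i) (toℤ j)) (Div--
        (subst (λ s → Div (+ Data.Fin.toℕ s ℤ.* + Data.Fin.toℕ s ℤ.- toℤ j)) (sym e) (proj₂ (root j))) (proj₂ (root i)))))
    found : Dec (∃ λ d → ¬ HasRoot d) → ∃ λ d → ∀ z → ¬ Div (z ℤ.* z ℤ.- d)
    found (no h) = ⊥-elim (not-all λ d → decided d (root? d))
      where
      decided : ∀ d → Dec (HasRoot d) → HasRoot d
      decided d (yes r) = r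
      decided d (no ¬r) = contradiction (d , ¬r) h
    found (yes (d , ¬root)) = toℤ d , λ z h → let (i , hi) = residue z in
      no-root (Data.Fin.toℕ i) (Fin.toℕ<n i) (subst Div (shift z (toℤ i) (toℤ d)) (Div-- h (Div-*ˡ (z ℤ.+ toℤ i) hi)))
      where
      shift : ∀ z i d → z ℤ.* z ℤ.- d ℤ.- (z ℤ.+ i) ℤ.* (z ℤ.- i) ≡ i ℤ.* i ℤ.- d
      shift = ℤ-Solver.solve-∀
      small : ∀ s → s < pred p → ¬ Div (+ s ℤ.* + s ℤ.- toℤ d)
      small s s< h = ¬root (Data.Fin.fromℕ< s< , subst (λ k → Div (+ k ℤ.* + k ℤ.- toℤ d)) (sym (Fin.toℕ-fromℕ< s<)) h)
      no-root : ∀ s → s < p → ¬ Div (+ s ℤ.* + s ℤ.- toℤ d)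
      no-root s s<p h with s <? pred p
      ... | yes q = small s q h
      ... | no q = small 1 (1<pred 2<p) (subst Div (flip (+ s) (toℤ d)) (Div-- h (Div-*ˡ (+ s ℤ.- + 1) s+1)))
        where
        1<pred : ∀ {n} → 2 < n → 1 < pred n
        1<pred (s≤s h) = h
        s≡ : suc s ≡ p
        s≡ = ≤-antisym s<p (≤-trans (≤-reflexive (sym (suc-pred p))) (s≤s (≮⇒≥ q)))
        s+1 : Div (+ s ℤ.+ + 1)
        s+1 = subst (λ n → Div (+ n)) (trans (sym s≡) (+-comm 1 s)) Div-p
        flip : ∀ s d → s ℤ.* s ℤ.- d ℤ.- (s ℤ.- + 1) ℤ.* (s ℤ.+ + 1) ≡ + 1 ℤ.* + 1 ℤ.- d
        flip = ℤ-Solver.solve-∀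

  module Quadratic (d : ℤ) (d-nonresidue : ∀ z → ¬ Div (z ℤ.* z ℤ.- d)) where

    infix 4 _≈_
    infixl 6 _⊕_
    infixl 7 _⊗_
    infix 8 ⊖_

    -- The pair (a , b) represents a + b√d.
    _≈_ : ℤ × ℤ → ℤ × ℤ → Set
    (a , b) ≈ (a′ , b′) = Div (a ℤ.- a′) × Div (b ℤ.- b′)

    _⊕_ _⊗_ : ℤ × ℤ → ℤ × ℤ → ℤ × ℤ
    (a , b) ⊕ (a′ , b′) = a ℤ.+ a′ , b ℤ.+ b′
    (a , b) ⊗ (a′ , b′) = a ℤ.* a′ ℤ.+ d ℤ.* b ℤ.* b′ , a ℤ.* b′ ℤ.+ b ℤ.* a′

    ⊖_ conj : ℤ × ℤ → ℤ × ℤ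
    ⊖ (a , b) = ℤ.- a , ℤ.- b
    conj (a , b) = a , ℤ.- b

    0# 1# : ℤ × ℤ
    0# = + 0 , + 0
    1# = + 1 , + 0

    ≡⇒≈ : ∀ {x y} → x ≡ y → x ≈ y
    ≡⇒≈ {a , b} refl = subst Div (sym (ℤ.+-inverseʳ a)) Div-0 , subst Div (sym (ℤ.+-inverseʳ b)) Div-0

    Div-sym : ∀ a b → Div (a ℤ.- b) → Div (b ℤ.- a)
    Div-sym a b h = subst Div (e a b) (ℤ∣.∣m⇒∣-m h)
      where
      e : ∀ x y → ℤ.- (x ℤ.- y) ≡ y ℤ.- x
      e = ℤ-Solver.solve-∀

    Div-trans : ∀ a b c → Div (a ℤ.- b) → Div (b ℤ.- c) → Div (a ℤ.- c)
    Div-trans a b c h k = subst Div (e a b c) (Div-+ h k)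
      where
      e : ∀ x y z → x ℤ.- y ℤ.+ (y ℤ.- z) ≡ x ℤ.- z
      e = ℤ-Solver.solve-∀

    Div-+-cong : ∀ a a′ b b′ → Div (a ℤ.- a′) → Div (b ℤ.- b′) → Div (a ℤ.+ b ℤ.- (a′ ℤ.+ b′))
    Div-+-cong a a′ b b′ h k = subst Div (e a a′ b b′) (Div-+ h k)
      where
      e : ∀ x x′ y y′ → x ℤ.- x′ ℤ.+ (y ℤ.- y′) ≡ x ℤ.+ y ℤ.- (x′ ℤ.+ y′)
      e = ℤ-Solver.solve-∀

    Div-*-cong : ∀ a a′ b b′ → Div (a ℤ.- a′) → Div (b ℤ.- b′) → Div (a ℤ.* b ℤ.- a′ ℤ.* b′)
    Div-*-cong a a′ b b′ h k = subst Div (e a a′ b b′) (Div-+ (Div-*ˡ b h) (Div-*ˡ a′ k))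
      where
      e : ∀ x x′ y y′ → y ℤ.* (x ℤ.- x′) ℤ.+ x′ ℤ.* (y ℤ.- y′) ≡ x ℤ.* y ℤ.- x′ ℤ.* y′
      e = ℤ-Solver.solve-∀

    Div-neg-cong : ∀ a a′ → Div (a ℤ.- a′) → Div (ℤ.- a ℤ.- (ℤ.- a′))
    Div-neg-cong a a′ h = subst Div (e a a′) (ℤ∣.∣m⇒∣-m h)
      where
      e : ∀ x y → ℤ.- (x ℤ.- y) ≡ ℤ.- x ℤ.- (ℤ.- y)
      e = ℤ-Solver.solve-∀

    isCommutativeRing : IsCommutativeRing _≈_ _⊕_ _⊗_ ⊖_ 0# 1#
    isCommutativeRing = record
      { isRing = record
        { +-isAbelianGroup = record
          { isGroup = record
            { isMonoid = record
              { isSemigroup = record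
                { isMagma = record
                  { isEquivalence = record
                    { refl = λ {x} → ≡⇒≈ {x} refl
                    ; sym = λ {x} {y} (h , k) → Div-sym (proj₁ x) (proj₁ y) h , Div-sym (proj₂ x) (proj₂ y) k
                    ; trans = λ {x} {y} {z} (h , k) (h′ , k′) →
                        Div-trans (proj₁ x) (proj₁ y) (proj₁ z) h h′ , Div-trans (proj₂ x) (proj₂ y) (proj₂ z) k k′
                    }
                  ; ∙-cong = λ {x} {x′} {y} {y′} (h , k) (h′ , k′) →
                      Div-+-cong (proj₁ x) (proj₁ x′) (proj₁ y) (proj₁ y′) h h′ , Div-+-cong (proj₂ x) (proj₂ x′) (proj₂ y) (proj₂ y′) k k′
                  }
                ; assoc = λ (a , b) (a′ , b′) (a″ , b″) → ≡⇒≈ (cong₂ _,_ (ℤ.+-assoc a a′ a″) (ℤ.+-assoc b b′ b″))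
                }
              ; identity = (λ (a , b) → ≡⇒≈ (cong₂ _,_ (ℤ.+-identityˡ a) (ℤ.+-identityˡ b))) , (λ (a , b) → ≡⇒≈ (cong₂ _,_ (ℤ.+-identityʳ a) (ℤ.+-identityʳ b)))
              }
            ; inverse = (λ (a , b) → ≡⇒≈ (cong₂ _,_ (ℤ.+-inverseˡ a) (ℤ.+-inverseˡ b))) , (λ (a , b) → ≡⇒≈ (cong₂ _,_ (ℤ.+-inverseʳ a) (ℤ.+-inverseʳ b)))
            ; ⁻¹-cong = λ {x} {y} (h , k) → Div-neg-cong (proj₁ x) (proj₁ y) h , Div-neg-cong (proj₂ x) (proj₂ y) k
            }
          ; comm = λ (a , b) (a′ , b′) → ≡⇒≈ (cong₂ _,_ (ℤ.+-comm a a′) (ℤ.+-comm b b′))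
          }
        ; *-cong = λ {x} {x′} {y} {y′} → *-cong x x′ y y′
        ; *-assoc = λ (a , b) (a′ , b′) (a″ , b″) → ≡⇒≈ (cong₂ _,_ (assoc₁ d a b a′ b′ a″ b″) (assoc₂ d a b a′ b′ a″ b″))
        ; *-identity = (λ (a , b) → ≡⇒≈ (cong₂ _,_ (idˡ₁ d a b) (idˡ₂ a b))) , (λ (a , b) → ≡⇒≈ (cong₂ _,_ (idʳ₁ d a b) (idʳ₂ a b)))
        ; distrib = (λ (a , b) (a′ , b′) (a″ , b″) → ≡⇒≈ (cong₂ _,_ (distˡ₁ d a b a′ b′ a″ b″) (distˡ₂ a b a′ b′ a″ b″)))
                  , (λ (a , b) (a′ , b′) (a″ , b″) → ≡⇒≈ (cong₂ _,_ (distʳ₁ d a b a′ b′ a″ b″) (distʳ₂ a b a′ b′ a″ b″)))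
        }
      ; *-comm = λ (a , b) (a′ , b′) → ≡⇒≈ (cong₂ _,_ (comm₁ d a b a′ b′) (comm₂ a b a′ b′))
      }
      where
      *-cong : ∀ x x′ y y′ → x ≈ x′ → y ≈ y′ → x ⊗ y ≈ x′ ⊗ y′
      *-cong (a , b) (a′ , b′) (e , f) (e′ , f′) (h , k) (h′ , k′) =
          Div-+-cong (a ℤ.* e) (a′ ℤ.* e′) _ _ (Div-*-cong a a′ e e′ h h′) (Div-*-cong (d ℤ.* b) (d ℤ.* b′) f f′ (subst Div (pull d b b′) (Div-*ˡ d k)) k′)
        , Div-+-cong (a ℤ.* f) (a′ ℤ.* f′) _ _ (Div-*-cong a a′ f f′ h k′) (Div-*-cong b b′ e e′ k h′)
        where
        pull : ∀ d x y → d ℤ.* (x ℤ.- y) ≡ d ℤ.* x ℤ.- d ℤ.* y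
        pull = ℤ-Solver.solve-∀
      assoc₁ : ∀ d a b a′ b′ a″ b″ → (a ℤ.* a′ ℤ.+ d ℤ.* b ℤ.* b′) ℤ.* a″ ℤ.+ d ℤ.* (a ℤ.* b′ ℤ.+ b ℤ.* a′) ℤ.* b″ ≡
        a ℤ.* (a′ ℤ.* a″ ℤ.+ d ℤ.* b′ ℤ.* b″) ℤ.+ d ℤ.* b ℤ.* (a′ ℤ.* b″ ℤ.+ b′ ℤ.* a″)
      assoc₁ = ℤ-Solver.solve-∀
      assoc₂ : ∀ d a b a′ b′ a″ b″ → (a ℤ.* a′ ℤ.+ d ℤ.* b ℤ.* b′) ℤ.* b″ ℤ.+ (a ℤ.* b′ ℤ.+ b ℤ.* a′) ℤ.* a″ ≡
        a ℤ.* (a′ ℤ.* b″ ℤ.+ b′ ℤ.* a″) ℤ.+ b ℤ.* (a′ ℤ.* a″ ℤ.+ d ℤ.* b′ ℤ.* b″)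
      assoc₂ = ℤ-Solver.solve-∀
      idˡ₁ : ∀ d a b → + 1 ℤ.* a ℤ.+ d ℤ.* + 0 ℤ.* b ≡ a
      idˡ₁ = ℤ-Solver.solve-∀
      idˡ₂ : ∀ a b → + 1 ℤ.* b ℤ.+ + 0 ℤ.* a ≡ b
      idˡ₂ = ℤ-Solver.solve-∀
      idʳ₁ : ∀ d a b → a ℤ.* + 1 ℤ.+ d ℤ.* b ℤ.* + 0 ≡ a
      idʳ₁ = ℤ-Solver.solve-∀
      idʳ₂ : ∀ a b → a ℤ.* + 0 ℤ.+ b ℤ.* + 1 ≡ b
      idʳ₂ = ℤ-Solver.solve-∀
      distˡ₁ : ∀ d a b a′ b′ a″ b″ → a ℤ.* (a′ ℤ.+ a″) ℤ.+ d ℤ.* b ℤ.* (b′ ℤ.+ b″) ≡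
        (a ℤ.* a′ ℤ.+ d ℤ.* b ℤ.* b′) ℤ.+ (a ℤ.* a″ ℤ.+ d ℤ.* b ℤ.* b″)
      distˡ₁ = ℤ-Solver.solve-∀
      distˡ₂ : ∀ a b a′ b′ a″ b″ → a ℤ.* (b′ ℤ.+ b″) ℤ.+ b ℤ.* (a′ ℤ.+ a″) ≡ (a ℤ.* b′ ℤ.+ b ℤ.* a′) ℤ.+ (a ℤ.* b″ ℤ.+ b ℤ.* a″)
      distˡ₂ = ℤ-Solver.solve-∀
      distʳ₁ : ∀ d a b a′ b′ a″ b″ → (a′ ℤ.+ a″) ℤ.* a ℤ.+ d ℤ.* (b′ ℤ.+ b″) ℤ.* b ≡
        (a′ ℤ.* a ℤ.+ d ℤ.* b′ ℤ.* b) ℤ.+ (a″ ℤ.* a ℤ.+ d ℤ.* b″ ℤ.* b)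
      distʳ₁ = ℤ-Solver.solve-∀
      distʳ₂ : ∀ a b a′ b′ a″ b″ → (a′ ℤ.+ a″) ℤ.* b ℤ.+ (b′ ℤ.+ b″) ℤ.* a ≡ (a′ ℤ.* b ℤ.+ b′ ℤ.* a) ℤ.+ (a″ ℤ.* b ℤ.+ b″ ℤ.* a)
      distʳ₂ = ℤ-Solver.solve-∀
      comm₁ : ∀ d a b a′ b′ → a ℤ.* a′ ℤ.+ d ℤ.* b ℤ.* b′ ≡ a′ ℤ.* a ℤ.+ d ℤ.* b′ ℤ.* b
      comm₁ = ℤ-Solver.solve-∀
      comm₂ : ∀ a b a′ b′ → a ℤ.* b′ ℤ.+ b ℤ.* a′ ≡ a′ ℤ.* b ℤ.+ b′ ℤ.* a
      comm₂ = ℤ-Solver.solve-∀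

    commutativeRing : CommutativeRing 0ℓ 0ℓ
    commutativeRing = record { isCommutativeRing = isCommutativeRing }

    fromℤ : ℤ.+-*-rawRing -Raw-AlmostCommutative⟶ fromCommutativeRing commutativeRing
    fromℤ = record
      { ⟦_⟧ = _, + 0
      ; +-homo = λ m n → ≡⇒≈ {m ℤ.+ n , + 0} refl
      ; *-homo = λ m n → ≡⇒≈ (cong₂ _,_ (re d m n) (im m n))
      ; -‿homo = λ m → ≡⇒≈ {ℤ.- m , + 0} refl
      ; 0-homo = ≡⇒≈ {0#} refl
      ; 1-homo = ≡⇒≈ {1#} refl
      }
      where
      re : ∀ d m n → m ℤ.* n ≡ m ℤ.* n ℤ.+ d ℤ.* + 0 ℤ.* + 0
      re = ℤ-Solver.solve-∀
      im : ∀ m n → + 0 ≡ m ℤ.* + 0 ℤ.+ + 0 ℤ.* n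
      im = ℤ-Solver.solve-∀

    conj-cong : ∀ {x y} → x ≈ y → conj x ≈ conj y
    conj-cong {a , b} {a′ , b′} (h , k) = h , Div-neg-cong b b′ k

    conj-⊕ : ∀ x y → conj (x ⊕ y) ≈ conj x ⊕ conj y
    conj-⊕ (a , b) (a′ , b′) = ≡⇒≈ (cong (a ℤ.+ a′ ,_) (ℤ.neg-distrib-+ b b′))

    conj-⊗ : ∀ x y → conj (x ⊗ y) ≈ conj x ⊗ conj y
    conj-⊗ (a , b) (a′ , b′) = ≡⇒≈ (cong₂ _,_ (re d a b a′ b′) (im a b a′ b′))
      where
      re : ∀ d a b a′ b′ → a ℤ.* a′ ℤ.+ d ℤ.* b ℤ.* b′ ≡ a ℤ.* a′ ℤ.+ d ℤ.* (ℤ.- b) ℤ.* (ℤ.- b′)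
      re = ℤ-Solver.solve-∀
      im : ∀ a b a′ b′ → ℤ.- (a ℤ.* b′ ℤ.+ b ℤ.* a′) ≡ a ℤ.* (ℤ.- b′) ℤ.+ (ℤ.- b) ℤ.* a′
      im = ℤ-Solver.solve-∀

    conj-⊖ : ∀ x y → conj (x ⊕ ⊖ y) ≈ conj x ⊕ ⊖ conj y
    conj-⊖ (a , b) (a′ , b′) = ≡⇒≈ (cong (a ℤ.+ ℤ.- a′ ,_) (ℤ.neg-distrib-+ b (ℤ.- b′)))

    conj-conj : ∀ x → conj (conj x) ≈ x
    conj-conj (a , b) = ≡⇒≈ (cong (a ,_) (ℤ.neg-involutive b))

    norm : ℤ × ℤ → ℤ
    norm (a , b) = a ℤ.* a ℤ.- d ℤ.* b ℤ.* b

    Div-0-⁺ : ∀ {a} → Div a → Div (a ℤ.- + 0)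
    Div-0-⁺ {a} = subst Div (sym (ℤ.+-identityʳ a))

    Div-0-⁻ : ∀ {a} → Div (a ℤ.- + 0) → Div a
    Div-0-⁻ {a} = subst Div (ℤ.+-identityʳ a)

    -- If b had an inverse u modulo p, then u² times the norm would exhibit `d` as the square of u
    -- a. So p divides b, hence a², hence a.
    anisotropic : ∀ x → Div (norm x) → x ≈ 0#
    anisotropic (a , b) h with Div? b
    ... | no ¬b = contradiction (subst Div (e u a b d) (Div-+ (Div-*ˡ (u ℤ.* u) h) (Div-*ˡ (d ℤ.* (u ℤ.* b ℤ.+ + 1)) hu))) (d-nonresidue (u ℤ.* a))
      where
      u = proj₁ (invertible b ¬b)
      hu = proj₂ (invertible b ¬b)
      e : ∀ u a b d → u ℤ.* u ℤ.* (a ℤ.* a ℤ.- d ℤ.* b ℤ.* b) ℤ.+ d ℤ.* (u ℤ.* b ℤ.+ + 1) ℤ.* (u ℤ.* b ℤ.- + 1) ≡ u ℤ.* a ℤ.* (u ℤ.* a) ℤ.- d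
      e = ℤ-Solver.solve-∀
    ... | yes hb = Div-0-⁺ (Data.Sum.reduce (euclid a a (subst Div (e a b d) (Div-+ h (Div-*ˡ (d ℤ.* b) hb))))) , Div-0-⁺ hb
      where
      e : ∀ a b d → a ℤ.* a ℤ.- d ℤ.* b ℤ.* b ℤ.+ d ℤ.* b ℤ.* b ≡ a ℤ.* a
      e = ℤ-Solver.solve-∀

    -- The norm is multiplicative (Brahmagupta), so the claim reduces to Euclid's lemma for
    -- integers.
    domain : ∀ x y → x ⊗ y ≈ 0# → x ≈ 0# ⊎ y ≈ 0#
    domain (a , b) (a′ , b′) (h , k) = Data.Sum.map (anisotropic (a , b)) (anisotropic (a′ , b′)) (euclid (norm (a , b)) (norm (a′ , b′))
      (subst Div (brahmagupta d a b a′ b′) (Div-- (Div-*ˡ (a ℤ.* a′ ℤ.+ d ℤ.* b ℤ.* b′) (Div-0-⁻ h)) (Div-*ˡ (d ℤ.* (a ℤ.* b′ ℤ.+ b ℤ.* a′)) (Div-0-⁻ k)))))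
      where
      brahmagupta : ∀ d a b a′ b′ →
        (a ℤ.* a′ ℤ.+ d ℤ.* b ℤ.* b′) ℤ.* (a ℤ.* a′ ℤ.+ d ℤ.* b ℤ.* b′) ℤ.- d ℤ.* (a ℤ.* b′ ℤ.+ b ℤ.* a′) ℤ.* (a ℤ.* b′ ℤ.+ b ℤ.* a′) ≡
        (a ℤ.* a ℤ.- d ℤ.* b ℤ.* b) ℤ.* (a′ ℤ.* a′ ℤ.- d ℤ.* b′ ℤ.* b′)
      brahmagupta = ℤ-Solver.solve-∀

    char≢2 : 2 < p → ∀ x → x ⊕ x ≈ 0# → x ≈ 0#
    char≢2 2<p (a , b) (h , k) = Div-0-⁺ (halve a h) , Div-0-⁺ (halve b k)
      where
      double : ∀ a → a ℤ.+ a ≡ + 2 ℤ.* a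
      double = ℤ-Solver.solve-∀
      halve : ∀ a → Div (a ℤ.+ a ℤ.- + 0) → Div a
      halve a h = Data.Sum.[ (λ q → contradiction (Div-<⇒≡0 2 2<p q) λ ()) , id ] (euclid (+ 2) a (subst Div (double a) (Div-0-⁻ h)))

    conjugationDomain : 2 < p → ConjugationDomain commutativeRing
    conjugationDomain 2<p = record
      { fromℤ = fromℤ
      ; conj = conj
      ; conj-cong = λ {x} {y} → conj-cong {x} {y}
      ; conj-⊕ = conj-⊕
      ; conj-⊗ = conj-⊗
      ; conj-⊖ = conj-⊖
      ; conj-conj = conj-conj
      ; domain = domain
      ; char≢2 = char≢2 2<p
      }

-- The Hermitian curve

#≡1 : ∀ {A : Set} {xs : List A} {x} p → Unique xs → x ∈ xs → p x ≡ true →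
  (∀ x y → p x ≡ true → p y ≡ true → x ≡ y) → # xs p ≡ 1
#≡1 {xs = xs} p u x∈ px inj = ≤-antisym (#-≤1 xs p u (λ x y _ _ → inj x y)) (#-pos x∈ px)

#≤2 : ∀ {A : Set} (xs : List A) p → Unique xs →
  (∀ x y z → p x ≡ true → p y ≡ true → p z ≡ true → x ≢ y → x ≢ z → y ≡ z) → # xs p ≤ 2
#≤2 [] p u h = z≤n
#≤2 (x ∷ xs) p (x∉ ∷ u) h with p x in eq
... | false = #≤2 xs p u h
... | true = s≤s (#-≤1 xs p u λ y z i j py pz → h x y z eq py pz (All.lookup x∉ i) (All.lookup x∉ j))

lookup-injective : ∀ {A : Set} {xs : List A} → Unique xs → ∀ i j → lookup xs i ≡ lookup xs j → i ≡ j
lookup-injective (x∉ ∷ u) zero zero e = refl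
lookup-injective (x∉ ∷ u) zero (suc j) e = contradiction e (All.lookup x∉ (∈-lookup j))
lookup-injective (x∉ ∷ u) (suc i) zero e = contradiction (sym e) (All.lookup x∉ (∈-lookup i))
lookup-injective (x∉ ∷ u) (suc i) (suc j) e = cong suc (lookup-injective u i j e)

length-allFin : ∀ n → length (allFin n) ≡ n
length-allFin n = Listₚ.length-tabulate id

module Unital (p : ℕ) (p-prime : Prime p) (2<p : 2 < p) (d : ℤ) (d-nonresidue : ∀ z → ¬ Modulo.Div p p-prime (z ℤ.* z ℤ.- d)) where

  open import Data.Integer using (+_)
  open Modulo p p-prime
  open Quadratic d d-nonresidue
  open Quadrilateral commutativeRing (conjugationDomain 2<p)
    using (Null; offset; no-quadrilateral)
  open CommutativeRing commutativeRing using () renaming (_-_ to _⊖ₖ_; sym to ≈-sym; trans to ≈-trans; +-congʳ to ⊕-congʳ; -‿inverseʳ to ⊖-inverseʳ)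

  Fₚ = Fin p
  F = allFin p

  -- A line is y = a x + b with a and b in the field of p² elements; vertical lines and the point of
  -- the curve at infinity are left out, which leaves p³ points and p⁴ lines.
  Point Line : Set
  Point = Fₚ × Fₚ × Fₚ
  Line = Fₚ × Fₚ × Fₚ × Fₚ

  points : List Point
  points = cartesianProduct F (cartesianProduct F F)

  lines : List Line
  lines = cartesianProduct F (cartesianProduct F (cartesianProduct F F))

  -- The affine points (x , y) of the Hermitian curve y + ȳ = 2 x x̄, with w the imaginary part of y.
  X Y : Point → ℤ × ℤ
  X (x₁ , x₂ , w) = toℤ x₁ , toℤ x₂
  Y (x₁ , x₂ , w) = toℤ x₁ ℤ.* toℤ x₁ ℤ.- d ℤ.* toℤ x₂ ℤ.* toℤ x₂ , toℤ w

  slope intercept : Line → ℤ × ℤ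
  slope (a₁ , a₂ , b₁ , b₂) = toℤ a₁ , toℤ a₂
  intercept (a₁ , a₂ , b₁ , b₂) = toℤ b₁ , toℤ b₂

  On : Line → Point → Set
  On ℓ P = Y P ≈ slope ℓ ⊗ X P ⊕ intercept ℓ

  re im : Line → Point → ℤ
  re ℓ P = proj₁ (Y P) ℤ.- proj₁ (slope ℓ ⊗ X P ⊕ intercept ℓ)
  im ℓ P = proj₂ (Y P) ℤ.- proj₂ (slope ℓ ⊗ X P ⊕ intercept ℓ)

  On? : ∀ ℓ P → Dec (On ℓ P)
  On? ℓ P = Div? (re ℓ P) ×-dec Div? (im ℓ P)

  null : ∀ P → Null (X P) (Y P)
  null (x₁ , x₂ , w) = ≡⇒≈ (cong₂ _,_ (e₁ d (toℤ x₁) (toℤ x₂)) (e₂ (toℤ x₁) (toℤ x₂) (toℤ w)))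
    where
    e₁ : ∀ d x z → x ℤ.* x ℤ.- d ℤ.* z ℤ.* z ℤ.+ (x ℤ.* x ℤ.- d ℤ.* z ℤ.* z) ≡ x ℤ.* x ℤ.+ d ℤ.* z ℤ.* (ℤ.- z) ℤ.+ (x ℤ.* x ℤ.+ d ℤ.* z ℤ.* (ℤ.- z))
    e₁ = ℤ-Solver.solve-∀
    e₂ : ∀ x z w → w ℤ.+ (ℤ.- w) ≡ x ℤ.* (ℤ.- z) ℤ.+ z ℤ.* x ℤ.+ (x ℤ.* (ℤ.- z) ℤ.+ z ℤ.* x)
    e₂ = ℤ-Solver.solve-∀

  pair-injective : ∀ {i j i′ j′} → (toℤ i , toℤ j) ≈ (toℤ i′ , toℤ j′) → i ≡ i′ × j ≡ j′
  pair-injective (h , k) = toℤ-injective _ _ h , toℤ-injective _ _ k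

  ⊖-≈0 : ∀ x y → x ≈ y → x ⊖ₖ y ≈ 0#
  ⊖-≈0 x y e = ≈-trans {x ⊖ₖ y} {y ⊖ₖ y} {0#} (⊕-congʳ {⊖ y} {x} {y} e) (⊖-inverseʳ y)

  ⊖-≈0⁻ : ∀ x y → x ⊖ₖ y ≈ 0# → x ≈ y
  ⊖-≈0⁻ (a , b) (a′ , b′) (h , k) = Div-0-⁻ h , Div-0-⁻ k

  same-X : ∀ ℓ P Q → On ℓ P → On ℓ Q → X P ≈ X Q → P ≡ Q
  same-X ℓ@(a₁ , a₂ , b₁ , b₂) P@(x₁ , x₂ , w) Q@(x₁′ , x₂′ , w′) (_ , h) (_ , k) e with pair-injective {x₁} {x₂} {x₁′} {x₂′} e
  ... | refl , refl = cong (λ z → x₁ , x₂ , z) (toℤ-injective w w′ (Div-trans (toℤ w) y (toℤ w′) h (Div-sym (toℤ w′) y k)))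
    where y = proj₂ (slope ℓ ⊗ X P ⊕ intercept ℓ)

  same-slope : ∀ ℓ ℓ′ P → On ℓ P → On ℓ′ P → slope ℓ ≈ slope ℓ′ → ℓ ≡ ℓ′
  same-slope ℓ@(a₁ , a₂ , b₁ , b₂) ℓ′@(a₁′ , a₂′ , b₁′ , b₂′) P (h₁ , h₂) (k₁ , k₂) e with pair-injective {a₁} {a₂} {a₁′} {a₂′} e
  ... | refl , refl with pair-injective {b₁} {b₂} {b₁′} {b₂′}
      (subst Div (e₁ (proj₁ (Y P)) (proj₁ (slope ℓ ⊗ X P)) (toℤ b₁) (toℤ b₁′)) (Div-- k₁ h₁) , subst Div (e₁ (proj₂ (Y P)) (proj₂ (slope ℓ ⊗ X P)) (toℤ b₂) (toℤ b₂′)) (Div-- k₂ h₂))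
    where
    e₁ : ∀ y s b b′ → y ℤ.- (s ℤ.+ b′) ℤ.- (y ℤ.- (s ℤ.+ b)) ≡ b ℤ.- b′
    e₁ = ℤ-Solver.solve-∀
  ... | refl , refl = refl

  meet-once : ∀ ℓ ℓ′ P Q → ℓ ≢ ℓ′ → On ℓ P → On ℓ′ P → On ℓ Q → On ℓ′ Q → P ≡ Q
  meet-once ℓ ℓ′ P Q ℓ≢ hP kP hQ kQ = Data.Sum.[ slopes , firsts ] (domain (slope ℓ ⊖ₖ slope ℓ′) (X P ⊖ₖ X Q) zero′)
    where
    zero′ : (slope ℓ ⊖ₖ slope ℓ′) ⊗ (X P ⊖ₖ X Q) ≈ 0#
    zero′ = ≈-trans {(slope ℓ ⊖ₖ slope ℓ′) ⊗ (X P ⊖ₖ X Q)} {Y P ⊖ₖ (slope ℓ′ ⊗ X P ⊕ intercept ℓ′)} {0#}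
      (offset (slope ℓ) (intercept ℓ) (slope ℓ′) (intercept ℓ′) (X P) (Y P) (X Q) (Y Q) hP hQ kQ)
      (⊖-≈0 (Y P) (slope ℓ′ ⊗ X P ⊕ intercept ℓ′) kP)
    slopes : slope ℓ ⊖ₖ slope ℓ′ ≈ 0# → P ≡ Q
    slopes e = contradiction (same-slope ℓ ℓ′ P hP kP (⊖-≈0⁻ (slope ℓ) (slope ℓ′) e)) ℓ≢
    firsts : X P ⊖ₖ X Q ≈ 0# → P ≡ Q
    firsts e = same-X ℓ P Q hP hQ (⊖-≈0⁻ (X P) (X Q) e)

  no-O'Nan : ∀ ℓ₁ ℓ₂ ℓ₃ ℓ₄ A B H D E G → On ℓ₁ A → On ℓ₂ A → On ℓ₁ B → On ℓ₃ B → On ℓ₂ H → On ℓ₃ H →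
    On ℓ₁ D → On ℓ₄ D → On ℓ₂ E → On ℓ₄ E → On ℓ₃ G → On ℓ₄ G →
    ℓ₁ ≢ ℓ₄ → ℓ₂ ≢ ℓ₄ → ℓ₃ ≢ ℓ₄ → ℓ₁ ≢ ℓ₂ → A ≢ D → B ≢ G → E ≢ H → B ≢ A → H ≢ A → ⊥
  no-O'Nan ℓ₁ ℓ₂ ℓ₃ ℓ₄ A B H D E G A₁ A₂ B₁ B₃ C₂ C₃ D₁ D₄ E₂ E₄ G₃ G₄ ℓ₁₄ ℓ₂₄ ℓ₃₄ ℓ₁₂ AD BG EC BA CA =
    no-quadrilateral {slope ℓ₁} {slope ℓ₂} {slope ℓ₃} {slope ℓ₄} {intercept ℓ₁} {intercept ℓ₂} {intercept ℓ₃} {intercept ℓ₄}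
      {X A} {Y A} {X B} {Y B} {X H} {Y H} {X D} {Y D} {X E} {Y E} {X G} {Y G}
      A₁ A₂ B₁ B₃ C₂ C₃ D₁ D₄ E₂ E₄ G₃ G₄
      (slopes ℓ₁ ℓ₄ D ℓ₁₄ D₁ D₄) (slopes ℓ₂ ℓ₄ E ℓ₂₄ E₂ E₄) (slopes ℓ₃ ℓ₄ G ℓ₃₄ G₃ G₄)
      (null A) (null B) (null H) (null D) (null E) (null G)
      (firsts ℓ₁ A D AD A₁ D₁) (firsts ℓ₃ B G BG B₃ G₃) (firsts ℓ₂ E H EC E₂ C₂) (firsts ℓ₁ B A BA B₁ A₁) (firsts ℓ₂ H A CA C₂ A₂)
      (slopes ℓ₁ ℓ₂ A ℓ₁₂ A₁ A₂)
    where
    slopes : ∀ ℓ ℓ′ P → ℓ ≢ ℓ′ → On ℓ P → On ℓ′ P → ¬ slope ℓ ⊖ₖ slope ℓ′ ≈ 0#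
    slopes ℓ ℓ′ P ℓ≢ h k e = ℓ≢ (same-slope ℓ ℓ′ P h k (⊖-≈0⁻ (slope ℓ) (slope ℓ′) e))
    firsts : ∀ ℓ P Q → P ≢ Q → On ℓ P → On ℓ Q → ¬ X P ⊖ₖ X Q ≈ 0#
    firsts ℓ P Q P≢ h k e = P≢ (same-X ℓ P Q h k (⊖-≈0⁻ (X P) (X Q) e))

  size : Line → ℕ
  size ℓ = # points (λ P → does (On? ℓ P))

  unique-solution : ∀ (g : Fₚ → ℤ) → (∀ i j → Div (g i) → Div (g j) → i ≡ j) → (∃ λ i → Div (g i)) → # F (λ i → does (Div? (g i))) ≡ 1
  unique-solution g inj (i , h) = #≡1 (λ i → does (Div? (g i))) (allFin-unique p) (∈-allFin i) (⇒does (Div? (g i)) h)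
    λ x y hx hy → inj x y (does⇒ (Div? (g x)) hx) (does⇒ (Div? (g y)) hy)

  w-unique : ∀ c → # F (λ w → does (Div? (toℤ w ℤ.- c))) ≡ 1
  w-unique c = unique-solution (λ w → toℤ w ℤ.- c)
    (λ i j h k → toℤ-injective i j (Div-trans (toℤ i) c (toℤ j) h (Div-sym (toℤ j) c k)))
    (let (i , h) = residue c in i , Div-sym c (toℤ i) h)

  b-unique : ∀ n c → # F (λ b → does (Div? (n ℤ.- (c ℤ.+ toℤ b)))) ≡ 1
  b-unique n c = unique-solution (λ b → n ℤ.- (c ℤ.+ toℤ b))
    (λ i j h k → toℤ-injective i j (subst Div (e₁ n c (toℤ i) (toℤ j)) (Div-- k h)))
    (let (i , h) = residue (n ℤ.- c) in i , subst Div (e₂ n c (toℤ i)) h)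
    where
    e₁ : ∀ n c i j → n ℤ.- (c ℤ.+ j) ℤ.- (n ℤ.- (c ℤ.+ i)) ≡ i ℤ.- j
    e₁ = ℤ-Solver.solve-∀
    e₂ : ∀ n c i → n ℤ.- c ℤ.- i ≡ n ℤ.- (c ℤ.+ i)
    e₂ = ℤ-Solver.solve-∀

  -- re does not depend on w, so the third coordinate is a dummy.
  circle : Line → Fₚ → Fₚ → ℕ
  circle ℓ x₁ x₂ = ⟦ does (Div? (re ℓ (x₁ , x₂ , x₁))) ⟧

  -- The imaginary part of the line equation determines `w`, so the points on a line correspond to
  -- the solutions (x₁ , x₂) of its real part, a conic over the prime field.
  size-circle : ∀ ℓ → size ℓ ≡ ∑ F (λ x₁ → ∑ F (λ x₂ → circle ℓ x₁ x₂))
  size-circle ℓ = trans (∑-cartesianProduct F (cartesianProduct F F) _) (∑-cong F λ x₁ →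
    trans (∑-cartesianProduct F F _) (∑-cong F λ x₂ →
      trans (∑-cong F (λ w → ⟦∧⟧ (does (Div? (re ℓ (x₁ , x₂ , w)))) (does (Div? (im ℓ (x₁ , x₂ , w))))))
      (trans (∑-*ˡ F (circle ℓ x₁ x₂) _) (trans (cong (circle ℓ x₁ x₂ *_) (w-unique (proj₂ (slope ℓ ⊗ X (x₁ , x₂ , x₁) ⊕ intercept ℓ)))) (*-identityʳ _)))))

  d-indivisible : ¬ Div d
  d-indivisible h = d-nonresidue (+ 0) (subst Div (sym (ℤ.+-identityˡ (ℤ.- d))) (ℤ∣.∣m⇒∣-m h))

  -- For fixed x₁ the conic is quadratic in x₂ with leading coefficient -d, which is not divisible
  -- by p. The resulting crude bound takes the place of the exact value p + 1 for a secant.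
  size≤ : ∀ ℓ → size ℓ ≤ 2 * p
  size≤ ℓ@(a₁ , a₂ , b₁ , b₂) = begin
    size ℓ  ≡⟨ size-circle ℓ ⟩
    ∑ F (λ x₁ → ∑ F (λ x₂ → circle ℓ x₁ x₂))  ≤⟨ ∑-mono F (λ x₁ → #≤2 F _ (allFin-unique p) (two-roots x₁)) ⟩
    ∑ F (λ _ → 2)  ≡⟨ ∑-const F 2 ⟩
    length F * 2  ≡⟨ trans (cong (_* 2) (length-allFin p)) (*-comm p 2) ⟩
    2 * p ∎
    where
    open ≤-Reasoning
    quadratic : Fₚ → Fₚ → ℤ
    quadratic x₁ x₂ = re ℓ (x₁ , x₂ , x₁)
    difference : ∀ a₁ a₂ b₁ d x s t →
      (x ℤ.* x ℤ.- d ℤ.* s ℤ.* s ℤ.- (a₁ ℤ.* x ℤ.+ d ℤ.* a₂ ℤ.* s ℤ.+ b₁)) ℤ.- (x ℤ.* x ℤ.- d ℤ.* t ℤ.* t ℤ.- (a₁ ℤ.* x ℤ.+ d ℤ.* a₂ ℤ.* t ℤ.+ b₁)) ≡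
      d ℤ.* ((t ℤ.- s) ℤ.* (s ℤ.+ t ℤ.+ a₂))
    difference = ℤ-Solver.solve-∀
    vieta : ∀ x₁ s t → Div (quadratic x₁ s) → Div (quadratic x₁ t) → s ≢ t → Div (toℤ s ℤ.+ toℤ t ℤ.+ toℤ a₂)
    vieta x₁ s t h k s≢t = Data.Sum.[ (λ q → contradiction q d-indivisible) ,
        (λ q → Data.Sum.[ (λ e → contradiction (sym (toℤ-injective t s e)) s≢t) , id ] (euclid (toℤ t ℤ.- toℤ s) (toℤ s ℤ.+ toℤ t ℤ.+ toℤ a₂) q)) ]
      (euclid d _ (subst Div (difference (toℤ a₁) (toℤ a₂) (toℤ b₁) d (toℤ x₁) (toℤ s) (toℤ t)) (Div-- h k)))
    cancel : ∀ s t u a → s ℤ.+ t ℤ.+ a ℤ.- (s ℤ.+ u ℤ.+ a) ≡ t ℤ.- u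
    cancel = ℤ-Solver.solve-∀
    two-roots : ∀ x₁ s t u → does (Div? (quadratic x₁ s)) ≡ true → does (Div? (quadratic x₁ t)) ≡ true → does (Div? (quadratic x₁ u)) ≡ true →
      s ≢ t → s ≢ u → t ≡ u
    two-roots x₁ s t u hs ht hu s≢t s≢u = toℤ-injective t u (subst Div (cancel (toℤ s) (toℤ t) (toℤ u) (toℤ a₂))
      (Div-- (vieta x₁ s t (does⇒ (Div? _) hs) (does⇒ (Div? _) ht) s≢t) (vieta x₁ s u (does⇒ (Div? _) hs) (does⇒ (Div? _) hu) s≢u)))

  ∑F : ∀ c → ∑ F (λ _ → c) ≡ p * c
  ∑F c = trans (∑-const F c) (cong (_* c) (length-allFin p))

  -- Through each of the p³ points passes exactly one line of each of the p² slopes: once `w` is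
  -- eliminated, b₁ is determined by b₂, x₁ and x₂.
  incidences : ∑ lines size ≡ p * (p * (p * (p * p)))
  incidences = begin
    ∑ lines size
      ≡⟨ trans (∑-cartesianProduct F _ size) (∑-cong F λ a₁ → trans (∑-cartesianProduct F _ _) (∑-cong F λ a₂ → per-slope a₁ a₂)) ⟩
    ∑ F (λ _ → ∑ F (λ _ → p * (p * p)))
      ≡⟨ trans (∑-cong F (λ _ → ∑F (p * (p * p)))) (∑F (p * (p * (p * p)))) ⟩
    p * (p * (p * (p * p))) ∎
    where
    open ≡-Reasoning
    per-slope : ∀ a₁ a₂ → ∑ (cartesianProduct F F) (λ (b₁ , b₂) → size (a₁ , a₂ , b₁ , b₂)) ≡ p * (p * p)
    per-slope a₁ a₂ = begin
      ∑ (cartesianProduct F F) (λ (b₁ , b₂) → size (a₁ , a₂ , b₁ , b₂))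
        ≡⟨ trans (∑-cartesianProduct F F _) (∑-swap F F (λ b₁ b₂ → size (a₁ , a₂ , b₁ , b₂))) ⟩
      ∑ F (λ b₂ → ∑ F (λ b₁ → size (a₁ , a₂ , b₁ , b₂)))
        ≡⟨ ∑-cong F (λ b₂ → trans (∑-cong F (λ b₁ → size-circle (a₁ , a₂ , b₁ , b₂))) (∑-swap F F _)) ⟩
      ∑ F (λ b₂ → ∑ F (λ x₁ → ∑ F (λ b₁ → ∑ F (λ x₂ → circle (a₁ , a₂ , b₁ , b₂) x₁ x₂))))
        ≡⟨ ∑-cong F (λ b₂ → ∑-cong F (λ x₁ → trans (∑-swap F F _) (∑-cong F (λ x₂ →
             b-unique (toℤ x₁ ℤ.* toℤ x₁ ℤ.- d ℤ.* toℤ x₂ ℤ.* toℤ x₂) (toℤ a₁ ℤ.* toℤ x₁ ℤ.+ d ℤ.* toℤ a₂ ℤ.* toℤ x₂))))) ⟩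
      ∑ F (λ _ → ∑ F (λ _ → ∑ F (λ _ → 1)))
        ≡⟨ trans (∑-cong F (λ _ → trans (∑-cong F (λ _ → trans (∑F 1) (*-identityʳ p))) (∑F p))) (∑F (p * p)) ⟩
      p * (p * p) ∎

  length-lines : length lines ≡ p * (p * (p * p))
  length-lines = trans (sym (trans (∑-const lines 1) (*-identityʳ _))) (trans (∑-cartesianProduct F _ _)
    (trans (∑-cong F (λ _ → trans (∑-cartesianProduct F _ _) (trans (∑-cong F (λ _ → trans (∑-cartesianProduct F F _) (trans (∑-cong F (λ _ → trans (∑F 1) (*-identityʳ p))) (∑F p)))) (∑F (p * p))))) (∑F (p * (p * p)))))

  length-points : length points ≡ p * (p * p)
  length-points = trans (sym (trans (∑-const points 1) (*-identityʳ _))) (trans (∑-cartesianProduct F _ _)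
    (trans (∑-cong F (λ _ → trans (∑-cartesianProduct F F _) (trans (∑-cong F (λ _ → trans (∑F 1) (*-identityʳ p))) (∑F p)))) (∑F (p * p))))

  K : ℕ
  K = length points

  points-unique : Unique points
  points-unique = Unique.cartesianProduct⁺ (allFin-unique p) (Unique.cartesianProduct⁺ (allFin-unique p) (allFin-unique p))

  lines-unique : Unique lines
  lines-unique = Unique.cartesianProduct⁺ (allFin-unique p) (Unique.cartesianProduct⁺ (allFin-unique p)
    (Unique.cartesianProduct⁺ (allFin-unique p) (allFin-unique p)))

  _≟L_ : DecidableEquality Line
  _≟L_ = Product.≡-dec Fin._≟_ (Product.≡-dec Fin._≟_ (Product.≡-dec Fin._≟_ Fin._≟_))

  abstract
    inc : Line → Fin K → Bool
    inc ℓ i = does (On? ℓ (lookup points i))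

    inc⇒On : ∀ ℓ i → inc ℓ i ≡ true → On ℓ (lookup points i)
    inc⇒On ℓ i h = does⇒ (On? ℓ (lookup points i)) h

    #-inc : ∀ ℓ → # (allFin K) (inc ℓ) ≡ size ℓ
    #-inc ℓ = ∑-lookup points (λ P → ⟦ does (On? ℓ P) ⟧)

  inc-meet-once : ∀ ℓ ℓ′ P Q → ℓ ≢ ℓ′ → inc ℓ P ≡ true → inc ℓ′ P ≡ true → inc ℓ Q ≡ true → inc ℓ′ Q ≡ true → P ≡ Q
  inc-meet-once ℓ ℓ′ P Q ℓ≢ h k h′ k′ = lookup-injective points-unique P Q
    (meet-once ℓ ℓ′ _ _ ℓ≢ (inc⇒On ℓ P h) (inc⇒On ℓ′ P k) (inc⇒On ℓ Q h′) (inc⇒On ℓ′ Q k′))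

  inc-no-O'Nan : ∀ ℓ₁ ℓ₂ ℓ₃ ℓ₄ A B H D E G → inc ℓ₁ A ≡ true → inc ℓ₂ A ≡ true → inc ℓ₁ B ≡ true → inc ℓ₃ B ≡ true → inc ℓ₂ H ≡ true → inc ℓ₃ H ≡ true →
    inc ℓ₁ D ≡ true → inc ℓ₄ D ≡ true → inc ℓ₂ E ≡ true → inc ℓ₄ E ≡ true → inc ℓ₃ G ≡ true → inc ℓ₄ G ≡ true →
    ℓ₁ ≢ ℓ₄ → ℓ₂ ≢ ℓ₄ → ℓ₃ ≢ ℓ₄ → ℓ₁ ≢ ℓ₂ → A ≢ D → B ≢ G → E ≢ H → B ≢ A → H ≢ A → ⊥
  inc-no-O'Nan ℓ₁ ℓ₂ ℓ₃ ℓ₄ A B H D E G A₁ A₂ B₁ B₃ C₂ C₃ D₁ D₄ E₂ E₄ G₃ G₄ ℓ₁₄ ℓ₂₄ ℓ₃₄ ℓ₁₂ AD BG EC BA CA =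
    no-O'Nan ℓ₁ ℓ₂ ℓ₃ ℓ₄ _ _ _ _ _ _ (inc⇒On ℓ₁ A A₁) (inc⇒On ℓ₂ A A₂) (inc⇒On ℓ₁ B B₁) (inc⇒On ℓ₃ B B₃) (inc⇒On ℓ₂ H C₂) (inc⇒On ℓ₃ H C₃)
      (inc⇒On ℓ₁ D D₁) (inc⇒On ℓ₄ D D₄) (inc⇒On ℓ₂ E E₂) (inc⇒On ℓ₄ E E₄) (inc⇒On ℓ₃ G G₃) (inc⇒On ℓ₄ G G₄)
      ℓ₁₄ ℓ₂₄ ℓ₃₄ ℓ₁₂ (AD ∘ inj A D) (BG ∘ inj B G) (EC ∘ inj E H) (BA ∘ inj B A) (CA ∘ inj H A)
    where inj = lookup-injective points-unique

  -- Tangent lines have a single point and must be discarded.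
  richLines : ℕ → List Line
  richLines r = filterᵇ (λ ℓ → 8 * r ≤ᵇ size ℓ) lines

  -- A line has p points on average. Poor lines carry at most half of all incidences, as `8 * r` is
  -- at most p / 2, and a rich line carries at most 2p, so at least a quarter of the lines are rich.
  many-rich-lines : ∀ r → 16 * r ≤ p → p * (p * (p * p)) ≤ 4 * length (richLines r)
  many-rich-lines r hr = *-cancelˡ-≤ p {{>-nonZero (≤-trans (s≤s z≤n) 2<p)}} (+-cancelʳ-≤ (p * q) _ _ (begin
    p * q + p * q  ≡⟨ cong₂ _+_ incidences incidences ⟨
    ∑ lines size + ∑ lines size  ≤⟨ +-mono-≤ bound bound ⟩
    (V * (2 * p) + q * (8 * r)) + (V * (2 * p) + q * (8 * r)) ≡⟨ e V p q r ⟩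
    p * (4 * V) + q * (16 * r)  ≤⟨ +-monoʳ-≤ (p * (4 * V)) (≤-trans (*-monoʳ-≤ q hr) (≤-reflexive (*-comm q p))) ⟩
    p * (4 * V) + p * q ∎))
    where
    open ≤-Reasoning
    q = p * (p * (p * p))
    V = length (richLines r)
    e : ∀ V p q r → (V * (2 * p) + q * (8 * r)) + (V * (2 * p) + q * (8 * r)) ≡ p * (4 * V) + q * (16 * r)
    e = solve-∀
    pointwise : ∀ ℓ → size ℓ ≤ ⟦ 8 * r ≤ᵇ size ℓ ⟧ * (2 * p) + 8 * r
    pointwise ℓ with ≤ᵇ-cases (8 * r) (size ℓ)
    ... | inj₁ (e , _) rewrite e = ≤-trans (size≤ ℓ) (≤-trans (≤-reflexive (sym (+-identityʳ (2 * p)))) (m≤m+n _ _))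
    ... | inj₂ (e , h) rewrite e = <⇒≤ h
    bound : ∑ lines size ≤ V * (2 * p) + q * (8 * r)
    bound = begin
      ∑ lines size  ≤⟨ ∑-mono lines pointwise ⟩
      ∑ lines (λ ℓ → ⟦ 8 * r ≤ᵇ size ℓ ⟧ * (2 * p) + 8 * r)  ≡⟨ ∑-+ lines _ _ ⟩
      ∑ lines (λ ℓ → ⟦ 8 * r ≤ᵇ size ℓ ⟧ * (2 * p)) + ∑ lines (λ _ → 8 * r)
        ≡⟨ cong₂ _+_ (trans (∑-*ʳ lines (2 * p) _) (cong (_* (2 * p)) (sym (length-filterᵇ _ lines)))) (trans (∑-const lines (8 * r)) (cong (_* (8 * r)) length-lines)) ⟩
      V * (2 * p) + q * (8 * r) ∎

  richLines-rich : ∀ r ℓ → ℓ ∈ richLines r → 8 * r ≤ # (allFin K) (inc ℓ)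
  richLines-rich r ℓ i = subst (8 * r ≤_) (sym (#-inc ℓ)) (≤ᵇ⇒≤ (8 * r) (size ℓ) (proj₂ (∈-filter⁻ (T? ∘ (λ ℓ → 8 * r ≤ᵇ size ℓ)) {xs = lines} i)))

  richLines-unique : ∀ r → Unique (richLines r)
  richLines-unique r = Unique.filter⁺ (T? ∘ (λ ℓ → 8 * r ≤ᵇ size ℓ)) lines-unique

-- The lower bound for r(4,n)

#-image : ∀ {n N} (f : Fin n → Fin N) → Injective _≡_ _≡_ f → n ≤ # (allFin N) (λ i → any? (allFin n) (λ k → does (f k Fin.≟ i)))
#-image {n} {N} f inj = begin
  n  ≡⟨ trans (∑-const (allFin n) 1) (trans (*-identityʳ _) (length-allFin n)) ⟨
  ∑ (allFin n) (λ _ → 1)  ≤⟨ ∑-mono (allFin n) (λ k → #-pos (∈-allFin (f k)) (⇒does (f k Fin.≟ f k) refl)) ⟩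
  ∑ (allFin n) (λ k → # (allFin N) (λ i → does (f k Fin.≟ i)))   ≡⟨ ∑-swap (allFin n) (allFin N) _ ⟩
  ∑ (allFin N) (λ i → # (allFin n) (λ k → does (f k Fin.≟ i)))   ≤⟨ ∑-mono (allFin N) (λ i → #≤any? (allFin n) _
    (#-≤1 (allFin n) _ (allFin-unique n) λ k l _ _ hk hl → inj (trans (does⇒ (f k Fin.≟ i) hk) (sym (does⇒ (f l Fin.≟ i) hl))))) ⟩
  # (allFin N) (λ i → any? (allFin n) (λ k → does (f k Fin.≟ i))) ∎
  where open ≤-Reasoning

module _ {V : Set} (adj : V → V → Bool) (adj-sym : ∀ u v → adj u v ≡ adj v u) where

  redGraph : ∀ {N} → Vec V N → Coloring N
  redGraph gs .col i j = not (adj (Vec.lookup gs i) (Vec.lookup gs j))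
  redGraph gs .col-sym i j = cong not (adj-sym _ _)

  redGraph-refutes : ∀ {N n} (gs : Vec V N) → (∀ u₁ u₂ u₃ u₄ → adj u₁ u₂ ≡ true → adj u₁ u₃ ≡ true → adj u₁ u₄ ≡ true →
      adj u₂ u₃ ≡ true → adj u₂ u₄ ≡ true → adj u₃ u₄ ≡ true → ⊥) →
    indepSubs adj (λ _ → true) n gs ≡ 0 → ¬ RProp 4 n N
  redGraph-refutes {N} {n} gs K₄-free none ramsey = cases (ramsey (redGraph gs))
    where
    cases : HasSet N 4 (Independent (Blue (redGraph gs))) ⊎ HasSet N n (Independent (Red (redGraph gs))) → ⊥
    cases (inj₁ (f , inj , ind)) = K₄-free (g zero) (g (suc zero)) (g (suc (suc zero))) (g (suc (suc (suc zero))))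
      (edge (λ ())) (edge (λ ())) (edge (λ ())) (edge (λ ())) (edge (λ ())) (edge (λ ()))
      where
      g : Fin 4 → V
      g a = Vec.lookup gs (f a)
      edge : ∀ {a b} → a ≢ b → adj (g a) (g b) ≡ true
      edge {a} {b} a≢b with adj (g a) (g b) in e
      ... | true = refl
      ... | false = contradiction ((λ q → a≢b (inj q)) , cong not e) (ind (f a) (f b) (a , refl) (b , refl))
    cases (inj₂ (f , inj , ind)) = contradiction (indepSubs-pos adj gs (λ _ → true) n S (λ _ _ → refl) no-edge (#-image f inj)) (λ h → contradiction (subst (1 ≤_) none h) λ ())
      where
      S : Fin N → Bool
      S i = any? (allFin n) (λ k → does (f k Fin.≟ i))
      image : ∀ i → S i ≡ true → Img f i
      image i h = let (k , _ , e) = any?-⁻ (allFin n) _ h in k , does⇒ (f k Fin.≟ i) e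
      no-edge : ∀ i j → i ≢ j → S i ≡ true → S j ≡ true → adj (Vec.lookup gs i) (Vec.lookup gs j) ≡ false
      no-edge i j i≢j hi hj with adj (Vec.lookup gs i) (Vec.lookup gs j) in e
      ... | false = refl
      ... | true = contradiction (i≢j , cong not e) (ind i j (image i hi) (image j hj))

-- By Bernoulli's inequality (1 + 1/B)^(B+1) is at least 2, so `suc B` picks of the Kleitman-Winston
-- algorithm halve the available set.
power-double : ∀ B i → 2 ^ i * B ^ (suc B * i) ≤ suc B ^ (suc B * i)
power-double B i = begin
  2 ^ i * B ^ (suc B * i)  ≡⟨ cong (2 ^ i *_) (^-*-assoc B (suc B) i) ⟨
  2 ^ i * (B ^ suc B) ^ i  ≡⟨ ^-distribʳ-* i 2 (B ^ suc B) ⟨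
  (2 * B ^ suc B) ^ i  ≤⟨ ^-monoˡ-≤ i twice ⟩
  (suc B ^ suc B) ^ i  ≡⟨ ^-*-assoc (suc B) (suc B) i ⟩
  suc B ^ (suc B * i) ∎
  where
  open ≤-Reasoning
  twice : 2 * B ^ suc B ≤ suc B ^ suc B
  twice = begin
    2 * B ^ suc B  ≡⟨ cong (B ^ suc B +_) (+-identityʳ _) ⟩
    B ^ suc B + B * B ^ B  ≤⟨ +-monoʳ-≤ (B ^ suc B) (*-monoˡ-≤ (B ^ B) (n≤1+n B)) ⟩
    B ^ suc B + suc B * B ^ B  ≤⟨ power-bernoulli B B ⟩
    suc B ^ suc B ∎

module LowerBound (p : ℕ) (p-prime : Prime p) (2<p : 2 < p) (d : ℤ) (d-nonresidue : ∀ z → ¬ Modulo.Div p p-prime (z ℤ.* z ℤ.- d)) where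

  open Unital p p-prime 2<p d d-nonresidue
  open LabelledLines _≟L_ K inc
  open Clash

  K₄-free : ∀ u₁ u₂ u₃ u₄ → adj u₁ u₂ ≡ true → adj u₁ u₃ ≡ true → adj u₁ u₄ ≡ true →
    adj u₂ u₃ ≡ true → adj u₂ u₄ ≡ true → adj u₃ u₄ ≡ true → ⊥
  K₄-free u₁ u₂ u₃ u₄ h₁₂ h₁₃ h₁₄ h₂₃ h₂₄ h₃₄ = inc-no-O'Nan (proj₁ u₁) (proj₁ u₂) (proj₁ u₃) (proj₁ u₄)
    (at c₁₂) (at c₁₃) (at c₂₃) (at c₁₄) (at c₂₄) (at c₃₄)
    (onˡ c₁₂) (onʳ c₁₂) (onˡ c₁₃) (onʳ c₁₃) (onˡ c₂₃) (onʳ c₂₃) (onˡ c₁₄) (onʳ c₁₄) (onˡ c₂₄) (onʳ c₂₄) (onˡ c₃₄) (onʳ c₃₄)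
    (distinct c₁₄) (distinct c₂₄) (distinct c₃₄) (distinct c₁₂)
    (clash-points-differ inc-meet-once c₁₂ c₁₄ c₂₄)
    (clash-points-differ inc-meet-once (flip c₁₃) c₃₄ c₁₄)
    (clash-points-differ inc-meet-once c₂₄ c₂₃ (flip c₃₄))
    (clash-points-differ inc-meet-once c₁₃ c₁₂ (flip c₂₃))
    (clash-points-differ inc-meet-once c₂₃ (flip c₁₂) (flip c₁₃))
    where
    c₁₂ = adj⇒Clash u₁ u₂ h₁₂
    c₁₃ = adj⇒Clash u₁ u₃ h₁₃
    c₁₄ = adj⇒Clash u₁ u₄ h₁₄
    c₂₃ = adj⇒Clash u₂ u₃ h₂₃
    c₂₄ = adj⇒Clash u₂ u₄ h₂₄
    c₃₄ = adj⇒Clash u₃ u₄ h₃₄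

-- Rich lines have at least `8 * r` points; `suc B` is of order p and its inverse is the edge
-- density. A total of `i` halvings lead from all labelled lines down to the threshold, `2 ^ x`
-- bounds the choices in one round, and `hn` keeps the choices of all `suc B * i` rounds below 2^n.
module LowerBoundNumbers (p : ℕ) (p-prime : Prime p) (2<p : 2 < p) (d : ℤ) (d-nonresidue : ∀ z → ¬ Modulo.Div p p-prime (z ℤ.* z ℤ.- d))
  (r B i x n N : ℕ) (hr : 16 * r ≤ p) (hlow : p * (p * (p * p)) ≤ 4 ^ r) (hB : 8 * (p * (p * p)) ≤ r * r * suc B) (p≤B : p ≤ suc B)
  (hi : p * p ≤ 2 ^ i) (hx : 1 + n * (p * p) ≤ 2 ^ x) (hn : x * (suc B * i) < n)
  (hN : 32 * (N * (suc B * (2 * p))) ≤ n * (p * (p * (p * p)))) where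

  open Unital p p-prime 2<p d d-nonresidue hiding (X)
  open LowerBound p p-prime 2<p d d-nonresidue using (K₄-free)
  open LabelledLines _≟L_ K inc
  open Supersaturation (richLines r) (richLines-unique r) inc-meet-once r (2 * p) (richLines-rich r)
    (λ ℓ → ≤-trans (≤-reflexive (#-inc ℓ)) (size≤ ℓ)) using (high-degree)

  open ≤-Reasoning

  p⁴ Z M V X j : ℕ
  p⁴ = p * (p * (p * p))
  Z = 2 ^ K
  M = suc B * (Z * (2 * p))
  V = length (richLines r)
  X = 1 + n * (p * p)
  j = suc B * i

  Γ : List Labelled
  Γ = labelled (richLines r)

  V≤ : V ≤ p⁴
  V≤ = ≤-trans (Listₚ.length-filter (T? ∘ (λ ℓ → 8 * r ≤ᵇ size ℓ)) lines) (≤-reflexive length-lines)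

  1≤p : 1 ≤ p
  1≤p = ≤-trans (s≤s z≤n) 2<p

  p²Z≤M : p * p * Z ≤ M
  p²Z≤M = begin
    p * p * Z  ≤⟨ m≤m+n _ _ ⟩
    p * p * Z + p * p * Z  ≡⟨ e p Z ⟩
    p * (Z * (2 * p))  ≤⟨ *-monoˡ-≤ (Z * (2 * p)) p≤B ⟩
    M ∎
    where
    e : ∀ p z → p * p * z + p * p * z ≡ p * (z * (2 * p))
    e = solve-∀

  -- The threshold `M` has density at least p⁻² among the labelled lines, so `i` halvings suffice to
  -- reach it.
  G≤ : length Γ ≤ p * p * M
  G≤ = begin
    length Γ  ≡⟨ length-labelled (richLines r) ⟩
    V * Z  ≤⟨ *-monoˡ-≤ Z V≤ ⟩
    p⁴ * Z  ≡⟨ e p Z ⟩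
    p * p * (p * p * Z) ≤⟨ *-monoʳ-≤ (p * p) p²Z≤M ⟩
    p * p * M ∎
    where
    e : ∀ p z → p * (p * (p * p)) * z ≡ p * p * (p * p * z)
    e = solve-∀

  1≤Z : 1 ≤ Z
  1≤Z = m^n>0 2 K

  Z≤M : Z ≤ M
  Z≤M = ≤-trans (≤-trans (≤-reflexive (sym (+-identityʳ Z))) (*-monoˡ-≤ Z (*-mono-≤ 1≤p 1≤p))) p²Z≤M

  dense : ∀ A → A ⊆ Γ → M ≤ length A → ∃ λ xs → ∃ λ v → ∃ λ ys → A ≡ xs ++ v ∷ ys × suc B * length (_∖_ adj A v) ≤ B * length A
  dense A A⊆ h = high-degree A A⊆ B
    (subst (1 ≤_) (sym length-points) (*-mono-≤ 1≤p (*-mono-≤ 1≤p 1≤p)))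
    (subst (λ k → 8 * k ≤ r * r * suc B) (sym length-points) hB)
    -- `M` is by definition the threshold `suc B * (2 ^ K * R)` with `R` equal to `2 * p`.
    h
    (begin
      2 * (V * Z)  ≤⟨ *-monoʳ-≤ 2 (*-monoˡ-≤ Z (≤-trans V≤ hlow)) ⟩
      2 * (4 ^ r * Z)  ≡⟨ e (4 ^ r) Z ⟩
      4 ^ r * (1 * (Z * 2)) ≤⟨ *-monoʳ-≤ (4 ^ r) (*-mono-≤ {1} {suc B} {Z * 2} {Z * (2 * p)} (s≤s z≤n) (*-monoʳ-≤ Z (*-monoʳ-≤ 2 1≤p))) ⟩
      4 ^ r * M  ≤⟨ *-monoʳ-≤ (4 ^ r) h ⟩
      4 ^ r * length A ∎)
    (≤-trans 1≤Z (≤-trans Z≤M h))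
    where
    e : ∀ a z → 2 * (a * z) ≡ a * (1 * (z * 2))
    e = solve-∀

  few-independent : ind adj n Γ ≤ X ^ j * M ^ n
  few-independent = kleitman-winston adj adj-sym Γ M X B n dense (s≤s z≤n) X-large j n Γ ≤-refl ⊆-refl small
    where
    e : ∀ m n q → m + n * (q * m) ≡ (1 + n * q) * m
    e = solve-∀
    X-large : M + n * length Γ ≤ X * M
    X-large = ≤-trans (+-monoʳ-≤ M (*-monoʳ-≤ n G≤)) (≤-reflexive (e M n (p * p)))
    e′ : ∀ a b m → a * (b * m) ≡ b * a * m
    e′ = solve-∀
    small : B ^ j * length Γ ≤ suc B ^ j * M
    small = begin
      B ^ j * length Γ  ≤⟨ *-monoʳ-≤ (B ^ j) (≤-trans G≤ (*-monoˡ-≤ M hi)) ⟩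
      B ^ j * (2 ^ i * M)     ≡⟨ e′ (B ^ j) (2 ^ i) M ⟩
      2 ^ i * B ^ j * M  ≤⟨ *-monoˡ-≤ M (power-double B i) ⟩
      suc B ^ j * M ∎

  lower-bound : ¬ RProp 4 n N
  lower-bound = let (gs , none) = sample adj Γ N n (sample-bound adj Γ N n M (X ^ j) few-independent dense-enough X^j< positive) in
      redGraph-refutes adj adj-sym gs K₄-free none
    where
    X^j< : X ^ j < 2 ^ n
    X^j< = begin-strict
      X ^ j  ≤⟨ ^-monoˡ-≤ j hx ⟩
      (2 ^ x) ^ j    ≡⟨ ^-*-assoc 2 x j ⟩
      2 ^ (x * j)    <⟨ ^-monoʳ-< 2 (s≤s (s≤s z≤n)) hn ⟩
      2 ^ n ∎
    e₁ : ∀ N b z q → 4 * (8 * (N * (b * (z * q)))) ≡ 32 * (N * (b * q)) * z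
    e₁ = solve-∀
    e₂ : ∀ n v z → n * (4 * v) * z ≡ 4 * (n * (v * z))
    e₂ = solve-∀
    dense-enough : 8 * (N * M) ≤ n * length Γ
    dense-enough = *-cancelˡ-≤ 4 (begin
      4 * (8 * (N * M))  ≡⟨ e₁ N (suc B) Z (2 * p) ⟩
      32 * (N * (suc B * (2 * p))) * Z  ≤⟨ *-monoˡ-≤ Z hN ⟩
      n * p⁴ * Z  ≤⟨ *-monoˡ-≤ Z (*-monoʳ-≤ n (many-rich-lines r hr)) ⟩
      n * (4 * V) * Z  ≡⟨ e₂ n V Z ⟩
      4 * (n * (V * Z))  ≡⟨ cong (λ g → 4 * (n * g)) (length-labelled (richLines r)) ⟨
      4 * (n * length Γ) ∎)
    1≤V : 1 ≤ V
    1≤V = *-cancelˡ-< 4 0 V (≤-trans (*-mono-≤ 1≤p (*-mono-≤ 1≤p (*-mono-≤ 1≤p 1≤p))) (many-rich-lines r hr))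
    positive : 0 < n * length Γ
    positive = *-mono-≤ (≤-trans (s≤s z≤n) hn) (≤-trans (*-mono-≤ 1≤V 1≤Z) (≤-reflexive (sym (length-labelled (richLines r)))))

-- Graphs without triangles and hexagons

module Graph (N : ℕ) (E : Fin N → Fin N → Bool) (E-sym : ∀ i j → E i j ≡ E j i) (E-irrefl : ∀ i → E i i ≡ false) where

  V : List (Fin N)
  V = allFin N

  Subset : Set
  Subset = Fin N → Bool

  infix 4 _⊑_
  _⊑_ : Subset → Subset → Set
  S ⊑ S′ = ∀ i → S i ≡ true → S′ i ≡ true

  Stable : Subset → Set
  Stable J = ∀ i j → J i ≡ true → J j ≡ true → E i j ≡ false

  nbr : Subset → Fin N → Subset
  nbr S v u = S u ∧ E v u

  #-remove : ∀ S R → # V S ≤ # V (λ u → S u ∧ not (R u)) + # V R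
  #-remove S R = ≤-trans (∑-mono V (λ u → split (S u) (R u))) (≤-reflexive (∑-+ V _ _))
    where
    split : ∀ s r → ⟦ s ⟧ ≤ ⟦ s ∧ not r ⟧ + ⟦ r ⟧
    split false r = z≤n
    split true true = ≤-refl
    split true false = ≤-refl

  insert : Fin N → Subset → Subset
  insert v J u = does (v Fin.≟ u) ∨ J u

  #-insert : ∀ v J → J v ≡ false → suc (# V J) ≤ # V (insert v J)
  #-insert v J h = begin
    1 + # V J  ≤⟨ +-monoˡ-≤ (# V J) (#-pos (∈-allFin v) (⇒does (v Fin.≟ v) refl)) ⟩
    # V (λ u → does (v Fin.≟ u)) + # V J  ≡⟨ ∑-+ V _ _ ⟨
    ∑ V (λ u → ⟦ does (v Fin.≟ u) ⟧ + ⟦ J u ⟧)  ≤⟨ ∑-mono V (λ u → disjoint u) ⟩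
    # V (insert v J) ∎
    where
    open ≤-Reasoning
    disjoint : ∀ u → ⟦ does (v Fin.≟ u) ⟧ + ⟦ J u ⟧ ≤ ⟦ does (v Fin.≟ u) ∨ J u ⟧
    disjoint u with v Fin.≟ u
    ... | yes refl rewrite h = ≤-refl
    ... | no _ = ≤-refl

  StableIn : Subset → ℕ → Set
  StableIn S n = ∃ λ J → J ⊑ S × Stable J × n ≤ # V J

  -- Greedy deletion of closed neighbourhoods of size at most `D`: n deletions yield a stable n-set,
  -- while an earlier stop leaves a core of minimum degree `D` at a loss of at most `n * D`
  -- vertices.
  min-degree : ∀ D n S → StableIn S n ⊎
    (∃ λ S′ → S′ ⊑ S × # V S ≤ # V S′ + n * D × (∀ v → S′ v ≡ true → D ≤ # V (nbr S′ v)))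
  min-degree D zero S = inj₁ ((λ _ → false) , (λ _ ()) , (λ _ _ ()) , z≤n)
  min-degree D (suc n) S with Fin.any? (λ v → Data.Bool._≟_ (S v) true ×-dec (suc (# V (nbr S v)) ≤? D))
  ... | no none = inj₂ (S , (λ _ h → h) , m≤m+n _ _ , λ v hv → ≮⇒≥ λ h → none (v , hv , h))
  ... | yes (v , hv , small) with min-degree D n S₁
    where S₁ = λ u → S u ∧ not (insert v (nbr S v) u)
  ... | inj₁ (J , J⊑ , J-stable , hn) = inj₁ (insert v J , sub , stable , ≤-trans (s≤s hn) (#-insert v J v∉J))
    where
    outside : ∀ u → J u ≡ true → S u ≡ true × insert v (nbr S v) u ≡ false
    outside u h = let (a , b) = ∧-⁻ (J⊑ u h) in a , not-⁻ b
    v∉J : J v ≡ false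
    v∉J = ≢true λ h → true≢false (cong (_∨ nbr S v v) (⇒does (v Fin.≟ v) refl)) (proj₂ (outside v h))
    no-edge : ∀ u → J u ≡ true → E v u ≡ false
    no-edge u h = ≢true λ e → true≢false (trans (cong (does (v Fin.≟ u) ∨_) (∧-⁺ (proj₁ (outside u h)) e)) (∨-true (does (v Fin.≟ u)))) (proj₂ (outside u h))
      where
      ∨-true : ∀ b → b ∨ true ≡ true
      ∨-true true = refl
      ∨-true false = refl
    sub : insert v J ⊑ S
    sub u h with ∨-⁻ {does (v Fin.≟ u)} h
    ... | inj₁ q = subst (λ w → S w ≡ true) (does⇒ (v Fin.≟ u) q) hv
    ... | inj₂ q = proj₁ (outside u q)
    stable : Stable (insert v J)
    stable i j hi hj with ∨-⁻ {does (v Fin.≟ i)} hi | ∨-⁻ {does (v Fin.≟ j)} hj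
    ... | inj₂ a | inj₂ b = J-stable i j a b
    ... | inj₁ a | inj₁ b = subst₂ (λ x y → E x y ≡ false) (does⇒ (v Fin.≟ i) a) (does⇒ (v Fin.≟ j) b) (E-irrefl v)
    ... | inj₁ a | inj₂ b = subst (λ x → E x j ≡ false) (does⇒ (v Fin.≟ i) a) (no-edge j b)
    ... | inj₂ a | inj₁ b = subst (λ y → E i y ≡ false) (does⇒ (v Fin.≟ j) b) (trans (E-sym i v) (no-edge i a))
  ... | inj₂ (S′ , S′⊑ , hS′ , deg) = inj₂ (S′ , (λ i h → proj₁ (∧-⁻ (S′⊑ i h))) , bound , deg)
    where
    open ≤-Reasoning
    closed : # V (insert v (nbr S v)) ≤ D
    closed = begin
      # V (insert v (nbr S v))  ≤⟨ #-∨ V _ _ ⟩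
      # V (λ u → does (v Fin.≟ u)) + # V (nbr S v)  ≤⟨ +-monoˡ-≤ _ (#-≤1 V _ (allFin-unique N) λ x y _ _ p q → trans (sym (does⇒ (v Fin.≟ x) p)) (does⇒ (v Fin.≟ y) q)) ⟩
      1 + # V (nbr S v)  ≤⟨ small ⟩
      D ∎
    e : ∀ s n d → s + n * d + d ≡ s + (d + n * d)
    e = solve-∀
    bound : # V S ≤ # V S′ + suc n * D
    bound = begin
      # V S  ≤⟨ #-remove S (insert v (nbr S v)) ⟩
      _  ≤⟨ +-mono-≤ hS′ closed ⟩
      # V S′ + n * D + D  ≡⟨ e (# V S′) n D ⟩
      # V S′ + suc n * D ∎

  module Neighbourhoods (S : Subset) (n D q : ℕ)
    (triangle-free : ∀ a b c → S a ≡ true → S b ≡ true → S c ≡ true → E a b ≡ true → E b c ≡ true → E a c ≡ true → ⊥)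
    (hexagon-free : ∀ x₁ x₂ x₃ y₁ y₂ y₃ → S x₁ ≡ true → S x₂ ≡ true → S x₃ ≡ true → S y₁ ≡ true → S y₂ ≡ true → S y₃ ≡ true →
      E x₁ y₂ ≡ true → E x₁ y₃ ≡ true → E x₂ y₁ ≡ true → E x₂ y₃ ≡ true → E x₃ y₁ ≡ true → E x₃ y₂ ≡ true →
      E x₁ y₁ ≡ false → E x₂ y₂ ≡ false → E x₃ y₃ ≡ false → ⊥)
    (small-stable : ∀ J → J ⊑ S → Stable J → # V J < n)
    (degree≥ : ∀ v → S v ≡ true → D ≤ # V (nbr S v)) where

    Γ : Fin N → Subset
    Γ = nbr S

    codeg : Fin N → Fin N → ℕ
    codeg x v = # V (λ w → Γ v w ∧ Γ x w)

    degree< : ∀ v → S v ≡ true → # V (Γ v) ≤ n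
    degree< v hv = <⇒≤ (small-stable (Γ v) (λ i h → proj₁ (∧-⁻ h)) λ i j hi hj →
      ≢true λ e → triangle-free v i j hv (proj₁ (∧-⁻ hi)) (proj₁ (∧-⁻ hj)) (proj₂ (∧-⁻ hi)) e (proj₂ (∧-⁻ hj)))

    -- A vertex is bad for v if it has many common neighbours with v, and in the crowd of v if it has many bad neighbours.
    bad crowd : Fin N → Subset
    bad v x = S x ∧ (q <ᵇ codeg x v)
    crowd v w = S w ∧ (q <ᵇ # V (λ x → Γ w x ∧ bad v x))

    <ᵇ⇒ : ∀ {m k} → (m <ᵇ k) ≡ true → m < k
    <ᵇ⇒ {m} {k} h = <ᵇ⇒< m k (subst T (sym h) tt)

    <ᵇ⇒≥ : ∀ {m k} → (m <ᵇ k) ≡ false → k ≤ m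
    <ᵇ⇒≥ h = ≮⇒≥ λ l → subst T h (<⇒<ᵇ l)

    markov : ∀ (f : Fin N → ℕ) (P : Subset) → # V (λ x → P x ∧ (q <ᵇ f x)) * q ≤ ∑ V (λ x → ⟦ P x ⟧ * f x)
    markov f P = ≤-trans (≤-reflexive (sym (∑-*ʳ V q _))) (∑-mono V pointwise)
      where
      pointwise : ∀ x → ⟦ P x ∧ (q <ᵇ f x) ⟧ * q ≤ ⟦ P x ⟧ * f x
      pointwise x with P x
      ... | false = z≤n
      ... | true with q <ᵇ f x in e
      ... | false = z≤n
      ... | true = +-monoˡ-≤ 0 (<⇒≤ (<ᵇ⇒ e))

    -- The edges between `S` and `A` are counted from the side of `A`, where neighbourhoods are
    -- stable and hence have at most n vertices.
    paths : ∀ (A : Subset) → A ⊑ S → ∑ V (λ x → ⟦ S x ⟧ * # V (λ w → Γ x w ∧ A w)) ≤ n * # V A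
    paths A A⊑ = begin
      ∑ V (λ x → ⟦ S x ⟧ * # V (λ w → Γ x w ∧ A w))  ≡⟨ ∑-cong V (λ x → ∑-*ˡ V ⟦ S x ⟧ _) ⟨
      ∑ V (λ x → ∑ V (λ w → ⟦ S x ⟧ * ⟦ Γ x w ∧ A w ⟧))     ≡⟨ ∑-swap V V _ ⟩
      ∑ V (λ w → ∑ V (λ x → ⟦ S x ⟧ * ⟦ Γ x w ∧ A w ⟧))     ≤⟨ ∑-mono V (λ w → ∑-mono V (λ x → turn x w)) ⟩
      ∑ V (λ w → ∑ V (λ x → ⟦ A w ⟧ * ⟦ Γ w x ⟧))  ≡⟨ ∑-cong V (λ w → ∑-*ˡ V ⟦ A w ⟧ _) ⟩
      ∑ V (λ w → ⟦ A w ⟧ * # V (Γ w))  ≤⟨ ∑-mono V bounded ⟩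
      ∑ V (λ w → ⟦ A w ⟧ * n)  ≡⟨ trans (∑-*ʳ V n _) (*-comm (# V A) n) ⟩
      n * # V A ∎
      where
      open ≤-Reasoning
      turn : ∀ x w → ⟦ S x ⟧ * ⟦ Γ x w ∧ A w ⟧ ≤ ⟦ A w ⟧ * ⟦ Γ w x ⟧
      turn x w rewrite E-sym w x with S x | S w | E x w | A w
      ... | false | _ | _ | _ = z≤n
      ... | true | false | _ | _ = z≤n
      ... | true | true | false | _ = z≤n
      ... | true | true | true | false = z≤n
      ... | true | true | true | true = ≤-refl
      bounded : ∀ w → ⟦ A w ⟧ * # V (Γ w) ≤ ⟦ A w ⟧ * n
      bounded w with A w in e
      ... | false = z≤n
      ... | true = +-monoˡ-≤ 0 (degree< w (A⊑ w e))

    -- At most n² paths of length two start at `v`, and every bad vertex is the end of more than q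
    -- of them; `crowd-bound` repeats this one step further out.
    bad-bound : ∀ v → S v ≡ true → # V (bad v) * q ≤ n * n
    bad-bound v hv = ≤-trans (markov (λ x → codeg x v) S) (≤-trans
      (∑-mono V (λ x → *-monoʳ-≤ ⟦ S x ⟧ (#-mono V (λ w h → let (a , b) = ∧-⁻ {Γ v w} h in ∧-⁺ {Γ x w} b a))))
      (≤-trans (paths (Γ v) (λ i h → proj₁ (∧-⁻ h))) (*-monoʳ-≤ n (degree< v hv))))

    crowd-bound : ∀ v → # V (crowd v) * q ≤ n * # V (bad v)
    crowd-bound v = ≤-trans (markov (λ w → # V (λ x → Γ w x ∧ bad v x)) S) (paths (bad v) (λ i h → proj₁ (∧-⁻ h)))

    -- What a later centre has to avoid: a non-edge between the two centres is one diagonal of the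
    -- hexagon, while few common neighbours and few bad neighbours keep the losses of order q.
    excluded : Fin N → Subset
    excluded v w = does (v Fin.≟ w) ∨ (Γ v w ∨ (bad v w ∨ crowd v w))

    excluded-bound : ∀ v → S v ≡ true → # V (excluded v) ≤ 1 + (n + (# V (bad v) + # V (crowd v)))
    excluded-bound v hv = ≤-trans (#-∨ V _ _) (+-mono-≤
      (#-≤1 V _ (allFin-unique N) λ x y _ _ p p′ → trans (sym (does⇒ (v Fin.≟ x) p)) (does⇒ (v Fin.≟ y) p′))
      (≤-trans (#-∨ V _ _) (+-mono-≤ (degree< v hv) (#-∨ V _ _))))

    -- The union of a non-empty finite chain is its largest member, so the number of traces does not
    -- enter the bound.
    chain-union : ∀ (M : Subset) (tr : Fin N → Subset) →
      (∀ y z → M y ≡ true → M z ≡ true → tr y ⊑ tr z ⊎ tr z ⊑ tr y) → (∀ y → M y ≡ true → # V (tr y) ≤ q) →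
      # V (λ w → any? V (λ y → M y ∧ tr y w)) ≤ q
    chain-union M tr chain small = conclude (largest V)
      where
      Largest : List (Fin N) → Set
      Largest ys = (∀ y → y ∈ ys → M y ≡ false) ⊎ (∃ λ y₀ → M y₀ ≡ true × (∀ y → y ∈ ys → M y ≡ true → tr y ⊑ tr y₀))
      largest : ∀ ys → Largest ys
      largest [] = inj₁ (λ _ ())
      largest (y ∷ ys) with M y in e | largest ys
      ... | false | inj₁ none = inj₁ λ { z (here refl) → e ; z (there i) → none z i }
      ... | false | inj₂ (y₀ , m₀ , top) = inj₂ (y₀ , m₀ , λ { z (here refl) h → true≢false h e ; z (there i) → top z i })
      ... | true | inj₁ none = inj₂ (y , e , λ { z (here refl) _ i h → h ; z (there i) h → true≢false h (none z i) })
      ... | true | inj₂ (y₀ , m₀ , top) with chain y y₀ e m₀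
      ... | inj₁ sub = inj₂ (y₀ , m₀ , λ { z (here refl) _ → sub ; z (there i) → top z i })
      ... | inj₂ sup = inj₂ (y , e , λ { z (here refl) _ i h → h ; z (there i) h w k → sup w (top z i h w k) })
      conclude : Largest V → # V (λ w → any? V (λ y → M y ∧ tr y w)) ≤ q
      conclude (inj₁ none) = ≤-trans (≤-reflexive (#-none V _ λ w _ h → let (y , i , e) = any?-⁻ V _ h in true≢false (proj₁ (∧-⁻ e)) (none y i))) z≤n
      conclude (inj₂ (y₀ , m₀ , top)) = ≤-trans (#-mono V λ w h → let (y , i , e) = any?-⁻ V _ h ; (a , b) = ∧-⁻ e in top y i a w b) (small y₀ m₀)

    -- The state after j centres. `J` stays inside the union of their neighbourhoods, so that a lost
    -- vertex can be assigned to a centre. One step costs at most `3 * q` for each earlier centre: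
    -- `2 * q` vertices of the new neighbourhood and q vertices of the old `J`; `m` bounds the
    -- number of earlier centres once and for all.
    record Pack (j m : ℕ) : Set where
      field
        centres   : List (Fin N)
        length≡   : length centres ≡ j
        centres⊑  : ∀ v → v ∈ centres → S v ≡ true
        J  : Subset
        J⊑  : J ⊑ S
        J-stable  : Stable J
        J-covered : ∀ w → J w ≡ true → any? centres (λ v → Γ v w) ≡ true
        J-large   : j * D ≤ # V J + j * (m * (3 * q))

    module Extend {j m : ℕ} (P : Pack j m) (j≤m : j ≤ m) (v : Fin N) (hv : S v ≡ true)
      (allowed : ∀ c → c ∈ Pack.centres P → excluded c v ≡ false) where

      open Pack P

      ∨-false : ∀ {a b} → a ∨ b ≡ false → a ≡ false × b ≡ false
      ∨-false {false} h = refl , h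

      drop-S : ∀ {s b} → s ≡ true → s ∧ b ≡ false → b ≡ false
      drop-S refl h = h

      allowed′ : ∀ c → c ∈ centres → Γ c v ≡ false × bad c v ≡ false × crowd c v ≡ false
      allowed′ c i = let (_ , h) = ∨-false {does (c Fin.≟ v)} (allowed c i) ; (a , h′) = ∨-false {Γ c v} h in
        a , ∨-false {bad c v} h′

      not-nbr : ∀ c → c ∈ centres → E c v ≡ false
      not-nbr c i = drop-S hv (proj₁ (allowed′ c i))

      codeg≤ : ∀ c → c ∈ centres → codeg v c ≤ q
      codeg≤ c i = <ᵇ⇒≥ (drop-S hv (proj₁ (proj₂ (allowed′ c i))))

      few-bad : ∀ c → c ∈ centres → # V (λ x → Γ v x ∧ bad c x) ≤ q
      few-bad c i = <ᵇ⇒≥ (drop-S hv (proj₂ (proj₂ (allowed′ c i))))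

      -- A neighbour of `v` that is bad for a centre could have a long trace on its neighbourhood,
      -- and a common neighbour with a centre could already lie in `J`.
      avoid : Subset
      avoid w = any? centres (λ c → Γ v w ∧ bad c w ∨ Γ c w ∧ Γ v w)

      M : Subset
      M w = Γ v w ∧ not (avoid w)

      near : Subset
      near w = any? V (λ y → M y ∧ E y w)

      J′ : Subset
      J′ w = M w ∨ (J w ∧ not (near w))

      open ≤-Reasoning

      ∑-centres : ∀ (f : Fin N → ℕ) c → (∀ v → v ∈ centres → f v ≤ c) → ∑ centres f ≤ j * c
      ∑-centres f c h = ≤-trans (∑-mono-∈ centres h) (≤-reflexive (trans (∑-const centres c) (cong (_* c) length≡)))

      M-large : D ≤ # V M + j * (2 * q)
      M-large = begin
        D  ≤⟨ degree≥ v hv ⟩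
        # V (Γ v)  ≤⟨ #-remove (Γ v) avoid ⟩
        # V M + # V avoid  ≤⟨ +-monoʳ-≤ (# V M) (≤-trans (#-any? V centres (λ w c → Γ v w ∧ bad c w ∨ Γ c w ∧ Γ v w)) (∑-centres _ (2 * q) each)) ⟩
        # V M + j * (2 * q) ∎
        where
        each : ∀ c → c ∈ centres → # V (λ w → Γ v w ∧ bad c w ∨ Γ c w ∧ Γ v w) ≤ 2 * q
        each c i = ≤-trans (#-∨ V _ _) (+-mono-≤ (few-bad c i) (≤-trans (codeg≤ c i) (≤-reflexive (sym (+-identityʳ q)))))

      M⇒ : ∀ w → M w ≡ true → S w ≡ true × E v w ≡ true × (∀ c → c ∈ centres → bad c w ≡ false × Γ c w ≡ false)
      M⇒ w h = let (g , a) = ∧-⁻ h ; (s , e) = ∧-⁻ g in s , e , λ c i →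
        ≢true (λ b → true≢false (any?-⁺ _ i (∨ˡ (∧-⁺ g b))) (not-⁻ a)) ,
        ≢true (λ b → true≢false (any?-⁺ _ i (∨ʳ {Γ v w ∧ bad c w} (∧-⁺ b g))) (not-⁻ a))
        where
        ∨ˡ : ∀ {a b} → a ≡ true → a ∨ b ≡ true
        ∨ˡ refl = refl
        ∨ʳ : ∀ {a b} → b ≡ true → a ∨ b ≡ true
        ∨ʳ {true} h = refl
        ∨ʳ {false} h = h

      -- Traces of M on the neighbourhood of c form a chain, as two crossing traces give a hexagon.
      near-centre : ∀ c → c ∈ centres → # V (λ w → any? V (λ y → M y ∧ (Γ c w ∧ Γ y w))) ≤ q
      near-centre c i = chain-union M tr chain small
        where
        tr : Fin N → Subset
        tr y w = Γ c w ∧ Γ y w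
        hc = centres⊑ c i
        small : ∀ y → M y ≡ true → # V (tr y) ≤ q
        small y h = let (s , _ , o) = M⇒ y h in <ᵇ⇒≥ (drop-S s (proj₁ (o c i)))
        no-crossing : ∀ y z a b → M y ≡ true → M z ≡ true → tr y a ≡ true → tr z a ≡ false → tr z b ≡ true → tr y b ≡ false → ⊥
        no-crossing y z a b my mz ya za zb yb =
          let (sy , ey , _) = M⇒ y my ; (sz , ez , _) = M⇒ z mz
              (ca , ya′) = ∧-⁻ ya ; (cb , zb′) = ∧-⁻ zb
              (sa , eca) = ∧-⁻ ca ; (sb , ecb) = ∧-⁻ cb
          -- The hexagon is c, a, y, v, z, b in cyclic order; its long diagonals c v, y b and z a
          -- are the three non-edges.
          in hexagon-free c y z v b a hc sy sz hv sb sa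
               ecb eca (trans (E-sym y v) ey) (proj₂ (∧-⁻ {S a} ya′)) (trans (E-sym z v) ez) (proj₂ (∧-⁻ {S b} zb′))
               (not-nbr c i) (drop-S sb (drop-S cb yb)) (drop-S sa (drop-S ca za))
        chain : ∀ y z → M y ≡ true → M z ≡ true → tr y ⊑ tr z ⊎ tr z ⊑ tr y
        chain y z my mz with any? V (λ w → tr y w ∧ not (tr z w)) in e
        ... | false = inj₁ λ w h → ≢false λ k → true≢false (any?-⁺ _ (∈-allFin w) (∧-⁺ h (cong not k))) e
        ... | true = inj₂ λ w h → ≢false λ k → let (a , _ , f) = any?-⁻ V _ e ; (ya , za) = ∧-⁻ f in
               no-crossing y z a w my mz ya (not-⁻ za) h k

      lost : # V (λ w → J w ∧ near w) ≤ j * q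
      lost = begin
        # V (λ w → J w ∧ near w)  ≤⟨ #-mono V locate ⟩
        # V (λ w → any? centres (λ c → any? V (λ y → M y ∧ (Γ c w ∧ Γ y w))))  ≤⟨ #-any? V centres _ ⟩
        ∑ centres (λ c → # V (λ w → any? V (λ y → M y ∧ (Γ c w ∧ Γ y w))))     ≤⟨ ∑-centres _ q near-centre ⟩
        j * q ∎
        where
        locate : ∀ w → J w ∧ near w ≡ true → any? centres (λ c → any? V (λ y → M y ∧ (Γ c w ∧ Γ y w))) ≡ true
        locate w h = let (hJ , hn) = ∧-⁻ h
                         (c , i , g) = any?-⁻ centres _ (J-covered w hJ)
                         (y , _ , k) = any?-⁻ V (λ y → M y ∧ E y w) hn
                         (my , eyw) = ∧-⁻ {M y} k
                     in any?-⁺ _ i (any?-⁺ (λ y → M y ∧ (Γ c w ∧ Γ y w)) (∈-allFin y) (∧-⁺ {M y} my (∧-⁺ {Γ c w} g (∧-⁺ {S w} (J⊑ w hJ) eyw))))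

      J′-size : # V M + # V (λ w → J w ∧ not (near w)) ≤ # V J′
      J′-size = ≤-trans (≤-reflexive (sym (∑-+ V _ _))) (∑-mono V disjoint)
        where
        disjoint : ∀ w → ⟦ M w ⟧ + ⟦ J w ∧ not (near w) ⟧ ≤ ⟦ M w ∨ (J w ∧ not (near w)) ⟧
        disjoint w with M w in e | J w in f
        ... | false | _ = ≤-refl
        ... | true | false = ≤-refl
        ... | true | true = let (c , i , g) = any?-⁻ centres _ (J-covered w f) in true≢false g (proj₂ (proj₂ (proj₂ (M⇒ w e)) c i))

      J-split : # V J ≤ # V (λ w → J w ∧ not (near w)) + # V (λ w → J w ∧ near w)
      J-split = ≤-trans (∑-mono V (λ w → split (J w) (near w))) (≤-reflexive (∑-+ V _ _))
        where
        split : ∀ a b → ⟦ a ⟧ ≤ ⟦ a ∧ not b ⟧ + ⟦ a ∧ b ⟧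
        split false b = z≤n
        split true true = ≤-refl
        split true false = ≤-refl

      J′-large : suc j * D ≤ # V J′ + suc j * (m * (3 * q))
      J′-large = begin
        D + j * D  ≤⟨ +-mono-≤ M-large J-large ⟩
        (# V M + j * (2 * q)) + (# V J + j * w)  ≤⟨ +-monoʳ-≤ (# V M + j * (2 * q)) (+-monoˡ-≤ (j * w) (≤-trans J-split (+-monoʳ-≤ a lost))) ⟩
        (# V M + j * (2 * q)) + (a + j * q + j * w)  ≡⟨ e₁ (# V M) j q a w ⟩
        (# V M + a) + (j * (3 * q) + j * w)  ≤⟨ +-mono-≤ J′-size (+-monoˡ-≤ (j * w) (*-monoˡ-≤ (3 * q) j≤m)) ⟩
        # V J′ + suc j * w ∎
        where
        a = # V (λ w → J w ∧ not (near w))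
        w = m * (3 * q)
        e₁ : ∀ M j q a w → (M + j * (2 * q)) + (a + j * q + j * w) ≡ (M + a) + (j * (3 * q) + j * w)
        e₁ = solve-∀

      far : ∀ y w → M y ≡ true → J w ∧ not (near w) ≡ true → E y w ≡ false
      far y w my h = ≢true λ e → true≢false (any?-⁺ _ (∈-allFin y) (∧-⁺ my e)) (not-⁻ (proj₂ (∧-⁻ {J w} h)))

      extended : Pack (suc j) m
      extended = record
        { centres = v ∷ centres
        ; length≡ = cong suc length≡
        ; centres⊑ = λ { c (here refl) → hv ; c (there i) → centres⊑ c i }
        ; J = J′
        ; J⊑ = λ w h → Data.Sum.[ (λ m → proj₁ (M⇒ w m)) , (λ k → J⊑ w (proj₁ (∧-⁻ k))) ] (∨-⁻ {M w} h)
        ; J-stable = λ y z hy hz → stable y z (∨-⁻ {M y} hy) (∨-⁻ {M z} hz)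
        ; J-covered = λ w h → covered w (∨-⁻ {M w} h)
        ; J-large = J′-large
        }
        where
        stable : ∀ y z → M y ≡ true ⊎ J y ∧ not (near y) ≡ true → M z ≡ true ⊎ J z ∧ not (near z) ≡ true → E y z ≡ false
        stable y z (inj₁ a) (inj₁ b) = let (sy , ey , _) = M⇒ y a ; (sz , ez , _) = M⇒ z b in
          ≢true λ e → triangle-free v y z hv sy sz ey e ez
        stable y z (inj₁ a) (inj₂ b) = far y z a b
        stable y z (inj₂ a) (inj₁ b) = trans (E-sym y z) (far z y b a)
        stable y z (inj₂ a) (inj₂ b) = J-stable y z (proj₁ (∧-⁻ a)) (proj₁ (∧-⁻ b))
        covered : ∀ w → M w ≡ true ⊎ J w ∧ not (near w) ≡ true → Γ v w ∨ any? centres (λ c → Γ c w) ≡ true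
        covered w (inj₁ a) rewrite proj₁ (∧-⁻ {Γ v w} a) = refl
        covered w (inj₂ b) rewrite J-covered w (proj₁ (∧-⁻ b)) with Γ v w
        ... | true = refl
        ... | false = refl

    -- Fewer than m centres exclude fewer than `m * e` vertices, so a further centre can always be
    -- found in `S`.
    pack : ∀ m e → (∀ v → S v ≡ true → # V (excluded v) ≤ e) → m * e ≤ # V S → 1 ≤ e → ∀ j → j ≤ m → Pack j m
    pack m e he hS 1≤e zero j≤m = record
      { centres = [] ; length≡ = refl ; centres⊑ = λ _ () ; J = λ _ → false ; J⊑ = λ _ () ; J-stable = λ _ _ () ; J-covered = λ _ () ; J-large = z≤n }
    pack m e he hS 1≤e (suc j) j<m = extend (#-witness V (λ w → S w ∧ not (ex w)) positive)
      where
      P = pack m e he hS 1≤e j (<⇒≤ j<m)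
      open Pack P
      open ≤-Reasoning
      ex : Subset
      ex w = any? centres (λ c → excluded c w)
      positive : 1 ≤ # V (λ w → S w ∧ not (ex w))
      positive = +-cancelʳ-≤ (j * e) _ _ (begin
        1 + j * e  ≤⟨ +-monoˡ-≤ (j * e) 1≤e ⟩
        suc j * e  ≤⟨ *-monoˡ-≤ e j<m ⟩
        m * e  ≤⟨ hS ⟩
        # V S  ≤⟨ #-remove S ex ⟩
        # V (λ w → S w ∧ not (ex w)) + # V ex  ≤⟨ +-monoʳ-≤ _ (≤-trans (#-any? V centres (λ w c → excluded c w))
                                                       (≤-trans (∑-mono-∈ centres (λ c i → he c (centres⊑ c i))) (≤-reflexive (trans (∑-const centres e) (cong (_* e) length≡))))) ⟩
        # V (λ w → S w ∧ not (ex w)) + j * e ∎)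
      extend : (∃ λ v → v ∈ V × S v ∧ not (ex v) ≡ true) → Pack (suc j) m
      extend (v , _ , h) = Extend.extended P (<⇒≤ j<m) v (proj₁ (∧-⁻ h))
        λ c i → ≢true λ x → true≢false (any?-⁺ _ i x) (not-⁻ (proj₂ (∧-⁻ {S v} h)))

    -- After m steps the stable set has at least m D - 3 m² q vertices, which is no less than n. The
    -- quantified bound `he` reflects that at most n²/q vertices are bad and at most n³/q² are in
    -- the crowd.
    contradictory : ∀ m e → (∀ β γ → β * q ≤ n * n → γ * q ≤ n * β → 1 + (n + (β + γ)) ≤ e) → m * e ≤ # V S → n + m * (m * (3 * q)) ≤ m * D → ⊥
    contradictory m e he hS hD = <⇒≱ (small-stable J J⊑ J-stable) (+-cancelʳ-≤ (m * (m * (3 * q))) _ _ (≤-trans hD J-large))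
      where
      open Pack (pack m e (λ v hv → ≤-trans (excluded-bound v hv) (he _ _ (bad-bound v hv) (crowd-bound v))) hS
        (≤-trans (s≤s z≤n) (he 0 0 z≤n z≤n)) m ≤-refl)

-- The upper bound for t(4,n)

choose : ∀ {N} n (J : Fin N → Bool) → n ≤ # (allFin N) J → ∃ λ (f : Fin n → Fin N) → Injective _≡_ _≡_ f × (∀ k → J (f k) ≡ true)
choose zero J h = (λ ()) , (λ { {()} }) , λ ()
choose {zero} (suc n) J ()
choose {suc N} (suc n) J h = go (J zero) refl
  where
  h′ : suc n ≤ ⟦ J zero ⟧ + # (allFin N) (J ∘ suc)
  h′ = subst (suc n ≤_) (∑-allFin-suc N (λ i → ⟦ J i ⟧)) h
  go : ∀ b → J zero ≡ b → ∃ λ (f : Fin (suc n) → Fin (suc N)) → Injective _≡_ _≡_ f × (∀ k → J (f k) ≡ true)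
  go false e = let (f , inj , hJ) = choose (suc n) (J ∘ suc) (subst (λ b → suc n ≤ ⟦ b ⟧ + # (allFin N) (J ∘ suc)) e h′) in
    suc ∘ f , inj ∘ Fin.suc-injective , hJ
  go true e = let (f , inj , hJ) = choose n (J ∘ suc) (s≤s⁻¹ (subst (λ b → suc n ≤ ⟦ b ⟧ + # (allFin N) (J ∘ suc)) e h′)) in
    (λ { zero → zero ; (suc k) → suc (f k) }) ,
    (λ { {zero} {zero} _ → refl ; {suc k} {suc l} q → cong suc (inj (Fin.suc-injective q)) }) ,
    λ { zero → e ; (suc k) → hJ k }

module Bound {N : ℕ} (E : Fin N → Fin N → Bool) (E-sym : ∀ i j → E i j ≡ E j i) (E-irrefl : ∀ i → E i i ≡ false) where

  open Graph N E E-sym E-irrefl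

  -- The parameters are n = u⁷, m = u, q = u⁵ and D = 4u⁶: the gain m D = 4u⁷ pays for n and for the
  -- losses 3 m² q = 3u⁷. At most u⁹ bad and u¹¹ crowded vertices make each centre exclude at most
  -- 4u¹¹ vertices, so u centres fit into the core, which keeps 4u¹³ vertices after the loss n D =
  -- 4u¹³.
  third : ∀ u S → 1 ≤ u →
    (∀ a b c → S a ≡ true → S b ≡ true → S c ≡ true → E a b ≡ true → E b c ≡ true → E a c ≡ true → ⊥) →
    (∀ x₁ x₂ x₃ y₁ y₂ y₃ → S x₁ ≡ true → S x₂ ≡ true → S x₃ ≡ true → S y₁ ≡ true → S y₂ ≡ true → S y₃ ≡ true →
      E x₁ y₂ ≡ true → E x₁ y₃ ≡ true → E x₂ y₁ ≡ true → E x₂ y₃ ≡ true → E x₃ y₁ ≡ true → E x₃ y₂ ≡ true →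
      E x₁ y₁ ≡ false → E x₂ y₂ ≡ false → E x₃ y₃ ≡ false → ⊥) →
    (∀ J → J ⊑ S → Stable J → # V J < u ^ 7) → # V S < 8 * u ^ 13
  third u S 1≤u triangle-free hexagon-free small-stable = ≰⇒> λ large → cases large (min-degree (4 * u ^ 6) (u ^ 7) S)
    where
    open ≤-Reasoning
    instance
      u≢0 : NonZero u
      u≢0 = >-nonZero 1≤u
    cases : 8 * u ^ 13 ≤ # V S → StableIn S (u ^ 7) ⊎ (∃ λ S′ → S′ ⊑ S × # V S ≤ # V S′ + u ^ 7 * (4 * u ^ 6) × (∀ v → S′ v ≡ true → 4 * u ^ 6 ≤ # V (nbr S′ v))) → ⊥
    cases large (inj₁ (J , J⊑ , stable , h)) = <⇒≱ (small-stable J J⊑ stable) h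
    cases large (inj₂ (S′ , ⊑S , size , degree)) = contradictory u (4 * u ^ 11) excluded≤ enough balance
      where
      open Neighbourhoods S′ (u ^ 7) (4 * u ^ 6) (u ^ 5)
        (λ a b c ha hb hc → triangle-free a b c (⊑S a ha) (⊑S b hb) (⊑S c hc))
        (λ x₁ x₂ x₃ y₁ y₂ y₃ h₁ h₂ h₃ k₁ k₂ k₃ → hexagon-free x₁ x₂ x₃ y₁ y₂ y₃ (⊑S x₁ h₁) (⊑S x₂ h₂) (⊑S x₃ h₃) (⊑S y₁ k₁) (⊑S y₂ k₂) (⊑S y₃ k₃))
        (λ J J⊑ → small-stable J (λ i → ⊑S i ∘ J⊑ i)) degree
      pow : ∀ a b → u ^ a * u ^ b ≡ u ^ (a + b)
      pow a b = sym (^-distribˡ-+-* u a b)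
      up : ∀ {a b} → a ≤ b → u ^ a ≤ u ^ b
      up h = ^-monoʳ-≤ u h
      size₁₃ : 4 * u ^ 13 ≤ # V S′
      size₁₃ = +-cancelʳ-≤ (4 * u ^ 13) _ _ (begin
        4 * u ^ 13 + 4 * u ^ 13  ≡⟨ *-distribʳ-+ (u ^ 13) 4 4 ⟨
        8 * u ^ 13  ≤⟨ large ⟩
        # V S  ≤⟨ size ⟩
        # V S′ + u ^ 7 * (4 * u ^ 6)    ≡⟨ cong (# V S′ +_) (trans (swap (u ^ 7) (u ^ 6)) (cong (4 *_) (pow 7 6))) ⟩
        # V S′ + 4 * u ^ 13 ∎)
        where
        swap : ∀ a b → a * (4 * b) ≡ 4 * (a * b)
        swap = solve-∀
      enough : u * (4 * u ^ 11) ≤ # V S′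
      enough = begin
        u * (4 * u ^ 11)     ≡⟨ swap u (u ^ 11) ⟩
        4 * u ^ 12  ≤⟨ *-monoʳ-≤ 4 (up (n≤1+n 12)) ⟩
        4 * u ^ 13  ≤⟨ size₁₃ ⟩
        # V S′ ∎
        where
        swap : ∀ a b → a * (4 * b) ≡ 4 * (a * b)
        swap = solve-∀
      balance : u ^ 7 + u * (u * (3 * u ^ 5)) ≤ u * (4 * u ^ 6)
      balance = ≤-reflexive (e u (u ^ 5))
        where
        e : ∀ u w → u * (u * w) + u * (u * (3 * w)) ≡ u * (4 * (u * w))
        e = solve-∀
      excluded≤ : ∀ β γ → β * u ^ 5 ≤ u ^ 7 * u ^ 7 → γ * u ^ 5 ≤ u ^ 7 * β → 1 + (u ^ 7 + (β + γ)) ≤ 4 * u ^ 11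
      excluded≤ β γ hβ hγ = begin
        1 + (u ^ 7 + (β + γ))  ≤⟨ +-mono-≤ (up {0} {11} z≤n) (+-mono-≤ (up {7} {11} (≤ᵇ⇒≤ 7 11 tt)) (+-mono-≤ (≤-trans β≤ (up {9} {11} (≤ᵇ⇒≤ 9 11 tt))) γ≤)) ⟩
        u ^ 11 + (u ^ 11 + (u ^ 11 + u ^ 11))  ≡⟨ e (u ^ 11) ⟩
        4 * u ^ 11 ∎
        where
        e : ∀ w → w + (w + (w + w)) ≡ 4 * w
        e = solve-∀
        β≤ : β ≤ u ^ 9
        β≤ = *-cancelʳ-≤ β (u ^ 9) (u ^ 5) {{m^n≢0 u 5}} (≤-trans hβ (≤-reflexive (trans (pow 7 7) (sym (pow 9 5)))))
        γ≤ : γ ≤ u ^ 11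
        γ≤ = *-cancelʳ-≤ γ (u ^ 11) (u ^ 5) {{m^n≢0 u 5}} (≤-trans hγ (≤-trans (*-monoʳ-≤ (u ^ 7) β≤) (≤-reflexive (trans (pow 7 9) (sym (pow 11 5))))))

module RedGraph {N : ℕ} (c : Coloring N) where

  red : Fin N → Fin N → Bool
  red i j = not (does (i Fin.≟ j)) ∧ not (col c i j)

  red-sym : ∀ i j → red i j ≡ red j i
  red-sym i j = cong₂ (λ a b → not a ∧ not b) ≟-sym (col-sym c i j)
    where
    ≟-sym : does (i Fin.≟ j) ≡ does (j Fin.≟ i)
    ≟-sym with i Fin.≟ j | j Fin.≟ i
    ... | yes _ | yes _ = refl
    ... | no _ | no _ = refl
    ... | yes p | no q = contradiction (sym p) q
    ... | no p | yes q = contradiction (sym q) p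

  red-irrefl : ∀ i → red i i ≡ false
  red-irrefl i rewrite ⇒does (i Fin.≟ i) refl = refl

  open Graph N red red-sym red-irrefl
  open Bound red red-sym red-irrefl

  red⇒≢ : ∀ {i j} → red i j ≡ true → i ≢ j
  red⇒≢ {i} h refl = true≢false h (red-irrefl i)

  red⇒¬Blue : ∀ {i j} → red i j ≡ true → ¬ Blue c i j
  red⇒¬Blue h (_ , b) = true≢false b (not-⁻ (proj₂ (∧-⁻ h)))

  ¬red⇒Blue : ∀ {i j} → i ≢ j → red i j ≡ false → Blue c i j
  ¬red⇒Blue {i} {j} i≢j h with i Fin.≟ j | col c i j
  ... | yes p | _ = contradiction p i≢j
  ... | no _ | true = i≢j , refl
  ... | no _ | false = true≢false refl h

  Red⇒red : ∀ {i j} → Red c i j → red i j ≡ true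
  Red⇒red {i} {j} (i≢j , h) rewrite h with i Fin.≟ j
  ... | yes p = contradiction p i≢j
  ... | no _ = refl

  module _ (n : ℕ) (no-blue-clique : ¬ HasSet N n (Independent (Red c))) where

    small-stable : ∀ J → Stable J → # V J < n
    small-stable J stable = ≰⇒> λ h → let (f , inj , hJ) = choose n J h in
      no-blue-clique (f , inj , λ { _ _ (k , refl) (l , refl) r → true≢false (Red⇒red r) (stable (f k) (f l) (hJ k) (hJ l)) })

    vertex-of-degree : ∀ D S → n * D < # V S → ∃ λ v → S v ≡ true × ∃ λ S′ → S′ ⊑ S × D ≤ # V (nbr S′ v)
    vertex-of-degree D S h = cases (min-degree D n S)
      where
      cases : StableIn S n ⊎ (∃ λ S′ → S′ ⊑ S × # V S ≤ # V S′ + n * D × (∀ v → S′ v ≡ true → D ≤ # V (nbr S′ v))) →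
        ∃ λ v → S v ≡ true × ∃ λ S′ → S′ ⊑ S × D ≤ # V (nbr S′ v)
      cases (inj₁ (J , _ , stable , hJ)) = contradiction hJ (<⇒≱ (small-stable J stable))
      cases (inj₂ (S′ , S′⊑ , size , degree)) =
        let (v , _ , hv) = #-witness V S′ (+-cancelʳ-≤ (n * D) 1 (# V S′) (≤-trans h size)) in v , S′⊑ v hv , S′ , S′⊑ , degree v hv

  four : Fin N → Fin N → Fin N → Fin N → Fin 4 → Fin N
  four a b c d = Vec.lookup (a ∷ b ∷ c ∷ d ∷ [])

  four-injective : ∀ {a b c d} → a ≢ b → a ≢ c → a ≢ d → b ≢ c → b ≢ d → c ≢ d → Injective _≡_ _≡_ (four a b c d)
  four-injective ab ac ad bc bd cd {zero} {zero} e = refl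
  four-injective ab ac ad bc bd cd {zero} {suc zero} e = contradiction e ab
  four-injective ab ac ad bc bd cd {zero} {suc (suc zero)} e = contradiction e ac
  four-injective ab ac ad bc bd cd {zero} {suc (suc (suc zero))} e = contradiction e ad
  four-injective ab ac ad bc bd cd {suc zero} {zero} e = contradiction (sym e) ab
  four-injective ab ac ad bc bd cd {suc zero} {suc zero} e = refl
  four-injective ab ac ad bc bd cd {suc zero} {suc (suc zero)} e = contradiction e bc
  four-injective ab ac ad bc bd cd {suc zero} {suc (suc (suc zero))} e = contradiction e bd
  four-injective ab ac ad bc bd cd {suc (suc zero)} {zero} e = contradiction (sym e) ac
  four-injective ab ac ad bc bd cd {suc (suc zero)} {suc zero} e = contradiction (sym e) bc
  four-injective ab ac ad bc bd cd {suc (suc zero)} {suc (suc zero)} e = refl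
  four-injective ab ac ad bc bd cd {suc (suc zero)} {suc (suc (suc zero))} e = contradiction e cd
  four-injective ab ac ad bc bd cd {suc (suc (suc zero))} {zero} e = contradiction (sym e) ad
  four-injective ab ac ad bc bd cd {suc (suc (suc zero))} {suc zero} e = contradiction (sym e) bd
  four-injective ab ac ad bc bd cd {suc (suc (suc zero))} {suc (suc zero)} e = contradiction (sym e) cd
  four-injective ab ac ad bc bd cd {suc (suc (suc zero))} {suc (suc (suc zero))} e = refl

  four-Img : ∀ {a b c d v} → Img (four a b c d) v → v ≡ a ⊎ v ≡ b ⊎ v ≡ c ⊎ v ≡ d
  four-Img (zero , e) = inj₁ (sym e)
  four-Img (suc zero , e) = inj₂ (inj₁ (sym e))
  four-Img (suc (suc zero) , e) = inj₂ (inj₂ (inj₁ (sym e)))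
  four-Img (suc (suc (suc zero)) , e) = inj₂ (inj₂ (inj₂ (sym e)))

  red-K₄ : ∀ {a b c′ d} → red a b ≡ true → red a c′ ≡ true → red a d ≡ true → red b c′ ≡ true → red b d ≡ true → red c′ d ≡ true →
    HasSet N 4 (Independent (Blue c))
  red-K₄ {a} {b} {c′} {d} ab ac ad bc bd cd =
    four a b c′ d , four-injective (red⇒≢ ab) (red⇒≢ ac) (red⇒≢ ad) (red⇒≢ bc) (red⇒≢ bd) (red⇒≢ cd) , λ { _ _ (i , refl) (j , refl) → independent i j }
    where
    back : ∀ {i j} → red i j ≡ true → ¬ Blue c j i
    back {i} {j} h = red⇒¬Blue (trans (red-sym j i) h)
    independent : ∀ i j → ¬ Blue c (four a b c′ d i) (four a b c′ d j)
    independent zero zero (ne , _) = ne refl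
    independent zero (suc zero) = red⇒¬Blue ab
    independent zero (suc (suc zero)) = red⇒¬Blue ac
    independent zero (suc (suc (suc zero))) = red⇒¬Blue ad
    independent (suc zero) zero = back ab
    independent (suc zero) (suc zero) (ne , _) = ne refl
    independent (suc zero) (suc (suc zero)) = red⇒¬Blue bc
    independent (suc zero) (suc (suc (suc zero))) = red⇒¬Blue bd
    independent (suc (suc zero)) zero = back ac
    independent (suc (suc zero)) (suc zero) = back bc
    independent (suc (suc zero)) (suc (suc zero)) (ne , _) = ne refl
    independent (suc (suc zero)) (suc (suc (suc zero))) = red⇒¬Blue cd
    independent (suc (suc (suc zero))) zero = back ad
    independent (suc (suc (suc zero))) (suc zero) = back bd
    independent (suc (suc (suc zero))) (suc (suc zero)) = back cd
    independent (suc (suc (suc zero))) (suc (suc (suc zero))) (ne , _) = ne refl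

  independent⇒irredundant : HasSet N 4 (Independent (Blue c)) → HasSet N 4 (Irredundant (Blue c))
  independent⇒irredundant (f , inj , ind) = f , inj , λ x hx → inj₁ λ y hy → ind x y hx hy

  -- The vertex v is isolated in blue, and each yᵢ is a private neighbour of xᵢ.
  coned-hexagon : ∀ {v x₁ x₂ x₃ y₁ y₂ y₃} →
    (∀ {a b c} → red v a ≡ true → red v b ≡ true → red v c ≡ true → red a b ≡ true → red b c ≡ true → red a c ≡ true → ⊥) →
    red v x₁ ≡ true → red v x₂ ≡ true → red v x₃ ≡ true → red v y₁ ≡ true → red v y₂ ≡ true → red v y₃ ≡ true →
    red x₁ y₂ ≡ true → red x₁ y₃ ≡ true → red x₂ y₁ ≡ true → red x₂ y₃ ≡ true → red x₃ y₁ ≡ true → red x₃ y₂ ≡ true →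
    red x₁ y₁ ≡ false → red x₂ y₂ ≡ false → red x₃ y₃ ≡ false → HasSet N 4 (Irredundant (Blue c))
  coned-hexagon {v} {x₁} {x₂} {x₃} {y₁} {y₂} {y₃} triangle-free vx₁ vx₂ vx₃ vy₁ vy₂ vy₃ x₁y₂ x₁y₃ x₂y₁ x₂y₃ x₃y₁ x₃y₂ d₁ d₂ d₃ =
    four v x₁ x₂ x₃ , four-injective (red⇒≢ vx₁) (red⇒≢ vx₂) (red⇒≢ vx₃)
      (λ { refl → true≢false x₂y₁ d₁ }) (λ { refl → true≢false x₃y₁ d₁ }) (λ { refl → true≢false x₃y₂ d₂ }) , irredundant
    where
    xs = four v x₁ x₂ x₃
    -- A missing red edge does not by itself exclude equality; a coincidence would close a triangle
    -- in the red neighbourhood of `v`.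
    x₁≢y₁ : x₁ ≢ y₁
    x₁≢y₁ refl = triangle-free vx₂ vx₁ vy₃ x₂y₁ x₁y₃ x₂y₃
    x₂≢y₂ : x₂ ≢ y₂
    x₂≢y₂ refl = triangle-free vx₁ vx₂ vy₃ x₁y₂ x₂y₃ x₁y₃
    x₃≢y₃ : x₃ ≢ y₃
    x₃≢y₃ refl = triangle-free vx₁ vx₃ vy₂ x₁y₃ x₃y₂ x₁y₂
    private-neighbour : ∀ x y → x ≢ y → red x y ≡ false → red v y ≡ true →
      (∀ z → Img xs z → z ≢ x → red z y ≡ true) → Σ (Fin N) λ y → ¬ Img xs y × Blue c x y × (∀ z → Img xs z → Blue c z y → z ≡ x)
    private-neighbour x y x≢y d vy others = y , outside , ¬red⇒Blue x≢y d , unique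
      where
      outside : ¬ Img xs y
      outside h = true≢false (others y h (x≢y ∘ sym)) (red-irrefl y)
      unique : ∀ z → Img xs z → Blue c z y → z ≡ x
      unique z hz b with z Fin.≟ x
      ... | yes e = e
      ... | no ne = contradiction b (red⇒¬Blue (others z hz ne))
    irredundant : Irredundant (Blue c) (Img xs)
    irredundant x hx with four-Img hx
    ... | inj₁ refl = inj₁ λ y hy b → Data.Sum.[ (λ { refl → proj₁ b refl }) , Data.Sum.[ (λ { refl → red⇒¬Blue vx₁ b }) ,
            Data.Sum.[ (λ { refl → red⇒¬Blue vx₂ b }) , (λ { refl → red⇒¬Blue vx₃ b }) ] ] ] (four-Img hy)
    ... | inj₂ (inj₁ refl) = inj₂ (private-neighbour x₁ y₁ x₁≢y₁ d₁ vy₁ λ z hz ne →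
            Data.Sum.[ (λ { refl → vy₁ }) , Data.Sum.[ (λ e → contradiction e ne) , Data.Sum.[ (λ { refl → x₂y₁ }) , (λ { refl → x₃y₁ }) ] ] ] (four-Img hz))
    ... | inj₂ (inj₂ (inj₁ refl)) = inj₂ (private-neighbour x₂ y₂ x₂≢y₂ d₂ vy₂ λ z hz ne →
            Data.Sum.[ (λ { refl → vy₂ }) , Data.Sum.[ (λ { refl → x₁y₂ }) , Data.Sum.[ (λ e → contradiction e ne) , (λ { refl → x₃y₂ }) ] ] ] (four-Img hz))
    ... | inj₂ (inj₂ (inj₂ refl)) = inj₂ (private-neighbour x₃ y₃ x₃≢y₃ d₃ vy₃ λ z hz ne →
            Data.Sum.[ (λ { refl → vy₃ }) , Data.Sum.[ (λ { refl → x₁y₃ }) , Data.Sum.[ (λ { refl → x₂y₃ }) , (λ e → contradiction e ne) ] ] ] (four-Img hz))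

  everything : Subset
  everything _ = true

  #-everything : # V everything ≡ N
  #-everything = trans (∑-const V 1) (trans (*-identityʳ _) (Listₚ.length-tabulate id))

  irredundant-or-clique : ∀ u → 1 ≤ u → u ^ 7 * (8 * u ^ 13) < N →
    ¬ HasSet N 4 (Irredundant (Blue c)) → ¬ HasSet N (u ^ 7) (Independent (Red c)) → ⊥
  irredundant-or-clique u 1≤u hN no-irr no-clique =
    let (v , _ , S′ , _ , degree) = vertex-of-degree (u ^ 7) no-clique (8 * u ^ 13) everything (subst (u ^ 7 * (8 * u ^ 13) <_) (sym #-everything) hN)
        triangle-free : ∀ {a b d} → red v a ≡ true → red v b ≡ true → red v d ≡ true → red a b ≡ true → red b d ≡ true → red a d ≡ true → ⊥
        triangle-free va vb vd ab bd ad = no-irr (independent⇒irredundant (red-K₄ va vb vd ab ad bd))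
        at : ∀ {x} → nbr S′ v x ≡ true → red v x ≡ true
        at {x} h = proj₂ (∧-⁻ {S′ x} h)
    in <⇒≱ (third u (nbr S′ v) 1≤u
        (λ a b d ha hb hd → triangle-free (at ha) (at hb) (at hd))
        (λ x₁ x₂ x₃ y₁ y₂ y₃ h₁ h₂ h₃ k₁ k₂ k₃ a b d e f g p q r →
          no-irr (coned-hexagon triangle-free (at h₁) (at h₂) (at h₃) (at k₁) (at k₂) (at k₃) a b d e f g p q r))
        (λ J _ → small-stable (u ^ 7) no-clique J)) degree

  -- A crude Erdős-Szekeres bound; its purpose is that the Ramsey number `R` exists.
  clique-or-clique : ∀ n → n * suc (n * n) < N → ¬ HasSet N 4 (Independent (Blue c)) → ¬ HasSet N n (Independent (Red c)) → ⊥
  clique-or-clique n hN no-red no-blue =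
    let (v , _ , S′ , _ , degree) = vertex-of-degree n no-blue (suc (n * n)) everything (subst (n * suc (n * n) <_) (sym #-everything) hN)
        (w , hw , S″ , S″⊑ , degree′) = vertex-of-degree n no-blue n (nbr S′ v) degree
    in <⇒≱ (small-stable n no-blue (nbr S″ w) λ i j hi hj → ≢true λ e →
        let (si , wi) = ∧-⁻ {S″ i} hi ; (sj , wj) = ∧-⁻ {S″ j} hj in
        no-red (red-K₄ (proj₂ (∧-⁻ {S′ w} hw)) (proj₂ (∧-⁻ {S′ i} (S″⊑ i si))) (proj₂ (∧-⁻ {S′ j} (S″⊑ j sj))) wi wj e)) degree′

-- Decidability and monotonicity of the Ramsey properties

Searchable : Set → Set₁
Searchable A = ∀ {P : A → Set} → (∀ a → Dec (P a)) → Dec (∃ P)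

search-Bool : Searchable Bool
search-Bool {P} P? with P? true | P? false
... | yes p | _ = yes (true , p)
... | no _ | yes q = yes (false , q)
... | no ¬p | no ¬q = no λ { (true , p) → ¬p p ; (false , q) → ¬q q }

search-Vec : ∀ {A} → Searchable A → ∀ n → Searchable (Vec A n)
search-Vec s zero P? = map′ (λ p → [] , p) (λ { ([] , p) → p }) (P? [])
search-Vec s (suc n) P? = map′ (λ (a , v , p) → a ∷ v , p) (λ { (a ∷ v , p) → a , v , p })
  (s (λ a → search-Vec s n (λ v → P? (a ∷ v))))

-- Injections are searched as vectors. A function and its tabulation agree only pointwise, so `P`
-- must respect extensional equality of the images.
HasSet? : ∀ N m {P : (Fin N → Set) → Set} → (∀ {X Y} → (∀ v → X v → Y v) → (∀ v → Y v → X v) → P X → P Y) →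
  (∀ (f : Fin m → Fin N) → Dec (P (Img f))) → Dec (HasSet N m P)
HasSet? N m {P} resp P? = map′ (λ (v , h) → Vec.lookup v , h)
  (λ (f , inj , h) → Vec.tabulate f ,
    (λ {i} {j} e → inj (trans (sym (Vecₚ.lookup∘tabulate f i)) (trans e (Vecₚ.lookup∘tabulate f j)))) ,
    resp (λ v (i , e) → i , trans (Vecₚ.lookup∘tabulate f i) e) (λ v (i , e) → i , trans (sym (Vecₚ.lookup∘tabulate f i)) e) h)
  (search-Vec Fin.any? m (λ v → injective? (Vec.lookup v) ×-dec P? (Vec.lookup v)))
  where
  injective? : ∀ (f : Fin m → Fin N) → Dec (Injective _≡_ _≡_ f)
  injective? f = map′ (λ h {i} {j} → h i j) (λ h i j → h) (Fin.all? λ i → Fin.all? λ j → (f i Fin.≟ f j) →-dec (i Fin.≟ j))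

module _ {N : ℕ} (G : Fin N → Fin N → Set) (G? : ∀ i j → Dec (G i j)) where

  Img? : ∀ {m} (f : Fin m → Fin N) v → Dec (Img f v)
  Img? f v = Fin.any? λ i → f i Fin.≟ v

  hasIndependent? : ∀ m → Dec (HasSet N m (Independent G))
  hasIndependent? m = HasSet? N m {Independent G} (λ f g h x y hx hy → h x y (g x hx) (g y hy))
    λ f → Fin.all? λ x → Fin.all? λ y → Img? f x →-dec (Img? f y →-dec ¬? (G? x y))

  hasIrredundant? : ∀ m → Dec (HasSet N m (Irredundant G))
  hasIrredundant? m = HasSet? N m {Irredundant G} transfer
    λ f → Fin.all? λ x → Img? f x →-dec
      ((Fin.all? λ y → Img? f y →-dec ¬? (G? x y)) ⊎-dec
       (Fin.any? λ y → ¬? (Img? f y) ×-dec (G? x y ×-dec (Fin.all? λ z → Img? f z →-dec (G? z y →-dec (z Fin.≟ x))))))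
    where
    transfer : ∀ {X Y : Fin N → Set} → (∀ v → X v → Y v) → (∀ v → Y v → X v) → Irredundant G X → Irredundant G Y
    transfer f g h x hx with h x (g x hx)
    ... | inj₁ isolated = inj₁ λ y hy → isolated y (g y hy)
    ... | inj₂ (y , outside , e , unique) = inj₂ (y , (λ hy → outside (g y hy)) , e , λ z hz → unique z (g z hz))

Blue? : ∀ {N} (c : Coloring N) i j → Dec (Blue c i j)
Blue? c i j = ¬? (i Fin.≟ j) ×-dec (col c i j Data.Bool.≟ true)

Red? : ∀ {N} (c : Coloring N) i j → Dec (Red c i j)
Red? c i j = ¬? (i Fin.≟ j) ×-dec (col c i j Data.Bool.≟ false)

_≃_ : ∀ {N} → Coloring N → Coloring N → Set
c ≃ c′ = ∀ i j → col c i j ≡ col c′ i j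

≃-sym : ∀ {N} {c c′ : Coloring N} → c ≃ c′ → c′ ≃ c
≃-sym h i j = sym (h i j)

module _ {N : ℕ} {c c′ : Coloring N} (eq : c ≃ c′) where

  Blue-≃ : ∀ {i j} → Blue c i j → Blue c′ i j
  Blue-≃ {i} {j} (ne , h) = ne , trans (sym (eq i j)) h

  Red-≃ : ∀ {i j} → Red c i j → Red c′ i j
  Red-≃ {i} {j} (ne , h) = ne , trans (sym (eq i j)) h

-- Up to `≃` a coloring is one of finitely many symmetric Boolean matrices, among which a
-- counterexample is searched. The constructive existence of the least numbers T and R rests on
-- this.
every-coloring? : ∀ N {Q : Coloring N → Set} → (∀ {c c′} → c ≃ c′ → Q c → Q c′) → (∀ c → Dec (Q c)) → Dec (∀ c → Q c)
every-coloring? N {Q} resp Q? = decide (search-Vec (search-Vec search-Bool N) N (λ m → counterexample? m))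
  where
  Matrix = Vec (Vec Bool N) N
  entry : Matrix → Fin N → Fin N → Bool
  entry m i j = Vec.lookup (Vec.lookup m i) j
  Symmetric : Matrix → Set
  Symmetric m = ∀ i j → entry m i j ≡ entry m j i
  coloring : ∀ m → Symmetric m → Coloring N
  coloring m s = record { col = entry m ; col-sym = s }
  Counterexample : Matrix → Set
  Counterexample m = Σ (Symmetric m) λ s → ¬ Q (coloring m s)
  counterexample? : ∀ m → Dec (Counterexample m)
  counterexample? m with Fin.all? (λ i → Fin.all? λ j → entry m i j Data.Bool.≟ entry m j i)
  ... | no ¬s = no λ (s , _) → ¬s s
  ... | yes s with Q? (coloring m s)
  ... | yes q = no λ (s′ , ¬q) → ¬q (resp (λ _ _ → refl) q)
  ... | no ¬q = yes (s , ¬q)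
  matrix : Coloring N → Matrix
  matrix c = Vec.tabulate λ i → Vec.tabulate (col c i)
  entry-matrix : ∀ c i j → entry (matrix c) i j ≡ col c i j
  entry-matrix c i j = trans (cong (λ v → Vec.lookup v j) (Vecₚ.lookup∘tabulate _ i)) (Vecₚ.lookup∘tabulate (col c i) j)
  decide : Dec (∃ Counterexample) → Dec (∀ c → Q c)
  decide (yes (m , s , ¬q)) = no λ h → ¬q (h (coloring m s))
  decide (no none) = yes λ c → holds c (Q? c)
    where
    holds : ∀ c → Dec (Q c) → Q c
    holds c (yes q) = q
    holds c (no ¬q) = contradiction
      (matrix c , (λ i j → trans (entry-matrix c i j) (trans (col-sym c i j) (sym (entry-matrix c j i)))) , λ q → ¬q (resp (entry-matrix c) q)) none

Independent-mono : ∀ {N} {G H : Fin N → Fin N → Set} {X} → (∀ {i j} → H i j → G i j) → Independent G X → Independent H X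
Independent-mono f h x y hx hy e = h x y hx hy (f e)

Irredundant-resp : ∀ {N} {G H : Fin N → Fin N → Set} {X} → (∀ {i j} → G i j → H i j) → (∀ {i j} → H i j → G i j) → Irredundant G X → Irredundant H X
Irredundant-resp f g h x hx with h x hx
... | inj₁ isolated = inj₁ λ y hy e → isolated y hy (g e)
... | inj₂ (y , outside , e , unique) = inj₂ (y , outside , f e , λ z hz k → unique z hz (g k))

TProp? : ∀ m n N → Dec (TProp m n N)
TProp? m n N = every-coloring? N
  (λ {c} {c′} eq → λ { (inj₁ (f , inj , h)) → inj₁ (f , inj , Irredundant-resp (Blue-≃ {c = c} {c′} eq) (Blue-≃ {c = c′} {c} (≃-sym {c = c} {c′} eq)) h)
            ; (inj₂ (f , inj , h)) → inj₂ (f , inj , Independent-mono (Red-≃ {c = c′} {c} (≃-sym {c = c} {c′} eq)) h) })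
  λ c → hasIrredundant? (Blue c) (Blue? c) m ⊎-dec hasIndependent? (Red c) (Red? c) n

RProp? : ∀ m n N → Dec (RProp m n N)
RProp? m n N = every-coloring? N
  (λ {c} {c′} eq → λ { (inj₁ (f , inj , h)) → inj₁ (f , inj , Independent-mono (Blue-≃ {c = c′} {c} (≃-sym {c = c} {c′} eq)) h)
            ; (inj₂ (f , inj , h)) → inj₂ (f , inj , Independent-mono (Red-≃ {c = c′} {c} (≃-sym {c = c} {c′} eq)) h) })
  λ c → hasIndependent? (Blue c) (Blue? c) m ⊎-dec hasIndependent? (Red c) (Red? c) n

least : ∀ {P : ℕ → Set} → (∀ n → Dec (P n)) → ∀ N → P N → ∃ λ T → IsLeast P T × T ≤ N
least {P} P? N hN = go N 0 (+-identityʳ N) (λ _ ())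
  where
  go : ∀ k n → k + n ≡ N → (∀ M → M < n → ¬ P M) → ∃ λ T → IsLeast P T × T ≤ N
  go k n e below with P? n
  ... | yes p = n , (p , below) , ≤-trans (m≤n+m n k) (≤-reflexive e)
  go zero n refl below | no ¬p = contradiction hN ¬p
  go (suc k) n e below | no ¬p = go k (suc n) (trans (+-suc k n) e) λ M M≤n → Data.Sum.[ below M , (λ { refl → ¬p }) ] (m≤n⇒m<n∨m≡n (s≤s⁻¹ M≤n))

HasSet-Independent-≤ : ∀ {N m n} {G : Fin N → Fin N → Set} → m ≤ n → HasSet N n (Independent G) → HasSet N m (Independent G)
HasSet-Independent-≤ m≤n (f , inj , h) = (λ i → f (Data.Fin.inject≤ i m≤n)) , (λ e → Fin.inject≤-injective m≤n m≤n _ _ (inj e)) ,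
  λ x y (i , p) (j , q) → h x y (_ , p) (_ , q)

TProp-antitone : ∀ {m n n′ N} → n′ ≤ n → TProp m n N → TProp m n′ N
TProp-antitone n′≤n h c = Data.Sum.map₂ (HasSet-Independent-≤ n′≤n) (h c)

RProp-antitone : ∀ {m n n′ N} → n′ ≤ n → RProp m n N → RProp m n′ N
RProp-antitone n′≤n h c = Data.Sum.map₂ (HasSet-Independent-≤ n′≤n) (h c)

RProp-monotone : ∀ {m n N N′} → N ≤ N′ → RProp m n N → RProp m n N′
RProp-monotone {N = N} {N′} N≤N′ h c = Data.Sum.map
    (λ (f , inj , k) → ι ∘ f , inj ∘ ι-injective , λ { _ _ (i , refl) (j , refl) (ne , e) → k (f i) (f j) (i , refl) (j , refl) (ne ∘ cong ι , e) })
    (λ (f , inj , k) → ι ∘ f , inj ∘ ι-injective , λ { _ _ (i , refl) (j , refl) (ne , e) → k (f i) (f j) (i , refl) (j , refl) (ne ∘ cong ι , e) })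
    (h restricted)
  where
  ι : Fin N → Fin N′
  ι i = Data.Fin.inject≤ i N≤N′
  ι-injective : Injective _≡_ _≡_ ι
  ι-injective = Fin.inject≤-injective N≤N′ N≤N′ _ _
  restricted : Coloring N
  restricted = record { col = λ i j → col c (ι i) (ι j) ; col-sym = λ i j → col-sym c (ι i) (ι j) }

TProp-power : ∀ u N → 1 ≤ u → u ^ 7 * (8 * u ^ 13) < N → TProp 4 (u ^ 7) N
TProp-power u N 1≤u hN c with hasIrredundant? (Blue c) (Blue? c) 4 | hasIndependent? (Red c) (Red? c) (u ^ 7)
... | yes h | _ = inj₁ h
... | no _ | yes h = inj₂ h
... | no ¬irr | no ¬clique = ⊥-elim (RedGraph.irredundant-or-clique c u 1≤u hN ¬irr ¬clique)

RProp-cubic : ∀ n N → n * suc (n * n) < N → RProp 4 n N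
RProp-cubic n N hN c with hasIndependent? (Blue c) (Blue? c) 4 | hasIndependent? (Red c) (Red? c) n
... | yes h | _ = inj₁ h
... | no _ | yes h = inj₂ h
... | no ¬red | no ¬blue = ⊥-elim (RedGraph.clique-or-clique c n hN ¬red ¬blue)

-- Chebyshev's bound

absorption : ∀ n k → suc k * (suc n C suc k) ≡ suc n * (n C k)
absorption zero zero = refl
absorption zero (suc k) rewrite k>n⇒nCk≡0 {1} {2 + k} (s≤s (s≤s z≤n)) | k>n⇒nCk≡0 {0} {suc k} (s≤s z≤n) = *-zeroʳ (2 + k)
absorption (suc n) zero = begin
  1 * (suc (suc n) C 1)  ≡⟨ cong (1 *_) (nCk+nC[k+1]≡[n+1]C[k+1] (suc n) 0) ⟨
  1 * (suc n C 0 + suc n C 1)  ≡⟨ cong (λ c → 1 * (c + suc n C 1)) (nC0≡1 (suc n)) ⟩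
  1 * (1 + suc n C 1)  ≡⟨ e (suc n C 1) ⟩
  1 + 1 * (suc n C 1)  ≡⟨ cong suc (absorption n 0) ⟩
  1 + suc n * (n C 0)  ≡⟨ cong (λ c → 1 + suc n * c) (trans (nC0≡1 n) (sym (nC0≡1 (suc n)))) ⟩
  1 + suc n * (suc n C 0)  ≡⟨ cong (_+ suc n * (suc n C 0)) (sym (nC0≡1 (suc n))) ⟩
  suc (suc n) * (suc n C 0) ∎
  where
  open ≡-Reasoning
  e : ∀ x → 1 * (1 + x) ≡ 1 + 1 * x
  e = solve-∀
absorption (suc n) (suc k) = begin
  suc (suc k) * (suc (suc n) C suc (suc k))  ≡⟨ cong (suc (suc k) *_) (nCk+nC[k+1]≡[n+1]C[k+1] (suc n) (suc k)) ⟨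
  suc (suc k) * (x + y)  ≡⟨ e k x y ⟩
  x + (suc k * x + suc (suc k) * y)  ≡⟨ cong (x +_) (cong₂ _+_ (absorption n k) (absorption n (suc k))) ⟩
  x + (suc n * (n C k) + suc n * (n C suc k))  ≡⟨ cong (x +_) (*-distribˡ-+ (suc n) (n C k) (n C suc k)) ⟨
  x + suc n * (n C k + n C suc k)  ≡⟨ cong (λ c → x + suc n * c) (nCk+nC[k+1]≡[n+1]C[k+1] n k) ⟩
  suc (suc n) * (suc n C suc k) ∎
  where
  open ≡-Reasoning
  x = suc n C suc k
  y = suc n C suc (suc k)
  e : ∀ k x y → (2 + k) * (x + y) ≡ x + ((1 + k) * x + (2 + k) * y)
  e = solve-∀

succession : ∀ k e → suc k * ((suc (k + e)) C suc k) ≡ suc e * ((suc (k + e)) C k)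
succession k e = +-cancelˡ-≡ (suc k * (m C k)) _ _ (begin
  suc k * (m C k) + suc k * (m C suc k)  ≡⟨ *-distribˡ-+ (suc k) (m C k) (m C suc k) ⟨
  suc k * (m C k + m C suc k)  ≡⟨ cong (suc k *_) (nCk+nC[k+1]≡[n+1]C[k+1] m k) ⟩
  suc k * (suc m C suc k)  ≡⟨ absorption m k ⟩
  suc m * (m C k)  ≡⟨ r k e (m C k) ⟩
  suc k * (m C k) + suc e * (m C k) ∎)
  where
  open ≡-Reasoning
  m = suc (k + e)
  r : ∀ k e c → (2 + (k + e)) * c ≡ (1 + k) * c + (1 + e) * c
  r = solve-∀

-- Nair: the reciprocals of (m + 1) C(m , k) satisfy the recurrence of the Leibniz triangle.
leibniz : ∀ D k e → (∀ i → 1 ≤ i → i ≤ suc (k + e) → i ∣ D) → suc (k + e) * ((k + e) C k) ∣ D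
leibniz D zero e h = subst (_∣ D) (sym (trans (cong (suc e *_) (nC0≡1 e)) (*-identityʳ (suc e)))) (h (suc e) (s≤s z≤n) ≤-refl)
leibniz D (suc k) e h with leibniz D k e (λ i l u → h i l (≤-trans u (n≤1+n _))) | leibniz D k (suc e) (λ i l u → h i l (≤-trans u (≤-reflexive (cong suc (+-suc k e)))))
-- In the Leibniz triangle the new reciprocal is the difference of two known ones: `D` divided by
-- `t` is A - B, stated additively in `key`.
... | divides A hA | divides B hB′ = ∣m+n∣m⇒∣n (subst (t ∣_) (trans key (+-comm D (B * t))) (n∣m*n A)) (n∣m*n B)
  where
  open ≡-Reasoning
  m = suc (k + e)
  t = suc m * (m C suc k)
  hB : D ≡ B * (suc m * (m C k))
  hB = trans hB′ (cong (λ n → B * (suc n * (n C k))) (+-suc k e))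
  key : A * t ≡ D + B * t
  key = *-cancelˡ-≡ (A * t) (D + B * t) (suc k) (begin
    suc k * (A * t)  ≡⟨ e₁ (suc k) A (suc m) (m C suc k) ⟩
    suc m * (A * (suc k * (m C suc k)))  ≡⟨ cong (λ c → suc m * (A * c)) (absorption (k + e) k) ⟩
    suc m * (A * (m * ((k + e) C k)))  ≡⟨ cong (suc m *_) hA ⟨
    suc m * D  ≡⟨ e₂ k e D ⟩
    suc k * D + suc e * D  ≡⟨ cong (λ d → suc k * D + suc e * d) hB ⟩
    suc k * D + suc e * (B * (suc m * (m C k)))    ≡⟨ cong (suc k * D +_) (e₁′ (suc e) B (suc m) (m C k)) ⟩
    suc k * D + B * (suc m * (suc e * (m C k)))    ≡⟨ cong (λ c → suc k * D + B * (suc m * c)) (succession k e) ⟨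
    suc k * D + B * (suc m * (suc k * (m C suc k))) ≡⟨ e₃ (suc k) D B (suc m) (m C suc k) ⟩
    suc k * (D + B * t) ∎)
    where
    e₁ : ∀ k a m c → k * (a * (m * c)) ≡ m * (a * (k * c))
    e₁ = solve-∀
    e₁′ : ∀ e b m c → e * (b * (m * c)) ≡ b * (m * (e * c))
    e₁′ = solve-∀
    e₂ : ∀ k e d → (2 + (k + e)) * d ≡ (1 + k) * d + (1 + e) * d
    e₂ = solve-∀
    e₃ : ∀ k d b m c → k * d + b * (m * (k * c)) ≡ k * (d + b * (m * c))
    e₃ = solve-∀

central≥ : ∀ m → 2 ^ m ≤ (m + m) C m
central≥ zero = ≤-refl
central≥ (suc m) = begin
  2 * 2 ^ m  ≤⟨ *-monoʳ-≤ 2 (central≥ m) ⟩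
  2 * ((m + m) C m)  ≡⟨ cong ((m + m) C m +_) (+-identityʳ _) ⟩
  (m + m) C m + (m + m) C m  ≤⟨ +-mono-≤ (grow m) (≤-trans (m≤m+n _ _) (≤-reflexive (nCk+nC[k+1]≡[n+1]C[k+1] (m + m) m))) ⟩
  suc (m + m) C m + suc (m + m) C suc m  ≡⟨ nCk+nC[k+1]≡[n+1]C[k+1] (suc (m + m)) m ⟩
  suc (suc (m + m)) C suc m  ≡⟨ cong (λ n → suc n C suc m) (+-suc m m) ⟨
  (suc m + suc m) C suc m ∎
  where
  open ≤-Reasoning
  grow : ∀ k → (m + m) C k ≤ suc (m + m) C k
  grow zero = ≤-reflexive (trans (nC0≡1 (m + m)) (sym (nC0≡1 (suc (m + m)))))
  grow (suc k) = ≤-trans (m≤n+m _ ((m + m) C k)) (≤-reflexive (nCk+nC[k+1]≡[n+1]C[k+1] (m + m) k))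

common-multiple≥ : ∀ D m → 1 ≤ D → (∀ i → 1 ≤ i → i ≤ suc (m + m) → i ∣ D) → 2 ^ m ≤ D
common-multiple≥ D m 1≤D h = ≤-trans (≤-trans (central≥ m) (m≤m+n _ _)) (∣⇒≤ {{>-nonZero 1≤D}} (leibniz D m m h))

Smooth : ℕ → ℕ → Set
Smooth y i = ∀ p → Prime p → p ∣ i → p ≤ y

smooth-0 : ∀ i → 1 ≤ i → Smooth 0 i → i ≡ 1
smooth-0 i 1≤i h = go (factorise i {{>-nonZero 1≤i}})
  where
  go : PrimeFactorisation i → i ≡ 1
  go record { factors = [] ; isFactorisation = e } = e
  go record { factors = p ∷ ps ; isFactorisation = e ; factorsPrime = prime-p ∷ _ } =
    contradiction (h p prime-p (subst (p ∣_) (sym e) (m∣m*n _))) λ { z≤n → contradiction (prime⇒nonZero prime-p) λ () }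

split-power : ∀ p → Prime p → ∀ i → 1 ≤ i → ∃ λ b → ∃ λ i′ → i ≡ p ^ b * i′ × ¬ p ∣ i′
split-power p prime-p = <-rec _ step
  where
  step : ∀ i → (∀ {q} → q < i → 1 ≤ q → ∃ λ b → ∃ λ i′ → q ≡ p ^ b * i′ × ¬ p ∣ i′) → 1 ≤ i → ∃ λ b → ∃ λ i′ → i ≡ p ^ b * i′ × ¬ p ∣ i′
  step i rec 1≤i with p ∣? i
  ... | no p∤i = 0 , i , sym (+-identityʳ i) , p∤i
  ... | yes (divides zero e) = contradiction (subst (1 ≤_) e 1≤i) λ ()
  ... | yes (divides q@(suc _) e) with rec {q} (subst (q <_) (sym e) (m<m*n q p (nonTrivial⇒n>1 p {{prime⇒nonTrivial prime-p}}))) (s≤s z≤n)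
  ... | b , i′ , e′ , p∤i′ = suc b , i′ , trans e (trans (cong (_* p) e′) (r (p ^ b) i′ p)) , p∤i′
    where
    r : ∀ a i p → a * i * p ≡ p * a * i
    r = solve-∀

n<b^n : ∀ b n → 2 ≤ b → n < b ^ n
n<b^n b zero 2≤b = s≤s z≤n
n<b^n b (suc n) 2≤b = begin-strict
  suc n  ≤⟨ n<b^n b n 2≤b ⟩
  b ^ n  <⟨ m<m+n (b ^ n) (m^n>0 b {{>-nonZero (≤-trans (s≤s z≤n) 2≤b)}} n) ⟩
  b ^ n + b ^ n  ≡⟨ cong (b ^ n +_) (+-identityʳ _) ⟨
  2 * b ^ n  ≤⟨ *-monoˡ-≤ (b ^ n) 2≤b ⟩
  b ^ suc n ∎
  where open ≤-Reasoning

largest-power : ∀ b x → 2 ≤ b → 1 ≤ x → ∃ λ a → b ^ a ≤ x × x < b ^ suc a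
largest-power b x 2≤b 1≤x = go x (n<b^n b x 2≤b)
  where
  go : ∀ k → x < b ^ k → ∃ λ a → b ^ a ≤ x × x < b ^ suc a
  go zero h = contradiction 1≤x (<⇒≱ h)
  go (suc k) h with b ^ k ≤? x
  ... | yes q = k , q , h
  ... | no q = go k (≰⇒> q)

-- `D` is the product, over the primes up to `y`, of the largest power not exceeding `x`. Each of
-- these at most y factors is at most `x`.
smooth-multiple : ∀ x y → 1 ≤ x → ∃ λ D → 1 ≤ D × D ≤ x ^ y × (∀ i → 1 ≤ i → i ≤ x → Smooth y i → i ∣ D)
smooth-multiple x zero 1≤x = 1 , ≤-refl , ≤-refl , λ i 1≤i _ smooth → subst (_∣ 1) (sym (smooth-0 i 1≤i smooth)) ∣-refl
smooth-multiple x (suc y) 1≤x with smooth-multiple x y 1≤x | prime? (suc y)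
... | D , 1≤D , D≤ , h | no ¬prime-p = D , 1≤D , ≤-trans D≤ (m≤n*m (x ^ y) x {{>-nonZero 1≤x}}) ,
      λ i 1≤i i≤x smooth → h i 1≤i i≤x λ p prime-p p∣i →
        Data.Sum.[ s≤s⁻¹ , (λ { refl → contradiction prime-p ¬prime-p }) ] (m≤n⇒m<n∨m≡n (smooth p prime-p p∣i))
... | D , 1≤D , D≤ , h | yes prime-p with largest-power (suc y) x (nonTrivial⇒n>1 (suc y) {{prime⇒nonTrivial prime-p}}) 1≤x
... | a , a≤ , a> = suc y ^ a * D , *-mono-≤ (m^n>0 (suc y) a) 1≤D , *-mono-≤ a≤ D≤ , divisible
  where
  divisible : ∀ i → 1 ≤ i → i ≤ x → Smooth (suc y) i → i ∣ suc y ^ a * D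
  divisible i 1≤i i≤x smooth with split-power (suc y) prime-p i 1≤i
  ... | b , zero , e , _ = contradiction (subst (1 ≤_) (trans e (*-zeroʳ (suc y ^ b))) 1≤i) λ ()
  ... | b , i′@(suc _) , e , p∤i′ = subst (_∣ suc y ^ a * D) (sym e) (*-pres-∣ power-divides (h i′ (s≤s z≤n) i′≤x smooth′))
    where
    i′≤x : i′ ≤ x
    i′≤x = ≤-trans (m≤n*m i′ (suc y ^ b) {{m^n≢0 (suc y) b}}) (≤-trans (≤-reflexive (sym e)) i≤x)
    b≤a : b ≤ a
    b≤a = ≮⇒≥ λ a<b → <⇒≱ a> (≤-trans (^-monoʳ-≤ (suc y) a<b) (≤-trans (m≤m*n (suc y ^ b) i′) (≤-trans (≤-reflexive (sym e)) i≤x)))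
    power-divides : suc y ^ b ∣ suc y ^ a
    power-divides with m≤n⇒∃[o]m+o≡n b≤a
    ... | o , refl = subst (suc y ^ b ∣_) (sym (^-distribˡ-+-* (suc y) b o)) (m∣m*n (suc y ^ o))
    smooth′ : Smooth y i′
    smooth′ p prime-p′ p∣i′ = Data.Sum.[ s≤s⁻¹ , (λ { refl → contradiction p∣i′ p∤i′ }) ]
      (m≤n⇒m<n∨m≡n (smooth p prime-p′ (subst (p ∣_) (sym e) (∣n⇒∣m*n (suc y ^ b) p∣i′))))

-- If no prime lay in this range, all numbers up to 2m + 1 would be `y`-smooth and their smooth
-- multiple, at most (2m + 1)^y, would be a common multiple of them all; by Nair's bound it would be
-- at least 2^m.
prime-between : ∀ y m → suc (m + m) ^ y < 2 ^ m → ∃ λ p → Prime p × y < p × p ≤ suc (m + m)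
prime-between y m gap with anyUpTo? (λ p → prime? p ×-dec (y <? p)) (suc (suc (m + m)))
... | yes (p , p≤ , prime-p , y<p) = p , prime-p , y<p , s≤s⁻¹ p≤
... | no none with smooth-multiple (suc (m + m)) y (s≤s z≤n)
... | D , 1≤D , D≤ , h = contradiction (common-multiple≥ D m 1≤D λ i 1≤i i≤x → h i 1≤i i≤x λ p prime-p p∣i →
        ≮⇒≥ λ y<p → none (p , s≤s (≤-trans (∣⇒≤ {{>-nonZero 1≤i}} p∣i) i≤x) , prime-p , y<p)) (<⇒≱ (≤-<-trans D≤ gap))

-- Choice of parameters

module Scale (L : ℕ) (L-large : 2 ^ 14 * L < 2 ^ L) (1≤L : 1 ≤ L) where

  open ≤-Reasoning

  pow : ∀ a b → 2 ^ a * 2 ^ b ≡ 2 ^ (a + b)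
  pow a b = sym (^-distribˡ-+-* 2 a b)

  up : ∀ {a b} → a ≤ b → 2 ^ a ≤ 2 ^ b
  up = ^-monoʳ-≤ 2

  scaled : ∀ c → c ≤ 2 ^ 14 → c * L < 2 ^ L
  scaled c h = ≤-<-trans (*-monoˡ-≤ L h) L-large

  prime-in-range : ∃ λ p → Prime p × 2 ^ (53 * L) < p × p ≤ 2 ^ (54 * L)
  prime-in-range = let (p , prime-p , lower , upper) = prime-between (2 ^ (53 * L)) m gap in p , prime-p , lower , ≤-trans upper range
    where
    e m : ℕ
    -- Taking m as a quarter of 2^(54 L) gives 2m + 1 ≤ 2^(54 L), and the gap condition of
    -- `prime-between` reduces to 216 L < 2^L.
    e = 54 * L ∸ 2
    m = 2 ^ e
    2+e : 2 + e ≡ 54 * L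
    2+e = m+[n∸m]≡n {2} {54 * L} (≤-trans (≤ᵇ⇒≤ 2 54 tt) (*-monoʳ-≤ 54 1≤L))
    four : 4 * m ≡ 2 ^ (54 * L)
    four = trans (pow 2 e) (cong (2 ^_) 2+e)
    range : suc (m + m) ≤ 2 ^ (54 * L)
    range = begin
      suc (m + m)  ≤⟨ +-monoˡ-≤ (m + m) (m^n>0 2 e) ⟩
      m + (m + m)  ≤⟨ m≤m+n _ m ⟩
      m + (m + m) + m   ≡⟨ r m ⟩
      4 * m  ≡⟨ four ⟩
      2 ^ (54 * L) ∎
      where
      r : ∀ m → m + (m + m) + m ≡ 4 * m
      r = solve-∀
    exponent : 54 * L * 2 ^ (53 * L) < m
    exponent = *-cancelˡ-< 4 _ _ (begin-strict
      4 * (54 * L * 2 ^ (53 * L))    ≡⟨ r L (2 ^ (53 * L)) ⟩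
      216 * L * 2 ^ (53 * L)  <⟨ *-monoˡ-< (2 ^ (53 * L)) {{m^n≢0 2 (53 * L)}} (scaled 216 (≤ᵇ⇒≤ 216 (2 ^ 14) tt)) ⟩
      2 ^ L * 2 ^ (53 * L)  ≡⟨ trans (pow L (53 * L)) (sym four) ⟩
      4 * m ∎)
      where
      r : ∀ l w → 4 * (54 * l * w) ≡ 216 * l * w
      r = solve-∀
    gap : suc (m + m) ^ (2 ^ (53 * L)) < 2 ^ m
    gap = begin-strict
      suc (m + m) ^ (2 ^ (53 * L))  ≤⟨ ^-monoˡ-≤ (2 ^ (53 * L)) range ⟩
      (2 ^ (54 * L)) ^ (2 ^ (53 * L))    ≡⟨ ^-*-assoc 2 (54 * L) (2 ^ (53 * L)) ⟩
      2 ^ (54 * L * 2 ^ (53 * L))  <⟨ ^-monoʳ-< 2 (s≤s (s≤s z≤n)) exponent ⟩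
      2 ^ m ∎

  module _ (N : ℕ) (hN : 2 ^ 19 * N ≤ 2 ^ (162 * L)) where

    -- The factor 2^19 on `N` collects the 32 of the sampling condition, the 2^13 in `suc B` and the
    -- 2 in the bound `2 * p` for the points of a line. The exponent 162 is 56 + 2 · 53.
    not-ramsey′ : ∀ p → Prime p → 2 ^ (53 * L) < p → p ≤ 2 ^ (54 * L) → ¬ RProp 4 (2 ^ (56 * L)) N
    not-ramsey′ p prime-p p> p≤ = let (d , nonres) = Modulo.nonresidue p prime-p 2<p in
      LowerBoundNumbers.lower-bound p prime-p 2<p d nonres r B (108 * L) (165 * L) n N r≤ low≤ B-large p≤B squares sizes exponent N-small
      where
      n = 2 ^ (56 * L)
      r = p / 16
      -- Since p ≤ 32 r, the condition 8 p³ ≤ r² (B + 1) holds as soon as B + 1 is 8 · 32² p = 2^13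
      -- p.
      B = pred (2 ^ 13 * p)
      16≤p : 16 ≤ p
      16≤p = ≤-trans (up {4} {53 * L} (≤-trans (≤ᵇ⇒≤ 4 53 tt) (*-monoʳ-≤ 53 1≤L))) (<⇒≤ p>)
      2<p : 2 < p
      2<p = ≤-trans (≤ᵇ⇒≤ 3 16 tt) 16≤p
      1≤p : 1 ≤ p
      1≤p = ≤-trans (≤ᵇ⇒≤ 1 3 tt) 2<p
      sB : suc B ≡ 2 ^ 13 * p
      sB = suc-pred (2 ^ 13 * p) {{m*n≢0 (2 ^ 13) p {{_}} {{>-nonZero 1≤p}}}}
      r≤ : 16 * r ≤ p
      r≤ = ≤-trans (≤-reflexive (*-comm 16 r)) (m/n*n≤m p 16)
      1≤r : 1 ≤ r
      1≤r = 16≤⇒ r (≤-trans 16≤p (≤-reflexive (m≡m%n+[m/n]*n p 16)))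
        where
        16≤⇒ : ∀ r → 16 ≤ p % 16 + r * 16 → 1 ≤ r
        16≤⇒ zero h = contradiction (≤-trans h (≤-reflexive (+-identityʳ _))) (<⇒≱ (m%n<n p 16))
        16≤⇒ (suc r) h = s≤s z≤n
      p≤32r : p ≤ 32 * r
      p≤32r = begin
        p  ≡⟨ m≡m%n+[m/n]*n p 16 ⟩
        p % 16 + r * 16  ≤⟨ +-monoˡ-≤ (r * 16) (<⇒≤ (m%n<n p 16)) ⟩
        16 + r * 16  ≤⟨ +-monoˡ-≤ (r * 16) (≤-trans (≤-reflexive (sym (*-identityʳ 16))) (*-monoʳ-≤ 16 1≤r)) ⟩
        16 * r + r * 16  ≡⟨ e r ⟩
        32 * r ∎
        where
        e : ∀ r → 16 * r + r * 16 ≡ 32 * r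
        e = solve-∀
      squares : p * p ≤ 2 ^ (108 * L)
      squares = ≤-trans (*-mono-≤ p≤ p≤) (≤-reflexive (trans (pow (54 * L) (54 * L)) (cong (2 ^_) (sym (*-distribʳ-+ L 54 54)))))
      low≤ : p * (p * (p * p)) ≤ 4 ^ r
      low≤ = begin
        p * (p * (p * p))  ≡⟨ e₁ p ⟩
        (p * p) * (p * p)  ≤⟨ *-mono-≤ squares squares ⟩
        2 ^ (108 * L) * 2 ^ (108 * L)  ≡⟨ trans (pow (108 * L) (108 * L)) (cong (2 ^_) (sym (*-distribʳ-+ L 108 108))) ⟩
        2 ^ (216 * L)  ≤⟨ up (*-cancelˡ-≤ {216 * L} {2 * r} 16 enough) ⟩
        2 ^ (2 * r)  ≡⟨ ^-*-assoc 2 2 r ⟨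
        4 ^ r ∎
        where
        e₁ : ∀ p → p * (p * (p * p)) ≡ (p * p) * (p * p)
        e₁ = solve-∀
        e₂ : ∀ l → 16 * (216 * l) ≡ 3456 * l
        e₂ = solve-∀
        e₃ : ∀ r → 32 * r ≡ 16 * (2 * r)
        e₃ = solve-∀
        enough : 16 * (216 * L) ≤ 16 * (2 * r)
        enough = begin
          16 * (216 * L)    ≡⟨ e₂ L ⟩
          3456 * L  ≤⟨ <⇒≤ (scaled 3456 (≤ᵇ⇒≤ 3456 (2 ^ 14) tt)) ⟩
          2 ^ L  ≤⟨ up (m≤n*m L 53) ⟩
          2 ^ (53 * L)  ≤⟨ <⇒≤ p> ⟩
          p  ≤⟨ p≤32r ⟩
          32 * r  ≡⟨ e₃ r ⟩
          16 * (2 * r) ∎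
      B-large : 8 * (p * (p * p)) ≤ r * r * suc B
      B-large = begin
        8 * (p * (p * p))  ≤⟨ *-monoʳ-≤ 8 (*-monoʳ-≤ p (*-mono-≤ p≤32r p≤32r)) ⟩
        8 * (p * ((32 * r) * (32 * r)))    ≡⟨ e p r ⟩
        r * r * (8192 * p)  ≡⟨ cong (r * r *_) sB ⟨
        r * r * suc B ∎
        where
        e : ∀ p r → 8 * (p * ((32 * r) * (32 * r))) ≡ r * r * (8192 * p)
        e = solve-∀
      p≤B : p ≤ suc B
      p≤B = ≤-trans (m≤n*m p (2 ^ 13)) (≤-reflexive (sym sB))
      sizes : 1 + n * (p * p) ≤ 2 ^ (165 * L)
      sizes = begin
        1 + n * (p * p)  ≤⟨ +-mono-≤ (m^n>0 2 (164 * L)) (≤-trans (*-monoʳ-≤ n squares) (≤-reflexive (trans (pow (56 * L) (108 * L)) (cong (2 ^_) (sym (*-distribʳ-+ L 56 108)))))) ⟩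
        2 ^ (164 * L) + 2 ^ (164 * L)  ≡⟨ cong (2 ^ (164 * L) +_) (+-identityʳ _) ⟨
        2 ^ (1 + 164 * L)  ≤⟨ up (+-monoˡ-≤ (164 * L) 1≤L) ⟩
        2 ^ (165 * L) ∎
      -- Both the choices per round and the number of halvings contribute a factor L. Each of them,
      -- with its share 2^14 of the constants, is below 2^L, which uses up the distance from 54 to
      -- 56.
      exponent : 165 * L * (suc B * (108 * L)) < n
      exponent = begin-strict
        165 * L * (suc B * (108 * L))  ≡⟨ cong (λ b → 165 * L * (b * (108 * L))) sB ⟩
        165 * L * (2 ^ 13 * p * (108 * L))  ≡⟨ e L (2 ^ 13) p ⟩
        17820 * 2 ^ 13 * (p * (L * L))  ≤⟨ *-monoˡ-≤ (p * (L * L)) (≤ᵇ⇒≤ (17820 * 2 ^ 13) (2 ^ 14 * 2 ^ 14) tt) ⟩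
        2 ^ 14 * 2 ^ 14 * (p * (L * L))  ≡⟨ e′ (2 ^ 14) p L ⟩
        p * ((2 ^ 14 * L) * (2 ^ 14 * L))  ≤⟨ *-monoˡ-≤ ((2 ^ 14 * L) * (2 ^ 14 * L)) p≤ ⟩
        2 ^ (54 * L) * ((2 ^ 14 * L) * (2 ^ 14 * L)) <⟨ *-monoʳ-< (2 ^ (54 * L)) {{m^n≢0 2 (54 * L)}} (*-mono-< L-large L-large) ⟩
        2 ^ (54 * L) * (2 ^ L * 2 ^ L)  ≡⟨ trans (cong (2 ^ (54 * L) *_) (pow L L)) (trans (pow (54 * L) (L + L)) (cong (2 ^_) (e″ L))) ⟩
        n ∎
        where
        e : ∀ l b p → 165 * l * (b * p * (108 * l)) ≡ 17820 * b * (p * (l * l))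
        e = solve-∀
        e′ : ∀ b p l → b * b * (p * (l * l)) ≡ p * ((b * l) * (b * l))
        e′ = solve-∀
        e″ : ∀ l → 54 * l + (l + l) ≡ 56 * l
        e″ = solve-∀
      N-small : 32 * (N * (suc B * (2 * p))) ≤ n * (p * (p * (p * p)))
      N-small = begin
        32 * (N * (suc B * (2 * p)))  ≡⟨ cong (λ b → 32 * (N * (b * (2 * p)))) sB ⟩
        32 * (N * (2 ^ 13 * p * (2 * p)))  ≡⟨ e N p ⟩
        2 ^ 19 * N * (p * p)  ≤⟨ *-monoˡ-≤ (p * p) hN ⟩
        2 ^ (162 * L) * (p * p)  ≡⟨ cong (_* (p * p)) (trans (cong (2 ^_) (e′ L)) (trans (sym (pow (56 * L) _)) (cong (n *_) (sym (pow (53 * L) (53 * L)))))) ⟩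
        n * (2 ^ (53 * L) * 2 ^ (53 * L)) * (p * p) ≤⟨ *-monoˡ-≤ (p * p) (*-monoʳ-≤ n (*-mono-≤ (<⇒≤ p>) (<⇒≤ p>))) ⟩
        n * (p * p) * (p * p)  ≡⟨ e″ n p ⟩
        n * (p * (p * (p * p))) ∎
        where
        e : ∀ N p → 32 * (N * (8192 * p * (2 * p))) ≡ 524288 * N * (p * p)
        e = solve-∀
        e′ : ∀ l → 162 * l ≡ 56 * l + (53 * l + 53 * l)
        e′ = solve-∀
        e″ : ∀ n p → n * (p * p) * (p * p) ≡ n * (p * (p * (p * p)))
        e″ = solve-∀

    not-ramsey : ¬ RProp 4 (2 ^ (56 * L)) N
    not-ramsey = let (p , prime-p , p> , p≤) = prime-in-range in not-ramsey′ p prime-p p> p≤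

-- Writing `L` as `s + t` gives `L < suc s * 2 ^ t`, so the single inequality 2^14 · 31 ≤ 2^30
-- settles every `L` from 30 on.
linear<exponential : ∀ L → 30 ≤ L → 2 ^ 14 * L < 2 ^ L
linear<exponential L h = go 30 14 (≤ᵇ⇒≤ (2 ^ 14 * 31) (2 ^ 30) tt) (m≤n⇒∃[o]m+o≡n h)
  where
  open ≤-Reasoning
  e : ∀ a s w → a * (s * w + w) ≡ a * suc s * w
  e a s w = trans (cong (a *_) (+-comm (s * w) w)) (sym (*-assoc a (suc s) w))
  go : ∀ s r → 2 ^ r * suc s ≤ 2 ^ s → (∃ λ t → s + t ≡ L) → 2 ^ r * L < 2 ^ L
  go s r hs (t , s+t) = begin-strict
    2 ^ r * L  ≡⟨ cong (2 ^ r *_) s+t ⟨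
    2 ^ r * (s + t)  <⟨ *-monoʳ-< (2 ^ r) {{m^n≢0 2 r}} (+-mono-≤-< (m≤m*n s (2 ^ t) {{m^n≢0 2 t}}) (n<b^n 2 t ≤-refl)) ⟩
    2 ^ r * (s * 2 ^ t + 2 ^ t)  ≡⟨ e (2 ^ r) s (2 ^ t) ⟩
    2 ^ r * suc s * 2 ^ t  ≤⟨ *-monoˡ-≤ (2 ^ t) hs ⟩
    2 ^ s * 2 ^ t  ≡⟨ ^-distribˡ-+-* 2 s t ⟨
    2 ^ (s + t)  ≡⟨ cong (2 ^_) s+t ⟩
    2 ^ L ∎

-- M = L + 1 is kept as a variable, since a power of 2 with a literal summand in its exponent unfolds.
module Comparison (k L M : ℕ) (M≡ : M ≡ suc L) (L-large : 183 + k ≤ L) where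

  open ≤-Reasoning

  1≤L : 1 ≤ L
  1≤L = ≤-trans (s≤s z≤n) L-large

  open Scale L (linear<exponential L (≤-trans (≤ᵇ⇒≤ 30 183 tt) (≤-trans (m≤m+n 183 k) L-large))) 1≤L

  u T₀ : ℕ
  u = 2 ^ (8 * M)
  T₀ = suc (u ^ 7 * (8 * u ^ 13))

  u^7 : u ^ 7 ≡ 2 ^ (56 * M)
  u^7 = trans (^-*-assoc 2 (8 * M) 7) (cong (2 ^_) (e M))
    where
    e : ∀ l → 8 * l * 7 ≡ 56 * l
    e = solve-∀

  T₀≤ : T₀ ≤ 2 ^ 4 * 2 ^ (160 * M)
  T₀≤ = begin
    suc (u ^ 7 * (8 * u ^ 13))  ≡⟨ cong suc (trans (e₁ (u ^ 7) (u ^ 13)) (cong (8 *_) (sym (^-distribˡ-+-* u 7 13)))) ⟩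
    1 + 8 * u ^ 20  ≤⟨ +-monoˡ-≤ (8 * u ^ 20) (≤-trans (m^n>0 u {{m^n≢0 2 (8 * M)}} 20) (m≤n*m (u ^ 20) 8)) ⟩
    8 * u ^ 20 + 8 * u ^ 20  ≡⟨ *-distribʳ-+ (u ^ 20) 8 8 ⟨
    2 ^ 4 * u ^ 20  ≡⟨ cong (2 ^ 4 *_) (trans (^-*-assoc 2 (8 * M) 20) (cong (2 ^_) (e₂ M))) ⟩
    2 ^ 4 * 2 ^ (160 * M) ∎
    where
    e₁ : ∀ a b → a * (8 * b) ≡ 8 * (a * b)
    e₁ = solve-∀
    e₂ : ∀ l → 8 * l * 20 ≡ 160 * l
    e₂ = solve-∀

  -- The 183 in `L-large` is 19 for the constants of the lower bound, 4 for those of `T₀` and 160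
  -- for the step from `L` to `M`; `k` stands for the factor 2^k above `k`. One of the two surplus
  -- multiples of `L` covers all of this.
  exponents : 19 + (k + (4 + 160 * M)) ≤ 162 * L
  exponents = begin
    19 + (k + (4 + 160 * M))  ≡⟨ cong (λ m → 19 + (k + (4 + 160 * m))) M≡ ⟩
    19 + (k + (4 + 160 * suc L))  ≡⟨ e k L ⟩
    183 + k + 160 * L  ≤⟨ +-monoˡ-≤ (160 * L) L-large ⟩
    161 * L  ≤⟨ *-monoˡ-≤ L (n≤1+n 161) ⟩
    162 * L ∎
    where
    e : ∀ k l → 19 + (k + (4 + 160 * (1 + l))) ≡ 183 + k + 160 * l
    e = solve-∀

  product-small : 2 ^ 19 * (k * T₀) ≤ 2 ^ (162 * L)
  product-small = begin
    2 ^ 19 * (k * T₀)  ≤⟨ *-monoʳ-≤ (2 ^ 19) (*-mono-≤ (<⇒≤ (n<b^n 2 k ≤-refl)) T₀≤) ⟩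
    2 ^ 19 * (2 ^ k * (2 ^ 4 * 2 ^ (160 * M)))     ≡⟨ cong (λ z → 2 ^ 19 * (2 ^ k * z)) (pow 4 (160 * M)) ⟩
    2 ^ 19 * (2 ^ k * 2 ^ (4 + 160 * M))  ≡⟨ cong (2 ^ 19 *_) (pow k (4 + 160 * M)) ⟩
    2 ^ 19 * 2 ^ (k + (4 + 160 * M))  ≡⟨ pow 19 (k + (4 + 160 * M)) ⟩
    2 ^ (19 + (k + (4 + 160 * M)))  ≤⟨ up {19 + (k + (4 + 160 * M))} {162 * L} exponents ⟩
    2 ^ (162 * L) ∎

  -- For n between two consecutive scales, t(4,n) is bounded at the upper scale and r(4,n) at the
  -- lower one, both Ramsey properties being antitone in n.
  ratio-large : ∀ n → 2 ^ (56 * L) ≤ n → n ≤ 2 ^ (56 * M) → Σ ℕ λ T → Σ ℕ λ R → IsT 4 n T × IsR 4 n R × k * T < R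
  ratio-large n lower upper =
    let (T , isT , T≤) = least (TProp? 4 n) T₀ (TProp-antitone (≤-trans upper (≤-reflexive (sym u^7))) (TProp-power u T₀ (m^n>0 2 (8 * M)) ≤-refl))
        (R , isR , _) = least (RProp? 4 n) (suc (n * suc (n * n))) (RProp-cubic n _ ≤-refl)
    in T , R , isT , isR , ≰⇒> λ R≤kT → not-ramsey (k * T₀) product-small
         (RProp-antitone lower (RProp-monotone (≤-trans R≤kT (*-monoʳ-≤ k T≤)) (proj₁ isR)))

-- The limit without division: for every `k` the ratio is eventually below 1/k. The two numbers are
-- produced together with their minimality, so their existence is part of the claim.
theorem1p2 : (k : ℕ) → Σ ℕ λ n₀ → (n : ℕ) → n₀ ≤ n →
    Σ ℕ λ T → Σ ℕ λ R → IsT 4 n T × IsR 4 n R × k * T < R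
theorem1p2 k = at-scale (2 ^ 56) refl (183 + k) refl
  where
  -- The base 2^56 and the exponent are passed as variables with equations, so that the power
  -- `b ^ c` does not unfold.
  at-scale : ∀ b → b ≡ 2 ^ 56 → ∀ c → c ≡ 183 + k →
    Σ ℕ λ n₀ → (n : ℕ) → n₀ ≤ n → Σ ℕ λ T → Σ ℕ λ R → IsT 4 n T × IsR 4 n R × k * T < R
  at-scale b b≡ c c≡ = b ^ c , λ n h → between n h (largest-power b n 2≤b (≤-trans (m^n>0 b {{>-nonZero (≤-trans (s≤s z≤n) 2≤b)}} c) h))
    where
    2≤b : 2 ≤ b
    2≤b = ≤-trans (≤ᵇ⇒≤ 2 (2 ^ 56) tt) (≤-reflexive (sym b≡))
    b^ : ∀ m → b ^ m ≡ 2 ^ (56 * m)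
    b^ m = trans (cong (_^ m) b≡) (^-*-assoc 2 56 m)
    between : ∀ n → b ^ c ≤ n → (∃ λ L → b ^ L ≤ n × n < b ^ suc L) → Σ ℕ λ T → Σ ℕ λ R → IsT 4 n T × IsR 4 n R × k * T < R
    between n h (L , lower , upper) = Comparison.ratio-large k L (suc L) refl
      (≤-trans (≤-reflexive (sym c≡)) (≮⇒≥ λ L<c → <⇒≱ upper (≤-trans (^-monoʳ-≤ b {{>-nonZero (≤-trans (s≤s z≤n) 2≤b)}} L<c) h)))
      n (≤-trans (≤-reflexive (sym (b^ L))) lower) (≤-trans (<⇒≤ upper) (≤-reflexive (b^ (suc L))))
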